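{- Let $\mathbf{F}$ be a good class of finite nontrivial Steiner triple systems, and let $\mathbf{K}$ be the class of all finite $\mathbf{F}$-free Steiner triple systems. Then $\mathbf{K}$ is an amalgamation class containing countably infinitely many pairwise nonisomorphic elements. Consequently, the Fraïssé limit of $\mathbf{K}$ is a homogeneous locally finite Steiner triple system of countably infinite order.
   Context: A Steiner triple system (STS) is a pair $(V,\mathcal{B})$ with $\mathcal{B}$ a set of 3-subsets (blocks) of $V$ such that every pair of points lies in exactly one block; its order is $|V|$. It is nontrivial if its order is greater than 3. An isomorphism of STSs is a bijection of point sets mapping blocks exactly onto blocks. A subsystem of $(V,\mathcal{B})$ is an STS $(V',\mathcal{B}')$ with $V'\subseteq V$, $\mathcal{B}'\subseteq\mathcal{B}$. STSs are regarded as structures with the binary operation $x\circ x=x$ and $x\circ y=z$ where $\{x,y,z\}$ is the block containing $x,y$; thus substructures are exactly subsystems, and a finitely generated subsystem is the smallest subsystem containing a given finite set of points. For a class $\mathbf{F}$ of finite nontrivial STSs, an STS is $\mathbf{F}$-free if none of its subsystems is isomorphic to a member of $\mathbf{F}$; $\mathbf{F}$ is good if there is a finite $\mathbf{F}$-free STS that is not isomorphic to any subsystem of any member of $\mathbf{F}$. A class $\mathbf{K}$ of finitely generated structures is an amalgamation class if it is nonempty and has: countably many members up to isomorphism; the hereditary property (finitely generated substructures of members are isomorphic to members); the joint embedding property (any two members embed, as substructures up to isomorphism, into a common member); and the amalgamation property (if $A,B,C\in\mathbf{K}$ and $f:A\to B$, $g:A\to C$ are isomorphisms onto substructures, there exist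 $D\in\mathbf{K}$ and isomorphisms $f',g'$ from $B,C$ onto substructures of $D$ with $f'\circ f=g'\circ g$). By Fraïssé's theorem such a class has a unique countable homogeneous structure (its Fraïssé limit) whose finitely generated substructures are, up to isomorphism, exactly the members of $\mathbf{K}$. A countable STS is homogeneous if every isomorphism between two finitely generated subsystems extends to an automorphism, and locally finite if every finite set of points is contained in a finite subsystem. -}

module Defs where

open import Level using (0ℓ) renaming (suc to lsuc)
open import Data.Nat using (ℕ; _<_)
open import Data.Fin using (Fin)
open import Data.Product using (Σ; ∃; _×_; _,_; ∃-syntax; proj₁)
open import Data.List using (List)
open import Data.List.Membership.Propositional using (_∈_)
open import Relation.Binary.PropositionalEquality using (_≡_; _≢_)
open import Relation.Nullary using (¬_)
open import Function.Bundles using (_⇔_)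

-- Steiner triple systems on a point set V.
-- Blocks are 3-subsets; a block {x,y,z} is represented by the relation
-- Block x y z, which is required to be invariant under permutations of
-- its arguments and to relate only pairwise distinct points.  Thus the
-- set of blocks is { {x,y,z} | Block x y z }.  "Every pair lies in exactly
-- one block" = for distinct x,y there is a z with Block x y z, and it is
-- unique.

record STS (V : Set) : Set₁ where
  field
    Block          : V → V → V → Set
    Block-distinct : ∀ {x y z} → Block x y z → x ≢ y × x ≢ z × y ≢ z
    Block-swap₁₂   : ∀ {x y z} → Block x y z → Block y x z
    Block-swap₂₃   : ∀ {x y z} → Block x y z → Block x z y
    pair-covered   : ∀ x y → x ≢ y → ∃[ z ] Block x y z
    pair-unique    : ∀ {x y z w} → Block x y z → Block x y w → z ≡ w

open STS public

record FinSTS : Set₁ where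
  constructor finSTS
  field
    order : ℕ
    sts   : STS (Fin order)

open FinSTS public

-- Embeddings (= isomorphisms onto a subsystem) and isomorphisms.
-- A map is an isomorphism onto its image (which is then automatically a
-- subsystem) iff it is injective and maps blocks exactly onto the blocks
-- lying inside the image.

IsEmbedding : ∀ {V W} → STS V → STS W → (V → W) → Set
IsEmbedding S T f =
  (∀ {x y} → f x ≡ f y → x ≡ y) ×
  (∀ x y z → Block S x y z ⇔ Block T (f x) (f y) (f z))

Embedding : ∀ {V W} → STS V → STS W → Set
Embedding {V} {W} S T = Σ (V → W) (IsEmbedding S T)

IsIso : ∀ {V W} → STS V → STS W → (V → W) → Set
IsIso {V} S T f = IsEmbedding S T f × (∀ w → ∃[ v ] f v ≡ w)

_↪_ : FinSTS → FinSTS → Set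
A ↪ B = Embedding (sts A) (sts B)

_≅_ : FinSTS → FinSTS → Set
A ≅ B = Σ (Fin (order A) → Fin (order B)) (IsIso (sts A) (sts B))

Nontrivial : FinSTS → Set
Nontrivial A = 3 < order A

Free : (FinSTS → Set) → FinSTS → Set₁
Free F A = ∀ C → F C → ¬ (C ↪ A)

Good : (FinSTS → Set) → Set₁
Good F = ∃[ G ] (Free F G × (∀ C → F C → ¬ (G ↪ C)))

record AmalgamationClass (K : FinSTS → Set₁) : Set₁ where
  field
    nonempty      : ∃[ A ] K A
    countable     : Σ (ℕ → FinSTS) λ e → ((∀ i → K (e i)) × (∀ A → K A → ∃[ i ] (A ≅ e i)))
    hereditary    : ∀ A C → K A → C ↪ A → ∃[ C′ ] (K C′ × C ≅ C′)
    jointEmbed    : ∀ A B → K A → K B → ∃[ D ] (K D × A ↪ D × B ↪ D)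
    amalgamation  : ∀ A B C → K A → K B → K C → (f : A ↪ B) (g : A ↪ C) →
                    ∃[ D ] (K D × Σ (B ↪ D) λ f′ → Σ (C ↪ D) λ g′ →
                      ∀ a → proj₁ f′ (proj₁ f a) ≡ proj₁ g′ (proj₁ g a))

InfinitelyManyNonIso : (FinSTS → Set₁) → Set₁
InfinitelyManyNonIso K =
  Σ (ℕ → FinSTS) λ e → ((∀ i → K (e i)) × (∀ i j → i ≢ j → ¬ (e i ≅ e j)))

module _ {V : Set} (M : STS V) where

  IsSubsystem : (V → Set) → Set
  IsSubsystem S = ∀ {x y z} → S x → S y → Block M x y z → S z

  GeneratedBy : (V → Set) → List V → Set₁
  GeneratedBy S xs =
    IsSubsystem S × (∀ x → x ∈ xs → S x) ×
    (∀ (T : V → Set) → IsSubsystem T → (∀ x → x ∈ xs → T x) → ∀ x → S x → T x)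

  FinitelyGenerated : (V → Set) → Set₁
  FinitelyGenerated S = ∃[ xs ] GeneratedBy S xs

  FiniteSubset : (V → Set) → Set
  FiniteSubset S = ∃[ ys ] (∀ x → S x → x ∈ ys)

  LocallyFinite : Set₁
  LocallyFinite = ∀ (xs : List V) →
    ∃[ S ] (IsSubsystem S × (∀ x → x ∈ xs → S x) × FiniteSubset S)

  IsSubIso : (V → Set) → (V → Set) → (V → V) → Set
  IsSubIso S T φ =
    (∀ x → S x → T (φ x)) ×
    (∀ x y → S x → S y → φ x ≡ φ y → x ≡ y) ×
    (∀ y → T y → ∃[ x ] (S x × φ x ≡ y)) ×
    (∀ x y z → S x → S y → S z → Block M x y z ⇔ Block M (φ x) (φ y) (φ z))

  IsAutomorphism : (V → V) → Set
  IsAutomorphism σ = IsIso M M σ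

  Homogeneous : Set₁
  Homogeneous = ∀ (S T : V → Set) (φ : V → V) →
    FinitelyGenerated S → FinitelyGenerated T → IsSubIso S T φ →
    ∃[ σ ] (IsAutomorphism σ × (∀ x → S x → σ x ≡ φ x))

  HasAge : (FinSTS → Set₁) → Set₁
  HasAge K =
    (∀ (S : V → Set) → FinitelyGenerated S →
       ∃[ A ] (K A × Σ (Embedding (sts A) M) λ g →
         (∀ i → S (proj₁ g i)) × (∀ x → S x → ∃[ i ] (proj₁ g i ≡ x)))) ×
    (∀ A → K A → Embedding (sts A) M)

{-# OPTIONS --safe #-}

-- The amalgam D of B and C over A is built so that each of its nontrivial subsystems lies in B, in C or in a
-- system G that is F-free and embeds in no member of F, or else contains G; such a D is F-free.
-- The blocks of B ∪ C become lines of a projective space over 𝔽₂ after trades.  For every other block of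
-- this space we pass to a cover twisted at that block, whose fibres are copies of an extension of G minus a
-- point.  A subsystem meeting each fibre at most once is a section; a parity argument shows that there is no
-- section over a subsystem of order greater than 3 containing the twisted block, so only subsystems all of
-- whose blocks come from B ∪ C, hence subsystems of B or of C, remain.  A subsystem with two points in one fibre
-- and points outside it is invariant under a translation of the fibres, which forces it to contain G.
-- The extension of G has order 2g + 1, and its subsystems are trivial, inside G or contain G: it is the doubling
-- of G along a one-factorization of K_{g+1} with suitably labelled colours.
-- The limit is the union of a chain in which every extension problem is eventually solved; as the amalgamation
-- is strong, the stages can be taken to be initial segments of ℕ.

module Submission where

open import Defs
open import Level using (0ℓ) renaming (suc to lsuc)
open import Axiom.ExcludedMiddle using (ExcludedMiddle)
open import Axiom.UniquenessOfIdentityProofs using (module Decidable⇒UIP)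
open import Data.Bool using (Bool; true; false; not; _xor_; if_then_else_)
import Data.Bool.Properties as 𝔹
import Data.Bool.Solver
open import Data.Empty using (⊥; ⊥-elim)
open import Data.Fin using (Fin; zero; suc; toℕ; fromℕ<; _≟_; _↑ˡ_; _↑ʳ_; splitAt)
open import Data.Fin.Properties using (toℕ-injective; toℕ-fromℕ<; toℕ<n; toℕ-↑ˡ; toℕ-↑ʳ; suc-injective; ↑ˡ-injective; ↑ʳ-injective; splitAt-↑ˡ; splitAt-↑ʳ; splitAt⁻¹-↑ˡ; injective⇒≤; any?; +↔⊎; *↔×; 2↔Bool)
open import Data.List using (List; []; _∷_; tabulate; upTo)
open import Data.List.Membership.Propositional using (_∈_)
open import Data.List.Membership.Propositional.Properties using (∈-tabulate⁺; ∈-tabulate⁻; ∈-upTo⁺)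
import Data.List.Properties as Listₚ
open import Data.List.Relation.Unary.Any using (here; there)
open import Data.Maybe using (Maybe; just; nothing)
import Data.Maybe.Properties as Maybeₚ
open import Data.Maybe.Properties using (just-injective)
open import Data.Nat using (ℕ; zero; suc; _+_; _*_; _∸_; _⊔_; _≤_; _<_; z≤n; s≤s; _<?_; _≤′_; ≤′-refl; ≤′-step)
open import Data.Nat.DivMod using (_%_; m%n<n; m<n⇒m%n≡m; m%n%n≡m%n; %-distribˡ-+; m*n%n≡0; [m+n]%n≡m%n)
open import Data.Nat.Divisibility using (_∣_; divides; ∣m+n∣m⇒∣n; m%n≡0⇒n∣m; ∣⇒≤; _∣?_)
import Data.Nat.Properties as ℕₚ
import Data.Nat.Solver
open import Data.Product using (Σ; _×_; _,_; ∃-syntax; proj₁; proj₂)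
open import Data.Product.Function.NonDependent.Propositional using (_×-↔_)
import Data.Product.Properties as Prodₚ
open import Data.Sum using (_⊎_; inj₁; inj₂; [_,_]′)
open import Data.Sum.Function.Propositional using (_⊎-↔_)
open import Data.Sum.Properties using (inj₁-injective; inj₂-injective)
open import Data.Vec using (Vec; []; _∷_; lookup; zipWith; replicate)
import Data.Vec as Vec
import Data.Vec.Properties as Vecₚ
open import Function using (_∘_; id)
open import Function.Bundles using (_⇔_; mk⇔; Equivalence; _↔_; mk↔ₛ′; Inverse)
open import Function.Properties.Inverse using (↔-refl; ↔-sym; ↔-trans)
open import Relation.Binary.Definitions using (DecidableEquality; tri<; tri≈; tri>)
open import Relation.Binary.PropositionalEquality hiding ([_])
open import Relation.Nullary using (¬_; Dec; yes; no; contradiction; ¬?; does)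
open import Relation.Nullary.Decidable using (from-yes)

open Data.Bool.Solver.xor-∧-Solver using (_:=_; _:+_) renaming (solve to xor-solve)
open Decidable⇒UIP 𝔹._≟_ using (≡-irrelevant)

-- Nothing is known about the subsystems of `G`, and this shapes the fibres. They are built from an
-- extension in which one new point and two old ones generate all of `G`, whatever the subsystems of
-- `G` are. Less the point ∞ such a fibre has 2g points, placed on the circle ℤ/2g. The even order
-- makes parity a homomorphism, as the section argument requires. Translation invariance must then
-- exclude the remaining subsystems: those inside `G` lie in half of the circle, which no nonzero
-- translation preserves, and the others have two or three points on the circle, so that only
-- translations of order two or three could preserve them. Order two is excluded by the placement,
-- order three by arranging that 3 does not divide g. The one-factorizations rest on halving in a
-- cyclic group of odd order. With g = 2q + 1 this calls for ℤ/q when q is odd and for ℤ/(q + 1)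
-- when q is even, hence two different constructions. Proper sub-one-factorizations may survive; the
-- labelling only has to keep their colour sets from being subsystems of `G`.

-- Steiner quasigroups and their embeddings

-- Steiner quasigroups: the operation of the paper, x ∙ x = x and x ∙ y the third point of the block.
record Squag (V : Set) : Set where
  infixl 7 _∙_
  field
    _∙_   : V → V → V
    idem  : ∀ x → x ∙ x ≡ x
    comm  : ∀ x y → x ∙ y ≡ y ∙ x
    invol : ∀ x y → x ∙ (x ∙ y) ≡ y

  invol′ : ∀ x y → (x ∙ y) ∙ y ≡ x
  invol′ x y = trans (comm (x ∙ y) y) (trans (cong (y ∙_) (comm x y)) (invol y x))

  invol″ : ∀ x y → (x ∙ y) ∙ x ≡ y
  invol″ x y = trans (comm (x ∙ y) x) (invol x y)

  cancelˡ : ∀ x {y z} → x ∙ y ≡ x ∙ z → y ≡ z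
  cancelˡ x {y} {z} e = trans (sym (invol x y)) (trans (cong (x ∙_) e) (invol x z))

  ∙≢ˡ : ∀ {x y} → x ≢ y → x ∙ y ≢ x
  ∙≢ˡ {x} {y} x≢y e = x≢y (sym (cancelˡ x (trans e (sym (idem x)))))

  ∙≢ʳ : ∀ {x y} → x ≢ y → x ∙ y ≢ y
  ∙≢ʳ {x} {y} x≢y e = ∙≢ˡ (x≢y ∘ sym) (trans (comm y x) e)

  Closed : (V → Set) → Set
  Closed S = ∀ {x y} → S x → S y → S (x ∙ y)

  Line : V → V → V → Set
  Line x y z = z ≡ x ⊎ z ≡ y ⊎ z ≡ x ∙ y

record Emb {V W : Set} (Q : Squag V) (R : Squag W) : Set where
  constructor emb
  private
    module Q = Squag Q
    module R = Squag R
  field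
    fun : V → W
    inj : ∀ {x y} → fun x ≡ fun y → x ≡ y
    hom : ∀ x y → fun (x Q.∙ y) ≡ fun x R.∙ fun y

open Emb public

emb-refl : ∀ {V} {Q : Squag V} → Emb Q Q
emb-refl = emb id id (λ _ _ → refl)

infixl 9 _⊙_
_⊙_ : ∀ {V W X} {Q : Squag V} {R : Squag W} {P : Squag X} → Emb R P → Emb Q R → Emb Q P
(g ⊙ f) = emb (fun g ∘ fun f) (inj f ∘ inj g) (λ x y → trans (cong (fun g) (hom f x y)) (hom g _ _))

-- Since `g` is injective, every law of the factor can be checked after composing with `g`; a
-- pointwise choice of preimages is enough. Inclusions of images become embeddings in this way
-- throughout.
emb-factor : ∀ {V W X} {Q : Squag V} {R : Squag W} {P : Squag X} (f : Emb Q P) (g : Emb R P) →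
             (∀ v → ∃[ w ] fun g w ≡ fun f v) → Emb Q R
emb-factor {Q = Q} {R} {P} f g h = emb k
    (λ {x} {y} e → inj f (trans (sym (proj₂ (h x))) (trans (cong (fun g) e) (proj₂ (h y)))))
    λ x y → inj g (trans (proj₂ (h (x Q.∙ y))) (trans (hom f x y)
      (trans (sym (cong₂ P._∙_ (proj₂ (h x)) (proj₂ (h y)))) (sym (hom g _ _)))))
  where
    module Q = Squag Q
    module P = Squag P
    k = λ v → proj₁ (h v)

transport : ∀ {V W} → V ↔ W → Squag V → Squag W
transport {V} {W} i Q = record
  { _∙_   = λ x y → to (from x Q.∙ from y)
  ; idem  = λ x → trans (cong to (Q.idem _)) (to-from x)
  ; comm  = λ x y → cong to (Q.comm _ _)
  ; invol = λ x y → trans (cong (λ z → to (from x Q.∙ z)) (from-to _)) (trans (cong to (Q.invol _ _)) (to-from y)) }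
  where
    module Q = Squag Q
    open Inverse i using (to; from)
    to-from : ∀ x → to (from x) ≡ x
    to-from x = Inverse.strictlyInverseˡ i x
    from-to : ∀ x → from (to x) ≡ x
    from-to x = Inverse.strictlyInverseʳ i x

module _ {V W : Set} (i : V ↔ W) where
  open Inverse i using (to; from; strictlyInverseˡ; strictlyInverseʳ)

  ↔-injective : ∀ {x y} → to x ≡ to y → x ≡ y
  ↔-injective {x} {y} e = trans (sym (strictlyInverseʳ x)) (trans (cong from e) (strictlyInverseʳ y))

  ↔-injective⁻ : ∀ {x y} → from x ≡ from y → x ≡ y
  ↔-injective⁻ {x} {y} e = trans (sym (strictlyInverseˡ x)) (trans (cong to e) (strictlyInverseˡ y))

  transport-to : (Q : Squag V) → Emb Q (transport i Q)
  transport-to Q = emb to ↔-injective λ x y → sym (cong₂ (λ a b → to (Squag._∙_ Q a b)) (strictlyInverseʳ x) (strictlyInverseʳ y))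

  transport-from : (Q : Squag V) → Emb (transport i Q) Q
  transport-from Q = emb from ↔-injective⁻ λ x y → strictlyInverseʳ _

-- Finite sets: counting and enumeration

injective-surjective : ∀ {n} (f : Fin n → Fin n) → (∀ {x y} → f x ≡ f y → x ≡ y) → ∀ y → ∃[ x ] f x ≡ y
injective-surjective {n} f f-inj y with any? (λ x → f x ≟ y)
... | yes p = p
... | no ¬p = contradiction (injective⇒≤ {f = g} g-inj) ℕₚ.1+n≰n
  where
    g : Fin (suc n) → Fin n
    g zero    = y
    g (suc x) = f x
    g-inj : ∀ {a b} → g a ≡ g b → a ≡ b
    g-inj {zero}  {zero}  _ = refl
    g-inj {zero}  {suc b} e = contradiction (b , sym e) ¬p
    g-inj {suc a} {zero}  e = contradiction (a , e) ¬p
    g-inj {suc a} {suc b} e = cong suc (f-inj e)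

Fin-↔-≡ : ∀ {m n} → Fin m ↔ Fin n → m ≡ n
Fin-↔-≡ i = ℕₚ.≤-antisym (injective⇒≤ {f = Inverse.to i} (↔-injective i)) (injective⇒≤ {f = Inverse.from i} (↔-injective⁻ i))

record Enum {n} (P : Fin n → Set) : Set where
  field
    size     : ℕ
    elem     : Fin size → Fin n
    elem-inj : ∀ {i j} → elem i ≡ elem j → i ≡ j
    sound    : ∀ i → P (elem i)
    index    : ∀ x → P x → ∃[ i ] elem i ≡ x

enum : ∀ {n} {P : Fin n → Set} → (∀ x → Dec (P x)) → Enum P
enum {zero} P? = record { size = 0 ; elem = λ () ; elem-inj = λ { {()} } ; sound = λ () ; index = λ () }
enum {suc n} {P} P? with P? zero | enum {n} {P ∘ suc} (P? ∘ suc)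
... | no ¬p | E = record
  { size = size ; elem = suc ∘ elem ; elem-inj = elem-inj ∘ suc-injective ; sound = sound
  ; index = λ { zero p → contradiction p ¬p ; (suc x) p → proj₁ (index x p) , cong suc (proj₂ (index x p)) } }
  where open Enum E
... | yes p | E = record
  { size = suc size ; elem = el
  ; elem-inj = λ { {zero} {zero} _ → refl ; {suc i} {suc j} e → cong suc (elem-inj (suc-injective e)) }
  ; sound = λ { zero → p ; (suc i) → sound i }
  ; index = λ { zero _ → zero , refl ; (suc x) q → suc (proj₁ (index x q)) , cong suc (proj₂ (index x q)) } }
  where
    open Enum E
    el : Fin (suc size) → Fin (suc n)
    el zero    = zero
    el (suc i) = suc (elem i)

-- Passing between block systems and quasigroups

-- Blocks have distinct points while the operation is idempotent, hence the clause `x ≢ y`. As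
-- `Block` may be any `Set`-valued relation, a system and its quasigroup are compared by logical
-- equivalence.
Represents : ∀ {V} → STS V → Squag V → Set
Represents S Q = ∀ x y z → Block S x y z ⇔ (x ≢ y × Squag._∙_ Q x y ≡ z)

toSTS : ∀ {V} → Squag V → STS V
toSTS Q = record
  { Block = λ x y z → x ≢ y × x ∙ y ≡ z
  ; Block-distinct = λ { {x} {y} (n , refl) → n , (∙≢ˡ n ∘ sym) , (∙≢ʳ n ∘ sym) }
  ; Block-swap₁₂ = λ { {x} {y} (n , refl) → (n ∘ sym) , comm y x }
  ; Block-swap₂₃ = λ { {x} {y} (n , refl) → (∙≢ˡ n ∘ sym) , invol x y }
  ; pair-covered = λ x y n → x ∙ y , n , refl
  ; pair-unique = λ { (_ , e) (_ , e′) → trans (sym e) e′ } }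
  where open Squag Q

toSTS-represents : ∀ {V} (Q : Squag V) → Represents (toSTS Q) Q
toSTS-represents Q x y z = mk⇔ id id

module _ {V : Set} (_≟ⱽ_ : DecidableEquality V) (S : STS V) where
  private
    op : V → V → V
    op x y with x ≟ⱽ y
    ... | yes _ = x
    ... | no n  = proj₁ (pair-covered S x y n)

    op-idem : ∀ x → op x x ≡ x
    op-idem x with x ≟ⱽ x
    ... | yes _ = refl
    ... | no n  = contradiction refl n

    op-block : ∀ {x y} → x ≢ y → Block S x y (op x y)
    op-block {x} {y} n with x ≟ⱽ y
    ... | yes e = contradiction e n
    ... | no n′ = proj₂ (pair-covered S x y n′)

    op-comm : ∀ x y → op x y ≡ op y x
    op-comm x y with x ≟ⱽ y
    ... | yes refl = sym (op-idem x)
    ... | no n = pair-unique S (proj₂ (pair-covered S x y n)) (Block-swap₁₂ S (op-block (n ∘ sym)))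

    op-invol : ∀ x y → op x (op x y) ≡ y
    op-invol x y with x ≟ⱽ y
    ... | yes refl = op-idem x
    ... | no n with proj₂ (pair-covered S x y n)
    ... | b = pair-unique S (op-block (proj₁ (proj₂ (Block-distinct S b)))) (Block-swap₂₃ S b)

  ofSTS : Squag V
  ofSTS = record { _∙_ = op ; idem = op-idem ; comm = op-comm ; invol = op-invol }

  ofSTS-represents : Represents S ofSTS
  ofSTS-represents x y z = mk⇔
    (λ b → proj₁ (Block-distinct S b) , pair-unique S (op-block (proj₁ (Block-distinct S b))) b)
    λ { (n , refl) → op-block n }

module _ {V W : Set} {S : STS V} {T : STS W} {Q : Squag V} {R : Squag W}
         (S≈Q : Represents S Q) (T≈R : Represents T R) where
  private
    module Q = Squag Q
    module R = Squag R

  toEmb : DecidableEquality V → Embedding S T → Emb Q R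
  toEmb _≟ⱽ_ (f , f-inj , f-block) = emb f f-inj h
    where
      h : ∀ x y → f (x Q.∙ y) ≡ f x R.∙ f y
      h x y with x ≟ⱽ y
      ... | yes refl = trans (cong f (Q.idem x)) (sym (R.idem (f x)))
      ... | no n = sym (proj₂ (Equivalence.to (T≈R _ _ _) (Equivalence.to (f-block x y _) (Equivalence.from (S≈Q _ _ _) (n , refl)))))

  fromEmb : Emb Q R → Embedding S T
  fromEmb e = fun e , inj e , λ x y z → mk⇔
    (λ b → let n , q = Equivalence.to (S≈Q x y z) b in
           Equivalence.from (T≈R _ _ _) ((n ∘ inj e) , trans (sym (hom e x y)) (cong (fun e) q)))
    (λ b → let n , q = Equivalence.to (T≈R _ _ _) b in
           Equivalence.from (S≈Q x y z) ((n ∘ cong (fun e)) , inj e (trans (hom e x y) q)))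

-- Abelian groups, a solver for them, and cyclic groups

record Ab (A : Set) : Set where
  infixl 6 _⊕_ _⊝_
  infix 8 ⊖_
  field
    _⊕_     : A → A → A
    𝟘       : A
    ⊖_      : A → A
    assoc   : ∀ x y z → (x ⊕ y) ⊕ z ≡ x ⊕ (y ⊕ z)
    comm    : ∀ x y → x ⊕ y ≡ y ⊕ x
    identʳ  : ∀ x → x ⊕ 𝟘 ≡ x
    inverseʳ : ∀ x → x ⊕ ⊖ x ≡ 𝟘

  _⊝_ : A → A → A
  x ⊝ y = x ⊕ ⊖ y

  infixr 7 _·_
  _·_ : ℕ → A → A
  zero  · a = 𝟘
  suc n · a = a ⊕ n · a

  cancelʳ : ∀ {x y} z → x ⊕ z ≡ y ⊕ z → x ≡ y
  cancelʳ {x} {y} z e = trans (lemma x) (trans (cong (_⊕ ⊖ z) e) (sym (lemma y)))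
    where
      lemma : ∀ x → x ≡ x ⊕ z ⊕ ⊖ z
      lemma x = sym (trans (assoc x z (⊖ z)) (trans (cong (x ⊕_) (inverseʳ z)) (identʳ x)))

  swap : ∀ a b c d → (a ⊕ b) ⊕ (c ⊕ d) ≡ (a ⊕ c) ⊕ (b ⊕ d)
  swap a b c d = trans (assoc a b _) (trans (cong (a ⊕_) (trans (sym (assoc b c d))
    (trans (cong (_⊕ d) (comm b c)) (assoc c b d)))) (sym (assoc a c _)))

  ·-+ : ∀ m n a → (m + n) · a ≡ m · a ⊕ n · a
  ·-+ zero    n a = sym (trans (comm _ _) (identʳ _))
  ·-+ (suc m) n a = trans (cong (a ⊕_) (·-+ m n a)) (sym (assoc a _ _))

  ·-⊕ : ∀ n a b → n · (a ⊕ b) ≡ n · a ⊕ n · b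
  ·-⊕ zero    a b = sym (identʳ 𝟘)
  ·-⊕ (suc n) a b = trans (cong ((a ⊕ b) ⊕_) (·-⊕ n a b)) (swap a b _ _)

-- A decision procedure for identities in abelian groups: an expression is normalised to a difference
-- of two linear forms with natural coefficients.
data Expr (n : ℕ) : Set where
  var       : Fin n → Expr n
  _:⊕_ _:-_ : Expr n → Expr n → Expr n
  :0        : Expr n

infixl 6 _:⊕_ _:-_

pattern v₀ = var zero
pattern v₁ = var (suc zero)
pattern v₂ = var (suc (suc zero))
pattern v₃ = var (suc (suc (suc zero)))
pattern v₄ = var (suc (suc (suc (suc zero))))

module AbSolver {A : Set} (𝔸 : Ab A) where
  open Ab 𝔸

  private
    unit : ∀ {n} → Fin n → Vec ℕ n
    unit zero    = 1 ∷ replicate _ 0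
    unit (suc i) = 0 ∷ unit i

    pos neg : ∀ {n} → Expr n → Vec ℕ n
    pos (var i)  = unit i
    pos (e :⊕ f) = zipWith _+_ (pos e) (pos f)
    pos (e :- f) = zipWith _+_ (pos e) (neg f)
    pos :0       = replicate _ 0
    neg (var i)  = replicate _ 0
    neg (e :⊕ f) = zipWith _+_ (neg e) (neg f)
    neg (e :- f) = zipWith _+_ (neg e) (pos f)
    neg :0       = replicate _ 0

    lin : ∀ {n} → Vec ℕ n → Vec A n → A
    lin []      []      = 𝟘
    lin (c ∷ v) (a ∷ ρ) = c · a ⊕ lin v ρ

    lin-0 : ∀ {n} (ρ : Vec A n) → lin (replicate _ 0) ρ ≡ 𝟘
    lin-0 []      = refl
    lin-0 (a ∷ ρ) = trans (cong (𝟘 ⊕_) (lin-0 ρ)) (identʳ 𝟘)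

    lin-unit : ∀ {n} (i : Fin n) (ρ : Vec A n) → lin (unit i) ρ ≡ lookup ρ i
    lin-unit zero    (a ∷ ρ) = trans (cong₂ _⊕_ (identʳ a) (lin-0 ρ)) (identʳ a)
    lin-unit (suc i) (a ∷ ρ) = trans (cong (𝟘 ⊕_) (lin-unit i ρ)) (trans (comm _ _) (identʳ _))

    lin-+ : ∀ {n} (u v : Vec ℕ n) (ρ : Vec A n) → lin (zipWith _+_ u v) ρ ≡ lin u ρ ⊕ lin v ρ
    lin-+ []      []      []      = sym (identʳ 𝟘)
    lin-+ (c ∷ u) (d ∷ v) (a ∷ ρ) = trans (cong₂ _⊕_ (·-+ c d a) (lin-+ u v ρ)) (swap _ _ _ _)

  ⟦_⟧ : ∀ {n} → Expr n → Vec A n → A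
  ⟦ var i ⟧  ρ = lookup ρ i
  ⟦ e :⊕ f ⟧ ρ = ⟦ e ⟧ ρ ⊕ ⟦ f ⟧ ρ
  ⟦ e :- f ⟧ ρ = ⟦ e ⟧ ρ ⊝ ⟦ f ⟧ ρ
  ⟦ :0 ⟧     ρ = 𝟘

  private
    correct : ∀ {n} (e : Expr n) ρ → ⟦ e ⟧ ρ ⊕ lin (neg e) ρ ≡ lin (pos e) ρ
    correct (var i)  ρ = trans (cong (lookup ρ i ⊕_) (lin-0 ρ)) (trans (identʳ _) (sym (lin-unit i ρ)))
    correct (e :⊕ f) ρ = trans (cong ((⟦ e ⟧ ρ ⊕ ⟦ f ⟧ ρ) ⊕_) (lin-+ (neg e) (neg f) ρ)) (trans (swap _ _ _ _)
      (trans (cong₂ _⊕_ (correct e ρ) (correct f ρ)) (sym (lin-+ (pos e) (pos f) ρ))))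
    correct (e :- f) ρ = trans (cong ((⟦ e ⟧ ρ ⊝ ⟦ f ⟧ ρ) ⊕_) (lin-+ (neg e) (pos f) ρ)) (trans (swap _ _ _ _)
      (trans (cong₂ _⊕_ (correct e ρ) minus) (sym (lin-+ (pos e) (neg f) ρ))))
      where
        minus : ⊖ ⟦ f ⟧ ρ ⊕ lin (pos f) ρ ≡ lin (neg f) ρ
        minus = trans (cong (⊖ ⟦ f ⟧ ρ ⊕_) (sym (correct f ρ))) (trans (sym (assoc _ _ _))
          (trans (cong (_⊕ lin (neg f) ρ) (trans (comm _ _) (inverseʳ _))) (trans (comm _ _) (identʳ _))))
    correct :0 ρ = trans (cong (𝟘 ⊕_) (lin-0 ρ)) (trans (identʳ 𝟘) (sym (lin-0 ρ)))

  -- The normal forms P - N and P′ - N′ are compared crosswise, as P + N′ and P′ + N, so the side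
  -- condition concerns closed vectors of naturals and holds by `refl`.
  solve : ∀ {n} (ρ : Vec A n) (e f : Expr n) →
          zipWith _+_ (pos e) (neg f) ≡ zipWith _+_ (pos f) (neg e) → ⟦ e ⟧ ρ ≡ ⟦ f ⟧ ρ
  solve ρ e f eq = cancelʳ (lin (neg e) ρ ⊕ lin (neg f) ρ)
    (trans (sym (assoc _ _ _)) (trans (cong (_⊕ lin (neg f) ρ) (correct e ρ))
    (trans (sym (lin-+ (pos e) (neg f) ρ)) (trans (cong (λ v → lin v ρ) eq) (trans (lin-+ (pos f) (neg e) ρ)
    (trans (cong (_⊕ lin (neg e) ρ) (sym (correct f ρ))) (trans (assoc _ _ _) (cong (⟦ f ⟧ ρ ⊕_) (comm _ _)))))))))

module Cyclic (k : ℕ) where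
  private
    n = suc k

  [_] : ℕ → Fin n
  [ a ] = fromℕ< (m%n<n a n)

  toℕ-[] : ∀ a → toℕ [ a ] ≡ a % n
  toℕ-[] a = toℕ-fromℕ< (m%n<n a n)

  []-toℕ : ∀ x → [ toℕ x ] ≡ x
  []-toℕ x = toℕ-injective (trans (toℕ-[] (toℕ x)) (m<n⇒m%n≡m (toℕ<n x)))

  private
    infix 4 _≈_
    record _≈_ (a b : ℕ) : Set where
      constructor ⟪_⟫
      field ≈⇒% : a % n ≡ b % n
    open _≈_

    ≈-refl : ∀ {a} → a ≈ a
    ≈-refl = ⟪ refl ⟫

    ≈-sym : ∀ {a b} → a ≈ b → b ≈ a
    ≈-sym p = ⟪ sym (≈⇒% p) ⟫

    ≈-trans : ∀ {a b c} → a ≈ b → b ≈ c → a ≈ c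
    ≈-trans p q = ⟪ trans (≈⇒% p) (≈⇒% q) ⟫

    ≡⇒≈ : ∀ {a b} → a ≡ b → a ≈ b
    ≡⇒≈ e = ⟪ cong (_% n) e ⟫

    +-≈ : ∀ {a b c d} → a ≈ c → b ≈ d → a + b ≈ c + d
    +-≈ {a} {b} {c} {d} p q = ⟪ trans (%-distribˡ-+ a b n)
      (trans (cong₂ (λ x y → (x + y) % n) (≈⇒% p) (≈⇒% q)) (sym (%-distribˡ-+ c d n))) ⟫

    []-≈ : ∀ {a b} → a ≈ b → [ a ] ≡ [ b ]
    []-≈ {a} {b} p = toℕ-injective (trans (toℕ-[] a) (trans (≈⇒% p) (sym (toℕ-[] b))))

    toℕ-≈ : ∀ a → toℕ [ a ] ≈ a
    toℕ-≈ a = ⟪ trans (cong (_% n) (toℕ-[] a)) (m%n%n≡m%n a n) ⟫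

  []-n+ : ∀ a → [ a + n ] ≡ [ a ]
  []-n+ a = []-≈ {a + n} {a} ⟪ [m+n]%n≡m%n a n ⟫

  private
    infixl 6 _+ₘ_
    infix 8 -ₘ_
    abstract
      _+ₘ_ : Fin n → Fin n → Fin n
      x +ₘ y = [ toℕ x + toℕ y ]

      -ₘ_ : Fin n → Fin n
      -ₘ x = [ n ∸ toℕ x ]

      +ₘ-assoc : ∀ x y z → (x +ₘ y) +ₘ z ≡ x +ₘ (y +ₘ z)
      +ₘ-assoc x y z = []-≈ (≈-trans (+-≈ (toℕ-≈ (toℕ x + toℕ y)) ≈-refl)
        (≈-trans (≡⇒≈ (ℕₚ.+-assoc (toℕ x) (toℕ y) (toℕ z))) (+-≈ (≈-refl {toℕ x}) (≈-sym (toℕ-≈ (toℕ y + toℕ z))))))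

      +ₘ-comm : ∀ x y → x +ₘ y ≡ y +ₘ x
      +ₘ-comm x y = cong [_] (ℕₚ.+-comm (toℕ x) (toℕ y))

      +ₘ-identʳ : ∀ x → x +ₘ zero ≡ x
      +ₘ-identʳ x = trans (cong [_] (ℕₚ.+-identityʳ (toℕ x))) ([]-toℕ x)

      +ₘ-inverseʳ : ∀ x → x +ₘ -ₘ x ≡ zero
      +ₘ-inverseʳ x = trans ([]-≈ (≈-trans (+-≈ (≈-refl {toℕ x}) (toℕ-≈ (n ∸ toℕ x)))
        (≡⇒≈ (ℕₚ.m+[n∸m]≡n (ℕₚ.<⇒≤ (toℕ<n x)))))) ([]-n+ 0)

      +ₘ-[] : ∀ a b → [ a + b ] ≡ [ a ] +ₘ [ b ]
      +ₘ-[] a b = []-≈ (+-≈ (≈-sym (toℕ-≈ a)) (≈-sym (toℕ-≈ b)))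

      toℕ-+ₘ : ∀ x y → toℕ (x +ₘ y) ≡ (toℕ x + toℕ y) % n
      toℕ-+ₘ x y = toℕ-[] (toℕ x + toℕ y)

  ℤ/ : Ab (Fin n)
  ℤ/ = record { _⊕_ = _+ₘ_ ; 𝟘 = zero ; ⊖_ = -ₘ_ ; assoc = +ₘ-assoc ; comm = +ₘ-comm ; identʳ = +ₘ-identʳ ; inverseʳ = +ₘ-inverseʳ }

  open Ab ℤ/ public using (_⊕_; _⊝_; ⊖_; 𝟘; _·_)

  []-+ : ∀ a b → [ a + b ] ≡ [ a ] ⊕ [ b ]
  []-+ = +ₘ-[]

  -- The sum of two representatives is below 2n, so at most one wrap occurs. Parity and order
  -- arguments pass from ℕ to ℤ/n through this case distinction.
  toℕ-⊕ : ∀ x y → toℕ (x ⊕ y) ≡ toℕ x + toℕ y ⊎ toℕ (x ⊕ y) + n ≡ toℕ x + toℕ y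
  toℕ-⊕ x y with (toℕ x + toℕ y) ℕₚ.<? n
  ... | yes p = inj₁ (trans (toℕ-+ₘ x y) (m<n⇒m%n≡m p))
  ... | no ¬p = inj₂ (trans (cong (_+ n) (trans (toℕ-+ₘ x y) eq)) (ℕₚ.m∸n+n≡m n≤s))
    where
      s = toℕ x + toℕ y
      n≤s : n ≤ s
      n≤s = ℕₚ.≮⇒≥ ¬p
      s∸n<n : s ∸ n < n
      s∸n<n = ℕₚ.+-cancelʳ-< n (s ∸ n) n (subst (_< n + n) (sym (ℕₚ.m∸n+n≡m n≤s))
                (ℕₚ.+-mono-<-≤ (toℕ<n x) (ℕₚ.<⇒≤ (toℕ<n y))))
      eq : s % n ≡ s ∸ n
      eq = trans (cong (_% n) (sym (ℕₚ.m∸n+n≡m n≤s))) (trans ([m+n]%n≡m%n (s ∸ n) n) (m<n⇒m%n≡m s∸n<n))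

  ·-[] : ∀ t x → t · x ≡ [ t * toℕ x ]
  ·-[] zero    x = refl
  ·-[] (suc t) x = trans (cong₂ _⊕_ (sym ([]-toℕ x)) (·-[] t x)) (sym ([]-+ (toℕ x) (t * toℕ x)))

  n·≡𝟘 : ∀ x → n · x ≡ 𝟘
  n·≡𝟘 x = trans (·-[] n x) (trans (cong [_] (ℕₚ.*-comm n (toℕ x)))
             (toℕ-injective (trans (toℕ-[] (toℕ x * n)) (m*n%n≡0 (toℕ x) n))))

  generate : (P : Fin n → Set) → (∀ x → P x → P (x ⊕ [ 1 ])) → ∀ {x} → P x → ∀ y → P y
  generate P step {x} px y = subst P e (steps (toℕ (y ⊝ x)))
    where
      steps : ∀ t → P (x ⊕ [ t ])
      steps zero    = subst P (sym (Ab.identʳ ℤ/ x)) px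
      steps (suc t) = subst P (trans (Ab.assoc ℤ/ x [ t ] [ 1 ]) (cong (x ⊕_) (trans (sym ([]-+ t 1)) (cong [_] (ℕₚ.+-comm t 1))))) (step (x ⊕ [ t ]) (steps t))
      e : x ⊕ [ toℕ (y ⊝ x) ] ≡ y
      e = trans (cong (x ⊕_) ([]-toℕ (y ⊝ x))) (AbSolver.solve ℤ/ (x ∷ y ∷ []) (v₀ :⊕ (v₁ :- v₀)) v₁ refl)

-- Two-colourings with a single odd block

module Parity {c} (Q : Squag (Fin c)) where
  open Squag Q

  private
    -- An injection of the class { s = τ } into itself that misses a point.
    no-shift : (s : Fin c → Bool) (τ : Bool) (o o′ e w m : Fin c) →
      s w ≡ τ → s m ≡ τ → w ≢ m →
      (∀ x → s x ≡ τ → x ≢ e → s (o ∙ (o′ ∙ x)) ≡ τ × o ∙ (o′ ∙ x) ≢ w × o ∙ (o′ ∙ x) ≢ m) → ⊥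
    no-shift s τ o o′ e w m sw sm w≢m h = missed (injective-surjective Φ Φ-inj m)
      where
        Φ′ : ∀ x → Dec (s x ≡ τ) → Dec (x ≡ e) → Fin c
        Φ′ x (no _)  _       = x
        Φ′ x (yes _) (yes _) = w
        Φ′ x (yes _) (no _)  = o ∙ (o′ ∙ x)

        Φ : Fin c → Fin c
        Φ x = Φ′ x (s x 𝔹.≟ τ) (x ≟ e)

        Φ′-class : ∀ x d d′ → s x ≡ τ → s (Φ′ x d d′) ≡ τ
        Φ′-class x (no n)  _       p = contradiction p n
        Φ′-class x (yes _) (yes _) p = sw
        Φ′-class x (yes _) (no n)  p = proj₁ (h x p n)

        inj′ : ∀ x y dx ex dy ey → Φ′ x dx ex ≡ Φ′ y dy ey → x ≡ y
        inj′ x y (no _)  _       (no _)  _       eq = eq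
        inj′ x y (no n)  ex      (yes p) ey      eq = contradiction (trans (cong s eq) (Φ′-class y (yes p) ey p)) n
        inj′ x y (yes p) ex      (no n)  ey      eq = contradiction (trans (cong s (sym eq)) (Φ′-class x (yes p) ex p)) n
        inj′ x y (yes _) (yes a) (yes _) (yes b) eq = trans a (sym b)
        inj′ x y (yes _) (yes a) (yes p) (no n)  eq = contradiction (sym eq) (proj₁ (proj₂ (h y p n)))
        inj′ x y (yes p) (no n)  (yes _) (yes b) eq = contradiction eq (proj₁ (proj₂ (h x p n)))
        inj′ x y (yes _) (no _)  (yes _) (no _)  eq = cancelˡ o′ (cancelˡ o eq)

        Φ-inj : ∀ {x y} → Φ x ≡ Φ y → x ≡ y
        Φ-inj {x} {y} = inj′ x y (s x 𝔹.≟ τ) (x ≟ e) (s y 𝔹.≟ τ) (y ≟ e)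

        missed′ : ∀ x d d′ → Φ′ x d d′ ≡ m → ⊥
        missed′ x (no n)  _       eq = n (trans (cong s eq) sm)
        missed′ x (yes _) (yes _) eq = w≢m eq
        missed′ x (yes p) (no n)  eq = proj₂ (proj₂ (h x p n)) eq

        missed : ∃[ x ] Φ x ≡ m → ⊥
        missed (x , eq) = missed′ x (s x 𝔹.≟ τ) (x ≟ e) eq

    t≢f : ∀ {b} → b ≡ true → b ≡ false → ⊥
    t≢f refl ()

    -- With o on the odd block, x ↦ o ∙ x exchanges the two classes off that block, and with a point o′ off
    -- the odd block x ↦ o′ ∙ x exchanges them off o′: counting both ways gives different class sizes.
    odd-block′ : (s : Fin c → Bool) (o u q : Fin c) → o ≢ u → ¬ Line o u q → s o ≡ true → s (o ∙ u) ≡ s u →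
      (∀ x y → x ≢ y → ¬ (Line o u x × Line o u y) → s (x ∙ y) ≡ s x xor s y) → ⊥
    odd-block′ s o u q o≢u q∉ so sv even = go (s q) refl
      where
        flip-o : ∀ x → ¬ Line o u x → s (o ∙ x) ≡ not (s x)
        flip-o x x∉ = trans (even o x (λ { refl → x∉ (inj₁ refl) }) (x∉ ∘ proj₂)) (cong (_xor s x) so)

        o∙q∉ : ¬ Line o u (o ∙ q)
        o∙q∉ (inj₁ e)        = q∉ (inj₁ (cancelˡ o (trans e (sym (idem o)))))
        o∙q∉ (inj₂ (inj₁ e)) = q∉ (inj₂ (inj₂ (trans (sym (invol o q)) (cong (o ∙_) e))))
        o∙q∉ (inj₂ (inj₂ e)) = q∉ (inj₂ (inj₁ (cancelˡ o e)))

        main : (o′ : Fin c) → ¬ Line o u o′ → s o′ ≡ true → ⊥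
        main o′ o′∉ so′ = go′ (s u) refl
          where
            flip : ∀ x → x ≢ o′ → s (o′ ∙ x) ≡ not (s x)
            flip x n = trans (even o′ x (n ∘ sym) (o′∉ ∘ proj₁)) (cong (_xor s x) so′)

            go′ : ∀ τ → s u ≡ τ → ⊥
            -- The point `o′` is not moved by `x ↦ o′ ∙ x`, so it is sent to `o` instead. All other
            -- images avoid the block, and `u` is missed.
            go′ true su = no-shift s true o o′ o′ o u so su o≢u λ x sx x≢o′ →
              let sz = trans (flip x x≢o′) (cong not sx)
                  z∉ : ¬ Line o u (o′ ∙ x)
                  z∉ = [ (λ e → t≢f (trans (cong s e) so) sz) , [ (λ e → t≢f (trans (cong s e) su) sz) ,
                         (λ e → t≢f (trans (cong s e) (trans sv su)) sz) ]′ ]′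
              in trans (flip-o _ z∉) (cong not sz)
               , (λ e → z∉ (inj₁ (cancelˡ o (trans e (sym (idem o))))))
               , (λ e → z∉ (inj₂ (inj₂ (trans (sym (invol o _)) (cong (o ∙_) e)))))
            -- The exceptional point is now `o′ ∙ o`, which would be carried to `o`, a point of the
            -- other class. It is sent to `u`, and `o ∙ u` is missed.
            go′ false su = no-shift s false o o′ (o′ ∙ o) u (o ∙ u) su (trans sv su) (∙≢ʳ o≢u ∘ sym) λ x sx x≢e →
              let x≢o′ : x ≢ o′
                  x≢o′ = λ e → t≢f (trans (cong s e) so′) sx
                  sz = trans (flip x x≢o′) (cong not sx)
                  z∉ : ¬ Line o u (o′ ∙ x)
                  z∉ = [ (λ e → x≢e (trans (sym (invol o′ x)) (cong (o′ ∙_) e))) ,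
                       [ (λ e → t≢f sz (trans (cong s e) su)) , (λ e → t≢f sz (trans (cong s e) (trans sv su))) ]′ ]′
              in trans (flip-o _ z∉) (cong not sz)
               , (λ e → z∉ (inj₂ (inj₂ (trans (sym (invol o _)) (cong (o ∙_) e)))))
               , (λ e → z∉ (inj₂ (inj₁ (cancelˡ o e))))

        go : ∀ b → s q ≡ b → ⊥
        go true  sq = main q q∉ sq
        go false sq = main (o ∙ q) o∙q∉ (trans (flip-o q q∉) (cong not sq))

  -- In a Steiner triple system with a point off the block through a and b, no two-colouring of the points
  -- has this block as its only odd one.
  odd-block : (s : Fin c → Bool) (a b q : Fin c) → a ≢ b → ¬ Line a b q → s (a ∙ b) ≡ not (s a xor s b) →
    (∀ x y → x ≢ y → ¬ (Line a b x × Line a b y) → s (x ∙ y) ≡ s x xor s y) → ⊥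
  odd-block s a b q a≢b q∉ odd even = go (s a) (s b) refl refl
    where
      ba⇒ab : ∀ {x} → Line b a x → Line a b x
      ba⇒ab (inj₁ e)        = inj₂ (inj₁ e)
      ba⇒ab (inj₂ (inj₁ e)) = inj₁ e
      ba⇒ab (inj₂ (inj₂ e)) = inj₂ (inj₂ (trans e (comm b a)))
      ab⇒ba : ∀ {x} → Line a b x → Line b a x
      ab⇒ba (inj₁ e)        = inj₂ (inj₁ e)
      ab⇒ba (inj₂ (inj₁ e)) = inj₁ e
      ab⇒ba (inj₂ (inj₂ e)) = inj₂ (inj₂ (trans e (comm a b)))
      ca⇒ab : ∀ {x} → Line (a ∙ b) a x → Line a b x
      ca⇒ab (inj₁ e)        = inj₂ (inj₂ e)
      ca⇒ab (inj₂ (inj₁ e)) = inj₁ e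
      ca⇒ab (inj₂ (inj₂ e)) = inj₂ (inj₁ (trans e (invol″ a b)))
      ab⇒ca : ∀ {x} → Line a b x → Line (a ∙ b) a x
      ab⇒ca (inj₁ e)        = inj₂ (inj₁ e)
      ab⇒ca (inj₂ (inj₁ e)) = inj₂ (inj₂ (trans e (sym (invol″ a b))))
      ab⇒ca (inj₂ (inj₂ e)) = inj₁ e

      -- The block has an odd number of points coloured `true`. One of them takes the role of `o`,
      -- and the other two then have equal colours.
      go : ∀ α β → s a ≡ α → s b ≡ β → ⊥
      go true β sa sb = odd-block′ s a b q a≢b q∉ sa
        (trans odd (trans (cong (λ t → not (t xor s b)) sa) (𝔹.not-involutive (s b)))) even
      go false true sa sb = odd-block′ s b a q (a≢b ∘ sym) (q∉ ∘ ba⇒ab) sb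
        (trans (cong s (comm b a)) (trans odd (trans (cong₂ (λ t t′ → not (t xor t′)) sa sb) (sym sa))))
        λ x y n m → even x y n λ { (p , r) → m (ab⇒ba p , ab⇒ba r) }
      go false false sa sb = odd-block′ s (a ∙ b) a q (∙≢ˡ a≢b) (q∉ ∘ ca⇒ab)
        (trans odd (cong₂ (λ t t′ → not (t xor t′)) sa sb))
        (trans (cong s (invol″ a b)) (trans sb (sym sa)))
        λ x y n m → even x y n λ { (p , r) → m (ab⇒ca p , ab⇒ca r) }

off-line : ∀ {c} (Q : Squag (Fin c)) → 3 < c → ∀ a b → ∃[ q ] ¬ Squag.Line Q a b q
off-line {c} Q 3<c a b with any? (λ q → ¬? (line? q))
  where
    open Squag Q
    line? : ∀ q → Dec (Line a b q)
    line? q with q ≟ a | q ≟ b | q ≟ a ∙ b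
    ... | yes p | _     | _     = yes (inj₁ p)
    ... | no _  | yes p | _     = yes (inj₂ (inj₁ p))
    ... | no _  | no _  | yes p = yes (inj₂ (inj₂ p))
    ... | no p  | no p′ | no p″ = no [ p , [ p′ , p″ ]′ ]′
... | yes p = p
... | no none = contradiction (injective⇒≤ {f = f} f-inj) (ℕₚ.<⇒≱ 3<c)
  where
    open Squag Q
    g : ∀ q → Dec (q ≡ a) → Dec (q ≡ b) → Fin 3
    g q (yes _) _       = zero
    g q (no _)  (yes _) = suc zero
    g q (no _)  (no _)  = suc (suc zero)
    f : Fin c → Fin 3
    f q = g q (q ≟ a) (q ≟ b)
    third : ∀ {q} → q ≢ a → q ≢ b → q ≡ a ∙ b
    third {q} n n′ with q ≟ a ∙ b
    ... | yes p = p
    ... | no n″ = contradiction (q , [ n , [ n′ , n″ ]′ ]′) none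
    g-inj : ∀ p q dp dp′ dq dq′ → g p dp dp′ ≡ g q dq dq′ → p ≡ q
    g-inj p q (yes x) _       (yes y) _       _ = trans x (sym y)
    g-inj p q (no _)  (yes x) (no _)  (yes y) _ = trans x (sym y)
    g-inj p q (no x)  (no x′) (no y)  (no y′) _ = trans (third x x′) (sym (third y y′))
    g-inj p q (yes _) _       (no _)  (yes _) ()
    g-inj p q (yes _) _       (no _)  (no _)  ()
    g-inj p q (no _)  (yes _) (yes _) _       ()
    g-inj p q (no _)  (no _)  (yes _) _       ()
    g-inj p q (no _)  (yes _) (no _)  (no _)  ()
    g-inj p q (no _)  (no _)  (no _)  (yes _) ()
    f-inj : ∀ {p q} → f p ≡ f q → p ≡ q
    f-inj {p} {q} = g-inj p q (p ≟ a) (p ≟ b) (q ≟ a) (q ≟ b)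

-- Marked blocks and twisted covers

odd : ℕ → Bool
odd zero    = false
odd (suc n) = not (odd n)

not-xor : ∀ a b → not (a xor b) ≡ not a xor b
not-xor true  b = 𝔹.not-involutive b
not-xor false b = refl

xor-same : ∀ a → a xor a ≡ false
xor-same true  = refl
xor-same false = refl

odd-+ : ∀ m n → odd (m + n) ≡ odd m xor odd n
odd-+ zero    n = refl
odd-+ (suc m) n = trans (cong not (odd-+ m n)) (not-xor (odd m) (odd n))

-- A set of blocks, encoded on pairs. Exchanging two points and passing to the third generate all
-- permutations of a block, so the two laws make the value depend on the block only.
record Mark {V : Set} (Q : Squag V) : Set where
  open Squag Q
  field
    marked      : V → V → Bool
    marked-sym  : ∀ x y → marked x y ≡ marked y x
    marked-line : ∀ {x y} → x ≢ y → marked x (x ∙ y) ≡ marked x y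

open Mark public

ExactlyOne : ∀ {V C : Set} {Q : Squag V} {P : Squag C} → Mark Q → Emb P Q → Set
ExactlyOne {C = C} {P = P} m e = Σ C λ a → Σ C λ b → a ≢ b × marked m (fun e a) (fun e b) ≡ true ×
  (∀ a′ b′ → a′ ≢ b′ → marked m (fun e a′) (fun e b′) ≡ true → Line a b a′ × Line a b b′)
  where open Squag P

module Fibre (k : ℕ) where
  open Cyclic k

  Fib : Set
  Fib = Maybe (Fin (suc k))

  -- In the application `e` is the difference of two points of one fibre and `S` the trace of a
  -- subsystem of the cover on that fibre. The translation acts on the finite part and ignores ∞.
  Spread : Squag Fib → Set₁
  Spread H = (S : Fib → Set) → Squag.Closed H S → ∀ i e → e ≢ 𝟘 → S (just i) →
             (∀ l → S (just l) → S (just (l ⊕ e))) → ∀ v → S v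

-- The cover of Q with fibres H minus the point ∞ = nothing: the blocks over a block {x,y,z} of Q are the
-- triples (x,i),(y,j),(z,l) with i + j + l = 1 if {x,y,z} is marked and i + j + l = 0 otherwise.
module Cover (k : ℕ) (H : Squag (Fibre.Fib k)) {V : Set} (_≟ⱽ_ : DecidableEquality V)
             (Q : Squag V) (m : Mark Q) where
  open Cyclic k
  open Fibre k
  open Squag Q
  private
    module H = Squag H
    module Z = Ab ℤ/
    open AbSolver ℤ/ using (solve)

  Pt : Set
  Pt = Maybe (V × Fin (suc k))

  lift : V → Fib → Pt
  lift x nothing  = nothing
  lift x (just i) = just (x , i)

  lift-inj : ∀ x {u v} → lift x u ≡ lift x v → u ≡ v
  lift-inj x {nothing} {nothing} _    = refl
  lift-inj x {just _}  {just _}  refl = refl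

  private
    cst : V → V → Fin (suc k)
    cst x y = if marked m x y then [ 1 ] else 𝟘

    cst-sym : ∀ x y → cst x y ≡ cst y x
    cst-sym x y = cong (if_then [ 1 ] else 𝟘) (marked-sym m x y)

    cst-line : ∀ {x y} → x ≢ y → cst x (x ∙ y) ≡ cst x y
    cst-line n = cong (if_then [ 1 ] else 𝟘) (marked-line m n)

    op₂ : ∀ x (i : Fin (suc k)) y (j : Fin (suc k)) → Dec (x ≡ y) → Pt
    op₂ x i y j (yes _) = lift x (just i H.∙ just j)
    op₂ x i y j (no _)  = just (x ∙ y , cst x y ⊝ i ⊝ j)

    op : Pt → Pt → Pt
    op nothing        nothing        = nothing
    op nothing        (just (x , i)) = lift x (nothing H.∙ just i)
    op (just (x , i)) nothing        = lift x (just i H.∙ nothing)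
    op (just (x , i)) (just (y , j)) = op₂ x i y j (x ≟ⱽ y)

    op-same : ∀ x u v → op (lift x u) (lift x v) ≡ lift x (u H.∙ v)
    op-same x nothing  nothing  = sym (cong (lift x) (H.idem nothing))
    op-same x nothing  (just i) = refl
    op-same x (just i) nothing  = refl
    op-same x (just i) (just j) with x ≟ⱽ x
    ... | yes _ = refl
    ... | no n  = contradiction refl n

    op-diff : ∀ {x i y j} → x ≢ y → op (just (x , i)) (just (y , j)) ≡ just (x ∙ y , cst x y ⊝ i ⊝ j)
    op-diff {x} {i} {y} {j} n with x ≟ⱽ y
    ... | yes e = contradiction e n
    ... | no _  = refl

    op-comm : ∀ p q → op p q ≡ op q p
    op-comm nothing        nothing        = refl
    op-comm nothing        (just (y , j)) = cong (lift y) (H.comm _ _)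
    op-comm (just (x , i)) nothing        = cong (lift x) (H.comm _ _)
    op-comm (just (x , i)) (just (y , j)) = go (x ≟ⱽ y)
      where
        go : Dec (x ≡ y) → op (just (x , i)) (just (y , j)) ≡ op (just (y , j)) (just (x , i))
        go (yes refl) = trans (op-same x (just i) (just j)) (trans (cong (lift x) (H.comm _ _)) (sym (op-same x (just j) (just i))))
        go (no n) = trans (op-diff n) (trans (cong just (cong₂ _,_ (comm x y)
          (trans (cong (λ c → c ⊝ i ⊝ j) (cst-sym x y))
                 (solve (cst y x ∷ i ∷ j ∷ []) (v₀ :- v₁ :- v₂) (v₀ :- v₂ :- v₁) refl))))
          (sym (op-diff (n ∘ sym))))

    op-invol-same : ∀ x u v → op (lift x u) (op (lift x u) (lift x v)) ≡ lift x v
    op-invol-same x u v = trans (cong (op (lift x u)) (op-same x u v)) (trans (op-same x u _) (cong (lift x) (H.invol u v)))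

    op-invol : ∀ p q → op p (op p q) ≡ q
    op-invol nothing        nothing        = refl
    op-invol nothing        (just (y , j)) = op-invol-same y nothing (just j)
    op-invol (just (x , i)) nothing        = op-invol-same x (just i) nothing
    op-invol (just (x , i)) (just (y , j)) = go (x ≟ⱽ y)
      where
        go : Dec (x ≡ y) → op (just (x , i)) (op (just (x , i)) (just (y , j))) ≡ just (y , j)
        go (yes refl) = op-invol-same x (just i) (just j)
        go (no n) = trans (cong (op (just (x , i))) (op-diff n)) (trans (op-diff (∙≢ˡ n ∘ sym))
          (cong just (cong₂ _,_ (invol x y) (trans (cong (λ c → c ⊝ i ⊝ (cst x y ⊝ i ⊝ j)) (cst-line n))
            (solve (cst x y ∷ i ∷ j ∷ []) (v₀ :- v₁ :- (v₀ :- v₁ :- v₂)) v₂ refl)))))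

  cover : Squag Pt
  cover = record
    { _∙_ = op
    ; idem = λ { nothing → refl ; (just (x , i)) → trans (op-same x (just i) (just i)) (cong (lift x) (H.idem (just i))) }
    ; comm = op-comm ; invol = op-invol }

  fibre : ∀ x → Emb H cover
  fibre x = emb (lift x) (lift-inj x) (λ u v → sym (op-same x u v))

  -- Over an unmarked block the constant is 0, so the zero section respects it. This is how the
  -- blocks to be kept survive in the cover.
  section-hom : ∀ {x y} → x ≢ y → marked m x y ≡ false → just (x ∙ y , 𝟘) ≡ op (just (x , 𝟘)) (just (y , 𝟘))
  section-hom {x} {y} n e = trans (cong (λ z → just (x ∙ y , z)) (trans (solve [] :0 (:0 :- :0 :- :0) refl)
    (cong (λ b → (if b then [ 1 ] else 𝟘) ⊝ 𝟘 ⊝ 𝟘) (sym e)))) (sym (op-diff n))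

  -- Marks awaiting their own cover are carried along: a block across the fibres inherits the mark
  -- of its projection, and a block inside a fibre gets none.
  liftMark : Mark Q → Mark cover
  liftMark m′ = record
    { marked = mk
    ; marked-sym = mk-sym
    ; marked-line = λ {p} {q} → mk-line p q }
    where
      mk₂ : ∀ x y → Dec (x ≡ y) → Bool
      mk₂ x y (yes _) = false
      mk₂ x y (no _)  = marked m′ x y

      mk : Pt → Pt → Bool
      mk (just (x , _)) (just (y , _)) = mk₂ x y (x ≟ⱽ y)
      mk (just _)       nothing        = false
      mk nothing        _              = false

      mk-same : ∀ x u v → mk (lift x u) (lift x v) ≡ false
      mk-same x nothing  v        = refl
      mk-same x (just _) nothing  = refl
      mk-same x (just _) (just _) with x ≟ⱽ x
      ... | yes _ = refl
      ... | no n  = contradiction refl n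

      mk-diff : ∀ {x i y j} → x ≢ y → mk (just (x , i)) (just (y , j)) ≡ marked m′ x y
      mk-diff {x} {i} {y} n with x ≟ⱽ y
      ... | yes e = contradiction e n
      ... | no _  = refl

      mk-sym : ∀ p q → mk p q ≡ mk q p
      mk-sym nothing        nothing        = refl
      mk-sym nothing        (just _)       = refl
      mk-sym (just _)       nothing        = refl
      mk-sym (just (x , i)) (just (y , j)) = go (x ≟ⱽ y)
        where
          go : Dec (x ≡ y) → mk (just (x , i)) (just (y , j)) ≡ mk (just (y , j)) (just (x , i))
          go (yes refl) = trans (mk-same x (just i) (just j)) (sym (mk-same x (just j) (just i)))
          go (no n)     = trans (mk-diff {i = i} {j = j} n) (trans (marked-sym m′ x y) (sym (mk-diff {i = j} {j = i} (n ∘ sym))))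

      mk-line-same : ∀ x u v → mk (lift x u) (op (lift x u) (lift x v)) ≡ mk (lift x u) (lift x v)
      mk-line-same x u v = trans (cong (mk (lift x u)) (op-same x u v)) (trans (mk-same x u _) (sym (mk-same x u v)))

      mk-line : ∀ p q → p ≢ q → mk p (op p q) ≡ mk p q
      mk-line nothing        q              _ = refl
      mk-line (just (x , i)) nothing        _ = mk-line-same x (just i) nothing
      mk-line (just (x , i)) (just (y , j)) _ = go (x ≟ⱽ y)
        where
          go : Dec (x ≡ y) → mk (just (x , i)) (op (just (x , i)) (just (y , j))) ≡ mk (just (x , i)) (just (y , j))
          go (yes refl) = mk-line-same x (just i) (just j)
          go (no n) = trans (cong (mk (just (x , i))) (op-diff n)) (trans (mk-diff {i = i} {j = cst x y ⊝ i ⊝ j} (∙≢ˡ n ∘ sym))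
            (trans (marked-line m′ n) (sym (mk-diff {i = i} {j = j} n))))

  liftMark-diff : ∀ m′ {x i y j} → x ≢ y → marked (liftMark m′) (just (x , i)) (just (y , j)) ≡ marked m′ x y
  liftMark-diff m′ {x} {i} {y} n with x ≟ⱽ y
  ... | yes e = contradiction e n
  ... | no _  = refl

  -- A subsystem meeting two fibres and containing two points of one of them is invariant under a translation.
  translate : ∀ {i i′ l y j} {x} → x ≢ y → (S : Pt → Set) → Squag.Closed cover S →
    S (just (x , i)) → S (just (x , i′)) → S (just (y , j)) → S (just (x , l)) → S (just (x , l ⊕ (i′ ⊝ i)))
  translate {i} {i′} {l} {y} {j} {x} n S closed si si′ sj sl = subst S
      (trans (cong (λ p → op p (op a′ r)) e₁) (trans (cong (op (just (y , i ⊕ j ⊝ l))) (op-diff n)) (trans (op-diff (∙≢ʳ n ∘ sym))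
        (cong just (cong₂ _,_ (trans (cong (y ∙_) (comm x y)) (invol y x))
          (trans (cong (λ c → c ⊝ (i ⊕ j ⊝ l) ⊝ (cst x y ⊝ i′ ⊝ j)) e₂)
            (solve (cst x y ∷ i ∷ i′ ∷ j ∷ l ∷ []) (v₀ :- (v₁ :⊕ v₃ :- v₄) :- (v₀ :- v₂ :- v₃)) (v₄ :⊕ (v₂ :- v₁)) refl)))))))
      (closed (closed sl (closed si sj)) (closed si′ sj))
    where
      a = just (x , i)
      a′ = just (x , i′)
      r = just (y , j)
      e₁ : op (just (x , l)) (op a r) ≡ just (y , i ⊕ j ⊝ l)
      e₁ = trans (cong (op (just (x , l))) (op-diff n)) (trans (op-diff (∙≢ˡ n ∘ sym))
        (cong just (cong₂ _,_ (invol x y) (trans (cong (λ c → c ⊝ l ⊝ (cst x y ⊝ i ⊝ j)) (cst-line n))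
          (solve (cst x y ∷ i ∷ j ∷ l ∷ []) (v₀ :- v₃ :- (v₀ :- v₁ :- v₂)) (v₁ :⊕ v₂ :- v₃) refl)))))
      e₂ : cst y (x ∙ y) ≡ cst x y
      e₂ = trans (cong (cst y) (comm x y)) (trans (cst-line (n ∘ sym)) (cst-sym y x))

  module Classify (em : ExcludedMiddle 0ℓ) (spread : Spread H) {c} (P : Squag (Fin c)) (f : Emb P cover) where
    private
      module P = Squag P

    Section : Set
    Section = Σ (Emb P Q) λ e → ∀ a → ∃[ i ] fun f a ≡ just (fun e a , i)

    private
      Two : Set
      Two = ∃[ a ] ∃[ b ] ∃[ x ] ∃[ y ] ∃[ i ] ∃[ j ] (fun f a ≡ just (x , i) × fun f b ≡ just (y , j) × x ≢ y)

      Twin : Set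
      Twin = ∃[ a ] ∃[ b ] ∃[ x ] ∃[ i ] ∃[ j ] (fun f a ≡ just (x , i) × fun f b ≡ just (x , j) × i ≢ j)

      Image : Pt → Set
      Image v = ∃[ a ] fun f a ≡ v

      image-closed : Squag.Closed cover Image
      image-closed (a , refl) (b , refl) = a P.∙ b , hom f a b

      onefibre : ¬ Two → Emb P H
      onefibre no-two with em {∃[ a ] ∃[ x ] ∃[ i ] fun f a ≡ just (x , i)}
      -- Every point is sent to ∞, so there is at most one point.
      ... | no none = emb (λ _ → nothing) (λ _ → inj f (trans (all-∞ _) (sym (all-∞ _)))) (λ _ _ → sym (H.idem nothing))
        where
          all-∞ : ∀ a → fun f a ≡ nothing
          all-∞ a with fun f a in eq
          ... | nothing = refl
          ... | just (x , i) = contradiction (a , x , i , eq) none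
      ... | yes (a , x , i , fa) = emb-factor f (fibre x) pre
        where
          pre : ∀ b → ∃[ w ] lift x w ≡ fun f b
          pre b with fun f b in eq
          ... | nothing = nothing , refl
          ... | just (y , j) with x ≟ⱽ y
          ...   | yes refl = just j , refl
          ...   | no n = contradiction (a , b , x , y , i , j , fa , eq , n) no-two

      -- A point in another fibre lets `translate` act on the trace of the image on fibre `x`, with
      -- step the difference of the twins; `spread` then fills the fibre.
      fullfibre : Two → Twin → Emb H P
      fullfibre two (a , b , x , i , j , fa , fb , i≢j) = emb-factor (fibre x) f (spread S S-closed i (j ⊝ i) j⊝i≢0 (a , fa) step)
        where
          S : Fib → Set
          S v = Image (lift x v)
          S-closed : H.Closed S
          S-closed {u} {v} p q = subst Image (op-same x u v) (image-closed p q)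
          j⊝i≢0 : j ⊝ i ≢ 𝟘
          j⊝i≢0 e = i≢j (sym (trans (solve (i ∷ j ∷ []) v₁ (v₀ :⊕ (v₁ :- v₀)) refl) (trans (cong (i ⊕_) e) (Z.identʳ i))))
          other : Two → ∃[ r ] ∃[ y ] ∃[ t ] (fun f r ≡ just (y , t) × x ≢ y)
          other (a₁ , b₁ , x₁ , y₁ , i₁ , j₁ , e₁ , e₂ , n) with x ≟ⱽ x₁
          ... | yes refl = b₁ , y₁ , j₁ , e₂ , n
          ... | no n′    = a₁ , x₁ , i₁ , e₁ , n′
          step : ∀ l → S (just l) → S (just (l ⊕ (j ⊝ i)))
          step l sl with other two
          ... | r , y , t , fr , n = translate n Image image-closed (a , fa) (b , fb) (r , fr) sl

      section : Two → ¬ Twin → Section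
      section (a₀ , _ , x₀ , _ , i₀ , _ , f₀ , _) no-twin = emb base base-inj base-hom , λ a → proj₂ (over a)
        where
          -- The product of ∞ with the point `(x₀ , i₀)` would be a second point of its fibre.
          not-∞ : ∀ a → fun f a ≢ nothing
          not-∞ a fa = go (nothing H.∙ just i₀) refl
            where
              go : ∀ v → nothing H.∙ just i₀ ≡ v → ⊥
              go nothing  e = H.∙≢ˡ {nothing} {just i₀} (λ ()) e
              go (just j) e = no-twin (a₀ , a P.∙ a₀ , x₀ , i₀ , j , f₀ ,
                trans (hom f a a₀) (trans (cong₂ op fa f₀) (cong (lift x₀) e)) ,
                λ { refl → H.∙≢ʳ {nothing} {just i₀} (λ ()) e })
          over : ∀ a → ∃[ x ] ∃[ i ] fun f a ≡ just (x , i)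
          over a with fun f a in eq
          ... | nothing = contradiction eq (not-∞ a)
          ... | just (x , i) = x , i , refl
          base : Fin c → V
          base a = proj₁ (over a)
          base-inj : ∀ {a b} → base a ≡ base b → a ≡ b
          base-inj {a} {b} = go (over a) (over b)
            where
              go : (p : ∃[ x ] ∃[ i ] fun f a ≡ just (x , i)) (q : ∃[ x ] ∃[ i ] fun f b ≡ just (x , i)) →
                   proj₁ p ≡ proj₁ q → a ≡ b
              go (x , i , fa) (_ , j , fb) refl with i ≟ j
              ... | yes refl = inj f (trans fa (sym fb))
              ... | no n = contradiction (a , b , x , i , j , fa , fb , n) no-twin
          base-hom : ∀ a b → base (a P.∙ b) ≡ base a ∙ base b
          base-hom a b with a ≟ b
          ... | yes refl = trans (cong base (P.idem a)) (sym (idem _))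
          ... | no n = cong proj₁ (just-injective (trans (sym (proj₂ (proj₂ (over (a P.∙ b))))) (trans (hom f a b)
                  (trans (cong₂ op (proj₂ (proj₂ (over a))) (proj₂ (proj₂ (over b)))) (op-diff (n ∘ base-inj))))))

    classify : Emb H P ⊎ Emb P H ⊎ Section
    classify with em {Two} | em {Twin}
    ... | no no-two | _          = inj₂ (inj₁ (onefibre no-two))
    ... | yes two   | yes twin   = inj₁ (fullfibre two twin)
    ... | yes two   | no no-twin = inj₂ (inj₂ (section two no-twin))

    -- As `suc k` is even, parity is a homomorphism from ℤ/(k + 1) to ℤ/2. The parities of the fibre
    -- coordinates of a section form a two-colouring whose odd blocks are exactly the marked ones,
    -- and `odd-block` excludes that there is just one.
    section-unmarked : (h : ℕ) → k ≡ suc (h + h) → 3 < c → ((e , _) : Section) → ¬ ExactlyOne m e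
    section-unmarked h refl 3<c (e , over) (a , b , a≢b , mab , only) =
      Parity.odd-block P s a b (proj₁ q) a≢b (proj₂ q) (trans (s-∙ a b a≢b) (cong (λ t → t xor (s a xor s b)) mab))
        λ x y n x∉ → trans (s-∙ x y n) (cong (λ t → t xor (s x xor s y)) (unmarked x y n x∉))
      where
        q = off-line P 3<c a b
        par : Fin (suc k) → Bool
        par x = odd (toℕ x)
        odd-even : odd (suc k) ≡ false
        odd-even = trans (𝔹.not-involutive (odd (h + h))) (trans (odd-+ h h) (xor-same (odd h)))
        par-⊕ : ∀ x y → par (x ⊕ y) ≡ par x xor par y
        par-⊕ x y with toℕ-⊕ x y
        ... | inj₁ eq = trans (cong odd eq) (odd-+ (toℕ x) (toℕ y))
        ... | inj₂ eq = trans (trans (sym (𝔹.xor-identityʳ _)) (trans (cong (par (x ⊕ y) xor_) (sym odd-even))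
                          (sym (odd-+ (toℕ (x ⊕ y)) (suc k))))) (trans (cong odd eq) (odd-+ (toℕ x) (toℕ y)))
        par-⊖ : ∀ x → par (⊖ x) ≡ par x
        par-⊖ x = lemma (par x) (par (⊖ x)) (trans (sym (par-⊕ x (⊖ x))) (cong par (Z.inverseʳ x)))
          where
            lemma : ∀ a b → a xor b ≡ false → b ≡ a
            lemma true  true  _ = refl
            lemma false false _ = refl
        i : Fin c → Fin (suc k)
        i a = proj₁ (over a)
        s : Fin c → Bool
        s a = par (i a)
        par-cst : ∀ b → par (if b then [ 1 ] else 𝟘) ≡ b
        par-cst true  = refl
        par-cst false = refl
        s-∙ : ∀ x y → x ≢ y → s (x P.∙ y) ≡ marked m (fun e x) (fun e y) xor (s x xor s y)
        s-∙ x y n = trans (cong par (,-injectiveʳ′ (just-injective (trans (sym (proj₂ (over (x P.∙ y)))) (trans (hom f x y)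
            (trans (cong₂ op (proj₂ (over x)) (proj₂ (over y))) (op-diff (n ∘ inj e))))))))
          (trans (par-⊕ (cst (fun e x) (fun e y) ⊝ i x) (⊖ i y)) (trans (cong₂ _xor_ (trans (par-⊕ (cst (fun e x) (fun e y)) (⊖ i x))
            (cong₂ _xor_ (par-cst (marked m (fun e x) (fun e y))) (par-⊖ (i x)))) (par-⊖ (i y))) (𝔹.xor-assoc (marked m (fun e x) (fun e y)) (s x) (s y))))
          where
            ,-injectiveʳ′ : ∀ {A B : Set} {a a′ : A} {b b′ : B} → (a , b) ≡ (a′ , b′) → b ≡ b′
            ,-injectiveʳ′ refl = refl
        unmarked : ∀ x y → x ≢ y → ¬ (P.Line a b x × P.Line a b y) → marked m (fun e x) (fun e y) ≡ false
        unmarked x y n x∉ with marked m (fun e x) (fun e y) in eq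
        ... | false = refl
        ... | true  = contradiction (only x y n eq) x∉

-- One-factorizations and doubling

-- A one-factorization of the complete graph on Y with colours C; μ c is the perfect matching of colour c.
record OneFact (C Y : Set) : Set where
  field
    μ       : C → Y → Y
    μ-invol : ∀ c y → μ c (μ c y) ≡ y
    μ-fpf   : ∀ c y → μ c y ≢ y
    μ-inj   : ∀ {c c′} y → μ c y ≡ μ c′ y → c ≡ c′
    χ       : Y → Y → C
    χ-spec  : ∀ {y y′} → y ≢ y′ → μ (χ y y′) y ≡ y′

  χ-uniq : ∀ {c y y′} → μ c y ≡ y′ → χ y y′ ≡ c
  χ-uniq {c} {y} refl = μ-inj y (χ-spec (μ-fpf c y ∘ sym))

  χ-comm : ∀ {y y′} → y ≢ y′ → χ y y′ ≡ χ y′ y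
  χ-comm {y} {y′} n = χ-uniq (trans (cong (μ _) (sym (χ-spec (n ∘ sym)))) (μ-invol (χ y′ y) y′))

  record Sub (K : C → Set) (T : Y → Set) : Set where
    field
      μ-closed : ∀ {c y} → K c → T y → T (μ c y)
      χ-closed : ∀ {y y′} → y ≢ y′ → T y → T y′ → K (χ y y′)

    colour : ∀ {c y y′} → T y → T y′ → μ c y ≡ y′ → K c
    colour {c} {y} t t′ e = subst K (χ-uniq e) (χ-closed (λ e′ → μ-fpf c y (trans e (sym e′))) t t′)

-- The pairs `K`, `T` are what a subsystem of the doubling cuts out of the colours and the vertices.
-- Sub-one-factorizations whose colours are not closed in `G` are therefore allowed.
Rigid : ∀ {C Y} → Squag C → OneFact C Y → Set₁
Rigid G F = ∀ K T → Squag.Closed G K → OneFact.Sub F K T →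
            ∀ {y c c′} → T y → K c → K c′ → c ≢ c′ → ∀ d → K d

-- The classical v → 2v + 1 construction: to the blocks of `G` are added the edges, each completed
-- by its colour.
module Doubling {C Y : Set} (_≟ʸ_ : DecidableEquality Y) (G : Squag C) (F : OneFact C Y) where
  open OneFact F
  private
    module G = Squag G

    op₂ : ∀ (y y′ : Y) → Dec (y ≡ y′) → C ⊎ Y
    op₂ y y′ (yes _) = inj₂ y
    op₂ y y′ (no _)  = inj₁ (χ y y′)

    op : C ⊎ Y → C ⊎ Y → C ⊎ Y
    op (inj₁ c) (inj₁ c′) = inj₁ (c G.∙ c′)
    op (inj₁ c) (inj₂ y)  = inj₂ (μ c y)
    op (inj₂ y) (inj₁ c)  = inj₂ (μ c y)
    op (inj₂ y) (inj₂ y′) = op₂ y y′ (y ≟ʸ y′)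

    op-same : ∀ y → op (inj₂ y) (inj₂ y) ≡ inj₂ y
    op-same y with y ≟ʸ y
    ... | yes _ = refl
    ... | no n  = contradiction refl n

    op-diff : ∀ {y y′} → y ≢ y′ → op (inj₂ y) (inj₂ y′) ≡ inj₁ (χ y y′)
    op-diff {y} {y′} n with y ≟ʸ y′
    ... | yes e = contradiction e n
    ... | no _  = refl

    op-comm : ∀ p q → op p q ≡ op q p
    op-comm (inj₁ c) (inj₁ c′) = cong inj₁ (G.comm c c′)
    op-comm (inj₁ c) (inj₂ y)  = refl
    op-comm (inj₂ y) (inj₁ c)  = refl
    op-comm (inj₂ y) (inj₂ y′) = go (y ≟ʸ y′)
      where
        go : Dec (y ≡ y′) → op (inj₂ y) (inj₂ y′) ≡ op (inj₂ y′) (inj₂ y)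
        go (yes refl) = refl
        go (no n) = trans (op-diff n) (trans (cong inj₁ (χ-comm n)) (sym (op-diff (n ∘ sym))))

    op-invol : ∀ p q → op p (op p q) ≡ q
    op-invol (inj₁ c) (inj₁ c′) = cong inj₁ (G.invol c c′)
    op-invol (inj₁ c) (inj₂ y)  = cong inj₂ (μ-invol c y)
    op-invol (inj₂ y) (inj₁ c)  = trans (op-diff (μ-fpf c y ∘ sym)) (cong inj₁ (χ-uniq refl))
    op-invol (inj₂ y) (inj₂ y′) = go (y ≟ʸ y′)
      where
        go : Dec (y ≡ y′) → op (inj₂ y) (op (inj₂ y) (inj₂ y′)) ≡ inj₂ y′
        go (yes refl) = trans (cong (op (inj₂ y)) (op-same y)) (op-same y)
        go (no n) = trans (cong (op (inj₂ y)) (op-diff n)) (cong inj₂ (χ-spec n))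

  double : Squag (C ⊎ Y)
  double = record
    { _∙_ = op
    ; idem = λ { (inj₁ c) → cong inj₁ (G.idem c) ; (inj₂ y) → op-same y }
    ; comm = op-comm ; invol = op-invol }

  double-diff : ∀ {y y′} → y ≢ y′ → Squag._∙_ double (inj₂ y) (inj₂ y′) ≡ inj₁ (χ y y′)
  double-diff = op-diff

  base : Emb G double
  base = emb inj₁ inj₁-injective (λ _ _ → refl)

  module _ (rigid : Rigid G F) (S : C ⊎ Y → Set) (closed : Squag.Closed double S) where
    double-full : ∀ {y c c′} → S (inj₂ y) → S (inj₁ c) → S (inj₁ c′) → c ≢ c′ → ∀ v → S v
    double-full {y} sy sc sc′ n = λ { (inj₁ d) → all d ; (inj₂ y′) → go y′ (y ≟ʸ y′) }
      where
        all : ∀ d → S (inj₁ d)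
        all = rigid (S ∘ inj₁) (S ∘ inj₂) closed
          (record { μ-closed = closed ; χ-closed = λ n′ t t′ → subst S (op-diff n′) (closed t t′) }) sy sc sc′ n
        go : ∀ y′ → Dec (y ≡ y′) → S (inj₂ y′)
        go y′ (yes refl) = sy
        go y′ (no n′) = subst (S ∘ inj₂) (χ-spec n′) (closed (all (χ y y′)) sy)

-- Two rigid one-factorizations over odd cyclic groups

-- Halving in a cyclic group of odd order
module OddCyclic (r : ℕ) where
  open Cyclic (r + r) public
  private
    module Z = Ab ℤ/
  open AbSolver ℤ/ public using (solve)

  -- The inverse of 2 modulo 2r + 1 is r + 1.
  half : Fin (suc (r + r)) → Fin (suc (r + r))
  half x = suc r · x

  half+half : ∀ x → half x ⊕ half x ≡ x
  half+half x = trans (sym (Z.·-+ (suc r) (suc r) x)) (trans (cong (λ t → suc t · x) (ℕₚ.+-suc r r))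
    (trans (cong (x ⊕_) (n·≡𝟘 x)) (Z.identʳ x)))

  half-double : ∀ x → half (x ⊕ x) ≡ x
  half-double x = trans (Z.·-⊕ (suc r) x x) (half+half x)

  double-inj : ∀ {x y} → x ⊕ x ≡ y ⊕ y → x ≡ y
  double-inj {x} {y} e = trans (sym (half-double x)) (trans (cong half e) (half-double y))

  mid : Fin (suc (r + r)) → Fin (suc (r + r)) → Fin (suc (r + r))
  mid x y = half (x ⊕ y)

  mid+mid : ∀ x y → mid x y ⊕ mid x y ≡ x ⊕ y
  mid+mid x y = half+half (x ⊕ y)

  mid-uniq : ∀ {c x y} → c ⊕ c ≡ x ⊕ y → mid x y ≡ c
  mid-uniq {c} {x} {y} e = double-inj (trans (mid+mid x y) (sym e))

  mid≢ˡ : ∀ {x y} → x ≢ y → mid x y ≢ x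
  mid≢ˡ {x} {y} n e = n (trans (solve (x ∷ []) v₀ (v₀ :⊕ v₀ :- v₀) refl) (trans (cong (_⊝ x)
    (trans (cong₂ _⊕_ (sym e) (sym e)) (mid+mid x y))) (solve (x ∷ y ∷ []) (v₀ :⊕ v₁ :- v₀) v₁ refl)))

  reflect≢ : ∀ {c x} → x ≢ c → c ⊕ c ⊝ x ≢ x
  reflect≢ {c} {x} n e = n (sym (double-inj (trans (solve (c ∷ x ∷ []) (v₀ :⊕ v₀) (v₀ :⊕ v₀ :- v₁ :⊕ v₁) refl) (cong (_⊕ x) e))))

  reflect≢c : ∀ {c x} → x ≢ c → c ⊕ c ⊝ x ≢ c
  reflect≢c {c} {x} n e = n (trans (solve (c ∷ x ∷ []) v₁ (v₀ :⊕ v₀ :- (v₀ :⊕ v₀ :- v₁)) refl)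
    (trans (cong (c ⊕ c ⊝_) e) (solve (c ∷ []) (v₀ :⊕ v₀ :- v₀) v₀ refl)))

  reflect-invol : ∀ c x → c ⊕ c ⊝ (c ⊕ c ⊝ x) ≡ x
  reflect-invol c x = solve (c ∷ x ∷ []) (v₀ :⊕ v₀ :- (v₀ :⊕ v₀ :- v₁)) v₁ refl

  reflect-mid : ∀ x y → mid x y ⊕ mid x y ⊝ x ≡ y
  reflect-mid x y = trans (cong (_⊝ x) (mid+mid x y)) (solve (x ∷ y ∷ []) (v₀ :⊕ v₁ :- v₀) v₁ refl)

  -- The midpoint is the translate of `x` by r + 1 times `y ⊝ x`. It contradicts configurations in
  -- which midpoints are forbidden but translations are available.
  translate-mid : (P : Fin (suc (r + r)) → Set) → ∀ x y → (∀ z → P z → P (z ⊕ (y ⊝ x))) → P x → P (mid x y)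
  translate-mid P x y step px = subst P (sym (mid-uniq e)) (steps (suc r))
    where
      d = y ⊝ x
      steps : ∀ t → P (x ⊕ t · d)
      steps zero    = subst P (sym (Z.identʳ x)) px
      steps (suc t) = subst P (solve (x ∷ d ∷ (t · d) ∷ []) (v₀ :⊕ v₂ :⊕ v₁) (v₀ :⊕ (v₁ :⊕ v₂)) refl) (step _ (steps t))
      e : (x ⊕ half d) ⊕ (x ⊕ half d) ≡ x ⊕ y
      e = trans (solve (x ∷ half d ∷ []) (v₀ :⊕ v₁ :⊕ (v₀ :⊕ v₁)) (v₀ :⊕ v₀ :⊕ (v₁ :⊕ v₁)) refl)
          (trans (cong (x ⊕ x ⊕_) (half+half d)) (solve (x ∷ y ∷ []) (v₀ :⊕ v₀ :⊕ (v₁ :- v₀)) (v₀ :⊕ v₁) refl))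

xor-moveʳ : ∀ {a b c} → a xor b ≡ c → a ≡ c xor b
xor-moveʳ {a} {b} refl = xor-solve 2 (λ a b → a := (a :+ b) :+ b) refl a b

-- The colours (c , b) act on two copies of the near-one-factorization { x , 2c − x } of ℤ/M, M odd, with an
-- extra point ∞ = nothing in each copy.  The twist ν c = parity of c on the edges at ∞ destroys the
-- sub-one-factorizations meeting each pair of copies at most once.
module TwistedPair (r : ℕ) where
  open OddCyclic r
  private
    M : ℕ
    M = suc (r + r)
    module Z = Ab ℤ/

  Colour Vertex : Set
  Colour = Maybe (Fin M × Bool)
  Vertex = Maybe (Fin M) × Bool

  private
    ν : Fin M → Bool
    ν c = odd (toℕ c)

    μ₂ : ∀ (c : Fin M) (b : Bool) (i : Fin M) (s : Bool) → Dec (i ≡ c) → Vertex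
    μ₂ c b i s (yes _) = nothing , s xor (b xor ν c)
    μ₂ c b i s (no _)  = just (c ⊕ c ⊝ i) , s xor b

    μ : Colour → Vertex → Vertex
    μ nothing        (i , s)       = i , not s
    μ (just (c , b)) (nothing , s) = just c , s xor (b xor ν c)
    μ (just (c , b)) (just i , s)  = μ₂ c b i s (i ≟ c)

    χ₂ : ∀ (i j : Fin M) (s s′ : Bool) → Dec (i ≡ j) → Colour
    χ₂ i j s s′ (yes _) = nothing
    χ₂ i j s s′ (no _)  = just (mid i j , s xor s′)

    χ : Vertex → Vertex → Colour
    χ (nothing , s) (nothing , s′) = nothing
    χ (nothing , s) (just c , s′)  = just (c , (s xor s′) xor ν c)
    χ (just c , s)  (nothing , s′) = just (c , (s xor s′) xor ν c)
    χ (just i , s)  (just j , s′)  = χ₂ i j s s′ (i ≟ j)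

    μ-eq : ∀ (c : Fin M) (b s : Bool) → μ (just (c , b)) (just c , s) ≡ (nothing , s xor (b xor ν c))
    μ-eq c b s with c ≟ c
    ... | yes _ = refl
    ... | no n  = contradiction refl n

    μ-neq : ∀ {c : Fin M} {b : Bool} {i : Fin M} {s : Bool} → i ≢ c → μ (just (c , b)) (just i , s) ≡ (just (c ⊕ c ⊝ i) , s xor b)
    μ-neq {c} {b} {i} n with i ≟ c
    ... | yes e = contradiction e n
    ... | no _  = refl

    χ-neq : ∀ {i j : Fin M} {s s′ : Bool} → i ≢ j → χ (just i , s) (just j , s′) ≡ just (mid i j , s xor s′)
    χ-neq {i} {j} n with i ≟ j
    ... | yes e = contradiction e n
    ... | no _  = refl

    χ-eq : ∀ (i : Maybe (Fin M)) (s s′ : Bool) → χ (i , s) (i , s′) ≡ nothing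
    χ-eq nothing  s s′ = refl
    χ-eq (just i) s s′ with i ≟ i
    ... | yes _ = refl
    ... | no n  = contradiction refl n

    xor-twice : ∀ a b → (a xor b) xor b ≡ a
    xor-twice = xor-solve 2 (λ a b → (a :+ b) :+ b := a) refl

    not-xor-not : ∀ s b → not s xor not b ≡ s xor b
    not-xor-not true  b = refl
    not-xor-not false b = 𝔹.not-involutive b

    not-xor-not′ : ∀ s b n → not s xor (not b xor n) ≡ s xor (b xor n)
    not-xor-not′ s b n = trans (cong (not s xor_) (sym (not-xor b n))) (not-xor-not s (b xor n))

    not≢ : ∀ b → not b ≢ b
    not≢ true  ()
    not≢ false ()

    ≢⇒not : ∀ {a b} → a ≢ b → not a ≡ b
    ≢⇒not {true}  {true}  n = contradiction refl n
    ≢⇒not {true}  {false} _ = refl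
    ≢⇒not {false} {true}  _ = refl
    ≢⇒not {false} {false} n = contradiction refl n

    μ-invol : ∀ c y → μ c (μ c y) ≡ y
    μ-invol nothing        (i , s)       = cong (i ,_) (𝔹.not-involutive s)
    μ-invol (just (c , b)) (nothing , s) = trans (μ-eq c b _) (cong (nothing ,_) (xor-twice s (b xor ν c)))
    μ-invol (just (c , b)) (just i , s)  = go (i ≟ c)
      where
        go : Dec (i ≡ c) → μ (just (c , b)) (μ (just (c , b)) (just i , s)) ≡ (just i , s)
        go (yes refl) = trans (cong (μ (just (c , b))) (μ-eq c b s)) (cong (just c ,_) (xor-twice s (b xor ν c)))
        go (no n) = trans (cong (μ (just (c , b))) (μ-neq n)) (trans (μ-neq (reflect≢c n))
          (cong₂ _,_ (cong just (reflect-invol c i)) (xor-twice s b)))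

    μ-fpf : ∀ c y → μ c y ≢ y
    μ-fpf nothing        (i , s)       e = not≢ s (cong proj₂ e)
    μ-fpf (just (c , b)) (nothing , s) e = contradiction (cong proj₁ e) λ ()
    μ-fpf (just (c , b)) (just i , s)  e = go (i ≟ c)
      where
        go : Dec (i ≡ c) → ⊥
        go (yes refl) = contradiction (cong proj₁ (trans (sym (μ-eq c b s)) e)) λ ()
        go (no n) = reflect≢ n (just-injective (cong proj₁ (trans (sym (μ-neq n)) e)))

    χ-μ : ∀ c y → χ y (μ c y) ≡ c
    χ-μ nothing        (i , s)       = χ-eq i s (not s)
    χ-μ (just (c , b)) (nothing , s) = cong (λ t → just (c , t))
      (xor-solve 3 (λ s b n → (s :+ (s :+ (b :+ n))) :+ n := b) refl s b (ν c))
    χ-μ (just (c , b)) (just i , s)  = go (i ≟ c)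
      where
        go : Dec (i ≡ c) → χ (just i , s) (μ (just (c , b)) (just i , s)) ≡ just (c , b)
        go (yes refl) = trans (cong (χ (just c , s)) (μ-eq c b s)) (cong (λ t → just (c , t))
          (xor-solve 3 (λ s b n → (s :+ (s :+ (b :+ n))) :+ n := b) refl s b (ν c)))
        go (no n) = trans (cong (χ (just i , s)) (μ-neq n)) (trans (χ-neq (reflect≢ n ∘ sym))
          (cong just (cong₂ _,_ (mid-uniq (solve (c ∷ i ∷ []) (v₀ :⊕ v₀) (v₁ :⊕ (v₀ :⊕ v₀ :- v₁)) refl))
            (xor-solve 2 (λ s b → s :+ (s :+ b) := b) refl s b))))

    χ-spec : ∀ {y y′} → y ≢ y′ → μ (χ y y′) y ≡ y′
    χ-spec {nothing , s} {nothing , s′} n = cong (nothing ,_) (≢⇒not (n ∘ cong (nothing ,_)))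
    χ-spec {nothing , s} {just c , s′}  n = cong (just c ,_)
      (xor-solve 3 (λ s t n → s :+ (((s :+ t) :+ n) :+ n) := t) refl s s′ (ν c))
    χ-spec {just c , s}  {nothing , s′} n = trans (μ-eq c _ s) (cong (nothing ,_)
      (xor-solve 3 (λ s t n → s :+ (((s :+ t) :+ n) :+ n) := t) refl s s′ (ν c)))
    χ-spec {just i , s}  {just j , s′}  n = go (i ≟ j)
      where
        go : Dec (i ≡ j) → μ (χ (just i , s) (just j , s′)) (just i , s) ≡ (just j , s′)
        go (yes refl) = trans (cong (λ c → μ c (just i , s)) (χ-eq (just i) s s′)) (cong (just i ,_) (≢⇒not (n ∘ cong (just i ,_))))
        go (no n′) = trans (cong (λ c → μ c (just i , s)) (χ-neq n′)) (trans (μ-neq (mid≢ˡ n′ ∘ sym))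
          (cong₂ _,_ (cong just (reflect-mid i j)) (xor-solve 2 (λ s t → s :+ (s :+ t) := t) refl s s′)))

  oneFact : OneFact Colour Vertex
  oneFact = record
    { μ = μ ; μ-invol = μ-invol ; μ-fpf = μ-fpf
    ; μ-inj = λ {c} {c′} y e → trans (sym (χ-μ c y)) (trans (cong (χ y) e) (χ-μ c′ y))
    ; χ = χ ; χ-spec = χ-spec }

  open OneFact oneFact using (Sub; χ-uniq)

  -- The shift in `link` matters: without it `nothing`, `(c , false)` and `(c , true)` would form a
  -- block of `G`, and they are also the colours of a sub-one-factorization on the four vertices
  -- over ∞ and `c`.
  module _ (em : ExcludedMiddle 0ℓ) (G : Squag Colour)
           (link : ∀ c → Squag._∙_ G nothing (just (c , false)) ≡ just (c ⊕ [ 1 ] , true)) where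
    open Squag G using (_∙_; Closed)

    module _ (K : Colour → Set) (T : Vertex → Set) (K-closed : Closed K) (sub : Sub K T) where
      open Sub sub

      private
        -- If the sheets are exchanged then linked colours propagate everywhere.
        with-ω : ∀ {y c b} → T y → K nothing → K (just (c , b)) → ∀ d → K d
        with-ω {y} ty kω k = λ { nothing → kω ; (just (d , b)) → both d b (all d) }
          where
            flip : ∀ {c b} → K (just (c , b)) → K (just (c , not b))
            flip {c} {b} k = colour (μ-closed kω ty) (μ-closed k ty) (e y)
              where
                e : ∀ y → μ (just (c , not b)) (μ nothing y) ≡ μ (just (c , b)) y
                e (nothing , s) = cong (just c ,_) (not-xor-not′ s b (ν c))
                e (just i , s) with i ≟ c
                ... | yes _ = cong (nothing ,_) (not-xor-not′ s b (ν c))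
                ... | no _ = cong (just (c ⊕ c ⊝ i) ,_) (not-xor-not s b)
            P : Fin M → Set
            P c = K (just (c , false)) × K (just (c , true))
            pair : ∀ {c} b → K (just (c , b)) → P c
            pair true  k = flip k , k
            pair false k = k , flip k
            both : ∀ d b → P d → K (just (d , b))
            both d true  = proj₂
            both d false = proj₁
            all : ∀ d → P d
            all = generate P (λ c p → pair true (subst K (link c) (K-closed kω (proj₁ p)))) (pair _ k)

        -- An edge between the two vertices over one index has colour `nothing`. If this colour is
        -- absent, the vertices form a partial section of the two sheets, and it remains to show
        -- that three of them cannot occur.
        module WithoutSwap (¬kω : ¬ K nothing) where
          sheet : ∀ {i s s′} → T (i , s) → T (i , s′) → s ≡ s′
          sheet {i} {s} {s′} t t′ with s 𝔹.≟ s′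
          ... | yes e = e
          ... | no n  = contradiction (subst K (χ-eq i s s′) (χ-closed (n ∘ cong proj₂) t t′)) ¬kω

          On : Maybe (Fin M) → Set
          On i = ∃[ s ] T (i , s)

          -- The midpoint of two indices in use cannot be in use, as a colour centred there would
          -- join it to ∞. But two reflections compose to the translation by `j ⊝ i`, and this
          -- reaches `mid i j` from `i`.
          module NoInfinity (no-∞ : ¬ On nothing) where
            flip-mid : ∀ {i j x} → i ≢ j → On (just i) → On (just j) → On (just x) → x ≢ mid i j × On (just (i ⊕ j ⊝ x))
            flip-mid {i} {j} {x} n (s , ti) (s′ , tj) (u , tx) = x≢ , _ ,
                subst T (trans (μ-neq x≢) (cong (λ z → just (z ⊝ x) , u xor (s xor s′)) (mid+mid i j))) (μ-closed k tx)
              where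
                k : K (just (mid i j , s xor s′))
                k = subst K (χ-neq n) (χ-closed (n ∘ just-injective ∘ cong proj₁) ti tj)
                x≢ : x ≢ mid i j
                x≢ refl = no-∞ (_ , subst T (μ-eq (mid i j) (s xor s′) u) (μ-closed k tx))

            absurd : ∀ {i j k} → i ≢ j → i ≢ k → j ≢ k → On (just i) → On (just j) → On (just k) → ⊥
            absurd {i} {j} {k} i≢j i≢k j≢k ti tj tk =
              proj₁ (flip-mid i≢j ti tj (translate-mid (On ∘ just) i j step ti)) refl
              where
                step : ∀ z → On (just z) → On (just (z ⊕ (j ⊝ i)))
                step z tz = subst (On ∘ just) (solve (i ∷ j ∷ k ∷ z ∷ []) (v₁ :⊕ v₂ :- (v₀ :⊕ v₂ :- v₃)) (v₃ :⊕ (v₁ :- v₀)) refl)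
                  (proj₂ (flip-mid j≢k tj tk (proj₂ (flip-mid i≢k ti tk tz))))

          module AtInfinity {s∞} (t∞ : T (nothing , s∞)) where
            F : Fin M → Set
            F c = On (just c)

            spoke : ∀ {c s} → T (just c , s) → K (just (c , (s∞ xor s) xor ν c))
            spoke t = χ-closed (λ ()) t∞ t

            centre : ∀ {c b} → K (just (c , b)) → F c
            centre k = _ , μ-closed k t∞

            chord : ∀ {x y s s′} → x ≢ y → T (just x , s) → T (just y , s′) → K (just (mid x y , s xor s′))
            chord n t t′ = subst K (χ-neq n) (χ-closed (n ∘ just-injective ∘ cong proj₁) t t′)

            -- Both colours lead from the vertex at ∞ to the index `c`, where only one sheet is
            -- available.
            unique : ∀ {c b b′} → K (just (c , b)) → K (just (c , b′)) → b ≡ b′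
            unique {c} {b} {b′} k k′ = xor-cancel s∞ b b′ (ν c) (sheet (μ-closed k t∞) (μ-closed k′ t∞))
              where
                xor-cancel : ∀ s b b′ n → s xor (b xor n) ≡ s xor (b′ xor n) → b ≡ b′
                xor-cancel s b b′ n e = trans (xor-solve 3 (λ s b n → b := (s :+ (b :+ n)) :+ (s :+ n)) refl s b n)
                  (trans (cong (_xor (s xor n)) e) (xor-solve 3 (λ s b n → (s :+ (b :+ n)) :+ (s :+ n) := b) refl s b′ n))

            F-mid : ∀ {x y} → x ≢ y → F x → F y → F (mid x y)
            F-mid n (_ , t) (_ , t′) = centre (chord n t t′)

            F-reflect : ∀ {c x} → x ≢ c → F c → F x → F (c ⊕ c ⊝ x)
            F-reflect n (_ , tc) (_ , tx) = _ , subst T (μ-neq n) (μ-closed (spoke tc) tx)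

            -- The chord from `x` to `y` and the spoke to their midpoint have colours with the same
            -- centre, so `unique` equates them. The twist `ν` enters through the spoke alone.
            relation : ∀ {x y c s s′ u} → x ≢ y → mid x y ≡ c → T (just x , s) → T (just y , s′) → T (just c , u) →
                       (s xor s′) xor ((s∞ xor u) xor ν c) ≡ false
            relation {s = s} {s′} n refl t t′ tc = trans (cong ((s xor s′) xor_) (sym (unique (chord n t t′) (spoke tc)))) (xor-same (s xor s′))

            -- Summing the relations over an arithmetic progression x₀,…,x₄ leaves ν x₁ + ν x₃ = 0.
            ν-constant : ∀ {x y} → x ≢ y → F x → F y → ν x ≡ ν y
            ν-constant {x₁} {x₃} n f₁@(s₁ , t₁) f₃@(s₃ , t₃) = go (F-mid n f₁ f₃) (F-reflect x₂≢x₁ f₁ (F-mid n f₁ f₃)) (F-reflect x₂≢x₃ f₃ (F-mid n f₁ f₃))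
              where
                x₂ = mid x₁ x₃
                x₀ = x₁ ⊕ x₁ ⊝ x₂
                x₄ = x₃ ⊕ x₃ ⊝ x₂
                x₂≢x₁ : x₂ ≢ x₁
                x₂≢x₁ = mid≢ˡ n
                x₂≢x₃ : x₂ ≢ x₃
                x₂≢x₃ e = mid≢ˡ (n ∘ sym) (trans (cong half (Z.comm x₃ x₁)) e)
                x₀≢x₂ : x₀ ≢ x₂
                x₀≢x₂ = reflect≢ x₂≢x₁
                x₂≢x₄ : x₂ ≢ x₄
                x₂≢x₄ = reflect≢ x₂≢x₃ ∘ sym
                x₀≢x₄ : x₀ ≢ x₄
                x₀≢x₄ e = n (double-inj (Z.cancelʳ (⊖ x₂) e))
                mid₀₂ : mid x₀ x₂ ≡ x₁
                mid₀₂ = mid-uniq (solve (x₁ ∷ x₂ ∷ []) (v₀ :⊕ v₀) (v₀ :⊕ v₀ :- v₁ :⊕ v₁) refl)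
                mid₂₄ : mid x₂ x₄ ≡ x₃
                mid₂₄ = mid-uniq (solve (x₃ ∷ x₂ ∷ []) (v₀ :⊕ v₀) (v₁ :⊕ (v₀ :⊕ v₀ :- v₁)) refl)
                mid₀₄ : mid x₀ x₄ ≡ x₂
                mid₀₄ = mid-uniq (trans (solve (x₂ ∷ []) (v₀ :⊕ v₀) (v₀ :⊕ v₀ :⊕ (v₀ :⊕ v₀) :- v₀ :- v₀) refl)
                  (trans (cong (λ z → z ⊕ z ⊝ x₂ ⊝ x₂) (mid+mid x₁ x₃))
                    (solve (x₁ ∷ x₂ ∷ x₃ ∷ []) (v₀ :⊕ v₂ :⊕ (v₀ :⊕ v₂) :- v₁ :- v₁) ((v₀ :⊕ v₀ :- v₁) :⊕ (v₂ :⊕ v₂ :- v₁)) refl)))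
                sum₄ : ∀ {a b c d} → a ≡ false → b ≡ false → c ≡ false → d ≡ false → ((a xor b) xor c) xor d ≡ false
                sum₄ refl refl refl refl = refl
                go : F x₂ → F x₀ → F x₄ → ν x₁ ≡ ν x₃
                go (s₂ , t₂) (s₀ , t₀) (s₄ , t₄) = xor-moveʳ (trans
                  (xor-solve 9 (λ a s₀ s₁ s₂ s₃ s₄ n₁ n₂ n₃ → n₁ :+ n₃ :=
                    ((((s₀ :+ s₂) :+ ((a :+ s₁) :+ n₁)) :+ ((s₁ :+ s₃) :+ ((a :+ s₂) :+ n₂)))
                    :+ ((s₂ :+ s₄) :+ ((a :+ s₃) :+ n₃))) :+ ((s₀ :+ s₄) :+ ((a :+ s₂) :+ n₂))) refl
                    s∞ s₀ s₁ s₂ s₃ s₄ (ν x₁) (ν x₂) (ν x₃))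
                  (sum₄ (relation x₀≢x₂ mid₀₂ t₀ t₂ t₁) (relation n refl t₁ t₃ t₂)
                        (relation x₂≢x₄ mid₂₄ t₂ t₄ t₃) (relation x₀≢x₄ mid₀₄ t₀ t₄ t₂)))

            -- For x < y the reflection 2x − y is either smaller than x or has the parity opposite to that of y.
            descent : ∀ n {x y} → toℕ x < n → toℕ x < toℕ y → F x → F y → ⊥
            descent (suc n) {x} {y} (s≤s x≤n) x<y fx fy = go (toℕ-⊕ z y) (toℕ-⊕ x x)
              where
                z = x ⊕ x ⊝ y
                y≢x : y ≢ x
                y≢x refl = ℕₚ.<-irrefl refl x<y
                fz : F z
                fz = F-reflect y≢x fx fy
                e : z ⊕ y ≡ x ⊕ x
                e = solve (x ∷ y ∷ []) (v₀ :⊕ v₀ :- v₁ :⊕ v₁) (v₀ :⊕ v₀) refl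
                smaller : toℕ z + toℕ y ≡ toℕ x + toℕ x → ⊥
                smaller q = descent n (ℕₚ.<-≤-trans z<x x≤n) z<x fz fx
                  where
                    z<x : toℕ z < toℕ x
                    z<x = ℕₚ.+-cancelʳ-< (toℕ y) (toℕ z) (toℕ x) (subst (_< toℕ x + toℕ y) (sym q) (ℕₚ.+-monoʳ-< (toℕ x) x<y))
                same-parity : odd (toℕ z) ≡ odd (toℕ y)
                same-parity with z ≟ y
                ... | yes q = cong (odd ∘ toℕ) q
                ... | no q  = ν-constant q fz fy
                wrapped : toℕ z + toℕ y ≡ toℕ x + toℕ x + M → ⊥
                wrapped q = contradiction (trans (sym (xor-same (odd (toℕ y)))) (trans (cong (_xor odd (toℕ y)) (sym same-parity))
                  (trans (sym (odd-+ (toℕ z) (toℕ y))) (trans (cong odd q) (trans (odd-+ (toℕ x + toℕ x) M)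
                  (cong₂ _xor_ (trans (odd-+ (toℕ x) (toℕ x)) (xor-same (odd (toℕ x)))) (cong not (trans (odd-+ r r) (xor-same (odd r)))))))))) λ ()
                go : toℕ (z ⊕ y) ≡ toℕ z + toℕ y ⊎ toℕ (z ⊕ y) + M ≡ toℕ z + toℕ y →
                     toℕ (x ⊕ x) ≡ toℕ x + toℕ x ⊎ toℕ (x ⊕ x) + M ≡ toℕ x + toℕ x → ⊥
                go (inj₁ p) (inj₁ q) = smaller (trans (sym p) (trans (cong toℕ e) q))
                go (inj₂ p) (inj₂ q) = smaller (trans (sym p) (trans (cong (λ w → toℕ w + M) e) q))
                go (inj₂ p) (inj₁ q) = wrapped (trans (sym p) (cong (_+ M) (trans (cong toℕ e) q)))
                go (inj₁ p) (inj₂ q) = ℕₚ.<-irrefl (sym q) (ℕₚ.<-≤-trans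
                  (ℕₚ.+-mono-< x<y (toℕ<n x)) (ℕₚ.+-monoˡ-≤ M (subst (toℕ y ≤_) (sym (trans (sym (cong toℕ e)) p)) (ℕₚ.m≤n+m (toℕ y) (toℕ z)))))

            absurd : ∀ {x y} → x ≢ y → F x → F y → ⊥
            absurd {x} {y} n fx fy with ℕₚ.<-cmp (toℕ x) (toℕ y)
            ... | tri< p _ _ = descent M (toℕ<n x) p fx fy
            ... | tri≈ _ p _ = n (toℕ-injective p)
            ... | tri> _ _ p = descent M (toℕ<n y) p fy fx

          impossible : ∀ {i j k} → i ≢ j → i ≢ k → j ≢ k → On i → On j → On k → ⊥
          impossible {nothing} {nothing} i≢j _ _ _ _ _ = i≢j refl
          impossible {nothing} {just _} {nothing} _ i≢k _ _ _ _ = i≢k refl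
          impossible {just _} {nothing} {nothing} _ _ j≢k _ _ _ = j≢k refl
          impossible {nothing} {just _} {just _} _ _ j≢k (_ , t) tj tk = AtInfinity.absurd t (j≢k ∘ cong just) tj tk
          impossible {just _} {nothing} {just _} _ i≢k _ ti (_ , t) tk = AtInfinity.absurd t (i≢k ∘ cong just) ti tk
          impossible {just _} {just _} {nothing} i≢j _ _ ti tj (_ , t) = AtInfinity.absurd t (i≢j ∘ cong just) ti tj
          impossible {just _} {just _} {just _} i≢j i≢k j≢k ti tj tk with em {On nothing}
          ... | yes (_ , t) = AtInfinity.absurd t (i≢j ∘ cong just) ti tj
          ... | no no-∞     = NoInfinity.absurd no-∞ (i≢j ∘ cong just) (i≢k ∘ cong just) (j≢k ∘ cong just) ti tj tk

      conclude : ∀ {y c c′} → T y → K c → K c′ → c ≢ c′ → ∀ d → K d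
      conclude {y} {c} {c′} ty kc kc′ n with em {K nothing}
      conclude {y} {nothing} {nothing} ty kc kc′ n | yes kω = contradiction refl n
      conclude {y} {just _}  {_}       ty kc kc′ n | yes kω = with-ω ty kω kc
      conclude {y} {nothing} {just _}  ty kc kc′ n | yes kω = with-ω ty kω kc′
      -- The vertex `y` and its neighbours in the colours `c` and `c′` lie over three distinct
      -- indices.
      conclude {y} {c} {c′} ty kc kc′ n | no ¬kω =
        ⊥-elim (impossible (apart ty t₁ (μ-fpf c y ∘ sym)) (apart ty t₂ (μ-fpf c′ y ∘ sym))
          (apart t₁ t₂ (n ∘ OneFact.μ-inj oneFact y)) (_ , ty) (_ , t₁) (_ , t₂))
        where
          open WithoutSwap ¬kω
          t₁ = μ-closed kc ty
          t₂ = μ-closed kc′ ty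
          apart : ∀ {y y′} → T y → T y′ → y ≢ y′ → proj₁ y ≢ proj₁ y′
          apart {i , s} {_ , s′} t t′ n refl = n (cong (i ,_) (sheet t t′))

    rigid : Rigid G oneFact
    rigid K T K-closed sub = conclude K T K-closed sub

-- The one-factorization GA of K₂ₘ, m odd, on two copies of ℤ/m: the pure colour c joins x and 2c − x in both
-- copies and c with its twin, the cross colour d ≠ 0 joins x in the first copy with x + d in the second.
-- All the sub-one-factorizations with vertex set H × {0,1} + a, H a subgroup, use the same cross colours H ∖ 0.
module PureCross (r : ℕ) where
  open OddCyclic r
  private
    k m : ℕ
    k = r + r
    m = suc k
    module Z = Ab ℤ/

  Colour Vertex : Set
  Colour = Fin m ⊎ Fin k
  Vertex = Fin m × Bool

  private
    μ₂ : ∀ (c i : Fin m) (s : Bool) → Dec (i ≡ c) → Vertex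
    μ₂ c i s (yes _) = i , not s
    μ₂ c i s (no _)  = c ⊕ c ⊝ i , s

    μ : Colour → Vertex → Vertex
    μ (inj₁ c) (i , s)     = μ₂ c i s (i ≟ c)
    μ (inj₂ d) (i , false) = i ⊕ suc d , true
    μ (inj₂ d) (i , true)  = i ⊝ suc d , false

    χ₀ : Fin m → Fin m → Colour
    χ₀ i zero    = inj₁ i
    χ₀ i (suc d) = inj₂ d

    χ : Vertex → Vertex → Colour
    χ (i , false) (j , false) = inj₁ (mid i j)
    χ (i , true)  (j , true)  = inj₁ (mid i j)
    χ (i , false) (j , true)  = χ₀ i (j ⊝ i)
    χ (i , true)  (j , false) = χ₀ i (i ⊝ j)

    μ-eq : ∀ (c : Fin m) (s : Bool) → μ (inj₁ c) (c , s) ≡ (c , not s)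
    μ-eq c s with c ≟ c
    ... | yes _ = refl
    ... | no n  = contradiction refl n

    μ-neq : ∀ {c i : Fin m} {s : Bool} → i ≢ c → μ (inj₁ c) (i , s) ≡ (c ⊕ c ⊝ i , s)
    μ-neq {c} {i} n with i ≟ c
    ... | yes e = contradiction e n
    ... | no _  = refl

    χ-same : ∀ (i j : Fin m) (s : Bool) → χ (i , s) (j , s) ≡ inj₁ (mid i j)
    χ-same i j false = refl
    χ-same i j true  = refl

    χ-twin : ∀ (i : Fin m) (s : Bool) → χ (i , s) (i , not s) ≡ inj₁ i
    χ-twin i false = cong (χ₀ i) (Z.inverseʳ i)
    χ-twin i true  = cong (χ₀ i) (Z.inverseʳ i)

    not≢ : ∀ b → not b ≢ b
    not≢ true  ()
    not≢ false ()

    μ-invol : ∀ c y → μ c (μ c y) ≡ y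
    μ-invol (inj₁ c) (i , s) = go (i ≟ c)
      where
        go : Dec (i ≡ c) → μ (inj₁ c) (μ (inj₁ c) (i , s)) ≡ (i , s)
        go (yes refl) = trans (cong (μ (inj₁ c)) (μ-eq c s)) (trans (μ-eq c (not s)) (cong (c ,_) (𝔹.not-involutive s)))
        go (no n) = trans (cong (μ (inj₁ c)) (μ-neq n)) (trans (μ-neq (reflect≢c n)) (cong (_, s) (reflect-invol c i)))
    μ-invol (inj₂ d) (i , false) = cong (_, false) (solve (i ∷ suc d ∷ []) (v₀ :⊕ v₁ :- v₁) v₀ refl)
    μ-invol (inj₂ d) (i , true)  = cong (_, true) (solve (i ∷ suc d ∷ []) (v₀ :- v₁ :⊕ v₁) v₀ refl)

    μ-fpf : ∀ c y → μ c y ≢ y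
    μ-fpf (inj₁ c) (i , s) e = go (i ≟ c)
      where
        go : Dec (i ≡ c) → ⊥
        go (yes refl) = not≢ s (cong proj₂ (trans (sym (μ-eq c s)) e))
        go (no n) = reflect≢ n (cong proj₁ (trans (sym (μ-neq n)) e))
    μ-fpf (inj₂ d) (i , false) e = contradiction (cong proj₂ e) λ ()
    μ-fpf (inj₂ d) (i , true)  e = contradiction (cong proj₂ e) λ ()

    χ-μ : ∀ c y → χ y (μ c y) ≡ c
    χ-μ (inj₁ c) (i , s) = go (i ≟ c)
      where
        go : Dec (i ≡ c) → χ (i , s) (μ (inj₁ c) (i , s)) ≡ inj₁ c
        go (yes refl) = trans (cong (χ (c , s)) (μ-eq c s)) (χ-twin c s)
        go (no n) = trans (cong (χ (i , s)) (μ-neq n)) (trans (χ-same i _ s)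
          (cong inj₁ (mid-uniq (solve (c ∷ i ∷ []) (v₀ :⊕ v₀) (v₁ :⊕ (v₀ :⊕ v₀ :- v₁)) refl))))
    χ-μ (inj₂ d) (i , false) = cong (χ₀ i) (solve (i ∷ suc d ∷ []) (v₀ :⊕ v₁ :- v₀) v₁ refl)
    χ-μ (inj₂ d) (i , true)  = cong (χ₀ i) (solve (i ∷ suc d ∷ []) (v₀ :- (v₀ :- v₁)) v₁ refl)

    difference-0 : ∀ {i j} → j ⊝ i ≡ zero → i ≡ j
    difference-0 {i} {j} e = sym (trans (solve (i ∷ j ∷ []) v₁ (v₀ :⊕ (v₁ :- v₀)) refl) (trans (cong (i ⊕_) e) (Z.identʳ i)))

    χ₀-false : ∀ i j z → j ⊝ i ≡ z → μ (χ₀ i z) (i , false) ≡ (j , true)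
    χ₀-false i j zero    e = trans (μ-eq i false) (cong (_, true) (difference-0 e))
    χ₀-false i j (suc d) e = cong (_, true) (trans (cong (i ⊕_) (sym e)) (solve (i ∷ j ∷ []) (v₀ :⊕ (v₁ :- v₀)) v₁ refl))

    χ₀-true : ∀ i j z → i ⊝ j ≡ z → μ (χ₀ i z) (i , true) ≡ (j , false)
    χ₀-true i j zero    e = trans (μ-eq i true) (cong (_, false) (sym (difference-0 e)))
    χ₀-true i j (suc d) e = cong (_, false) (trans (cong (i ⊝_) (sym e)) (solve (i ∷ j ∷ []) (v₀ :- (v₀ :- v₁)) v₁ refl))

    χ-spec : ∀ {y y′} → y ≢ y′ → μ (χ y y′) y ≡ y′
    χ-spec {i , false} {j , true}  n = χ₀-false i j _ refl
    χ-spec {i , true}  {j , false} n = χ₀-true i j _ refl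
    χ-spec {i , false} {j , false} n = trans (μ-neq (mid≢ˡ (n ∘ cong (_, false)) ∘ sym)) (cong (_, false) (reflect-mid i j))
    χ-spec {i , true}  {j , true}  n = trans (μ-neq (mid≢ˡ (n ∘ cong (_, true)) ∘ sym)) (cong (_, true) (reflect-mid i j))

  oneFact : OneFact Colour Vertex
  oneFact = record
    { μ = μ ; μ-invol = μ-invol ; μ-fpf = μ-fpf
    ; μ-inj = λ {c} {c′} y e → trans (sym (χ-μ c y)) (trans (cong (χ y) e) (χ-μ c′ y))
    ; χ = χ ; χ-spec = χ-spec }

  open OneFact oneFact using (Sub; χ-uniq)

  -- By `link`, opposite cross colours other than ±1 generate the cross colour 1. Hence the cross
  -- colours from a proper nontrivial subgroup are never closed in `G`.
  module _ (em : ExcludedMiddle 0ℓ) (G : Squag Colour) (one : Fin k) (one≡1 : suc one ≡ [ 1 ])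
           (link : ∀ d d′ → suc d ⊕ suc d′ ≡ zero → d ≢ one → d′ ≢ one → Squag._∙_ G (inj₂ d) (inj₂ d′) ≡ inj₂ one) where
    open Squag G using (_∙_; Closed)

    module _ (K : Colour → Set) (T : Vertex → Set) (K-closed : Closed K) (sub : Sub K T) where
      open Sub sub

      private
        pure : ∀ {i j s} → i ≢ j → T (i , s) → T (j , s) → K (inj₁ (mid i j))
        pure {i} {j} {s} n t t′ = subst K (χ-same i j s) (χ-closed (n ∘ cong proj₁) t t′)

        cross : ∀ {i j} → i ≢ j → T (i , false) → T (j , true) → ∃[ d ] (K (inj₂ d) × suc d ≡ j ⊝ i)
        cross {i} {j} n t t′ = go (j ⊝ i) refl
          where
            go : ∀ z → j ⊝ i ≡ z → ∃[ d ] (K (inj₂ d) × suc d ≡ j ⊝ i)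
            go zero    e = contradiction (difference-0 e) n
            go (suc d) e = d , colour t t′ (χ₀-false i j (suc d) e) , sym e

        -- The pure colour centred at a midpoint would join it to its twin, so midpoints within a
        -- copy do not occur. Yet three vertices, two of them `i`, `j` in one copy, yield the
        -- translation of that copy by `j ⊝ i`, from two reflections or from two cross colours, and
        -- it reaches the midpoint.
        module _ (no-twins : ∀ {c} → T (c , false) → T (c , true) → ⊥) where
          untwinned : ∀ {c} s → T (c , s) → T (c , not s) → ⊥
          untwinned false t t′ = no-twins t t′
          untwinned true  t t′ = no-twins t′ t

          no-midpoint : ∀ {i j s} → i ≢ j → T (i , s) → T (j , s) → T (mid i j , s) → ⊥
          no-midpoint {s = s} n ti tj t = untwinned s t (subst T (μ-eq _ s) (μ-closed (pure n ti tj) t))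

          reflect : ∀ {i j x s} → i ≢ j → T (i , s) → T (j , s) → T (x , s) → T (i ⊕ j ⊝ x , s)
          reflect {i} {j} {x} {s} n ti tj tx = subst T (trans (μ-neq x≢) (cong (λ z → z ⊝ x , s) (mid+mid i j))) (μ-closed (pure n ti tj) tx)
            where
              x≢ : x ≢ mid i j
              x≢ refl = no-midpoint n ti tj tx

          not-three : ∀ {i j l s} → i ≢ j → i ≢ l → j ≢ l → T (i , s) → T (j , s) → T (l , s) → ⊥
          not-three {i} {j} {l} {s} i≢j i≢l j≢l ti tj tl = no-midpoint i≢j ti tj (translate-mid (λ z → T (z , s)) i j step ti)
            where
              step : ∀ z → T (z , s) → T (z ⊕ (j ⊝ i) , s)
              step z tz = subst (λ w → T (w , s)) (solve (i ∷ j ∷ l ∷ z ∷ []) (v₁ :⊕ v₂ :- (v₀ :⊕ v₂ :- v₃)) (v₃ :⊕ (v₁ :- v₀)) refl)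
                (reflect j≢l tj tl (reflect i≢l ti tl tz))

          not-two-one : ∀ {i j l} s → i ≢ j → T (i , s) → T (j , s) → T (l , not s) → ⊥
          not-two-one {i} {j} {l} false n ti tj tl = no-midpoint n ti tj (translate-mid (λ z → T (z , false)) i j step ti)
            where
              step : ∀ z → T (z , false) → T (z ⊕ (j ⊝ i) , false)
              step z tz with cross (λ { refl → no-twins ti tl }) ti tl | cross (λ { refl → no-twins tj tl }) tj tl
              ... | d , kd , e | d′ , kd′ , e′ = subst (λ w → T (w , false)) (trans (cong₂ (λ u v → z ⊕ u ⊝ v) e e′)
                (solve (i ∷ j ∷ l ∷ z ∷ []) (v₃ :⊕ (v₂ :- v₀) :- (v₂ :- v₁)) (v₃ :⊕ (v₁ :- v₀)) refl)) (μ-closed kd′ (μ-closed kd tz))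
          not-two-one {i} {j} {l} true n ti tj tl = no-midpoint n ti tj (translate-mid (λ z → T (z , true)) i j step ti)
            where
              step : ∀ z → T (z , true) → T (z ⊕ (j ⊝ i) , true)
              step z tz with cross (λ { refl → no-twins tl ti }) tl ti | cross (λ { refl → no-twins tl tj }) tl tj
              ... | d , kd , e | d′ , kd′ , e′ = subst (λ w → T (w , true)) (trans (cong₂ (λ u v → z ⊝ u ⊕ v) e e′)
                (solve (i ∷ j ∷ l ∷ z ∷ []) (v₃ :- (v₀ :- v₂) :⊕ (v₁ :- v₂)) (v₃ :⊕ (v₁ :- v₀)) refl)) (μ-closed kd′ (μ-closed kd tz))

          at-most-two : ∀ {y y′ y″} → y ≢ y′ → y ≢ y″ → y′ ≢ y″ → T y → T y′ → T y″ → ⊥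
          at-most-two {i , s} {j , s′} {l , s″} a b c t t′ t″ = go (s 𝔹.≟ s′) (s 𝔹.≟ s″) (s′ 𝔹.≟ s″)
            where
              not-eq : ∀ {a b} → a ≢ b → b ≡ not a
              not-eq {true}  {true}  n = contradiction refl n
              not-eq {true}  {false} _ = refl
              not-eq {false} {true}  _ = refl
              not-eq {false} {false} n = contradiction refl n
              go : Dec (s ≡ s′) → Dec (s ≡ s″) → Dec (s′ ≡ s″) → ⊥
              go (yes refl) (yes refl) _ = not-three (a ∘ cong (_, s)) (b ∘ cong (_, s)) (c ∘ cong (_, s)) t t′ t″
              go (yes refl) (no n) _ = not-two-one s (a ∘ cong (_, s)) t t′ (subst (λ u → T (l , u)) (not-eq n) t″)
              go (no n) (yes refl) _ = not-two-one s (b ∘ cong (_, s)) t t″ (subst (λ u → T (j , u)) (not-eq n) t′)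
              go (no n) (no _) (yes refl) = not-two-one s′ (c ∘ cong (_, s′)) t′ t″ (subst (λ u → T (i , u)) (not-eq (n ∘ sym)) t)
              go (no n) (no n′) (no n″) = n″ (trans (not-eq n) (sym (not-eq n′)))

        module _ {c} (tf : T (c , false)) (tt : T (c , true)) where
          kc : K (inj₁ c)
          kc = subst K (χ-twin c false) (χ-closed (λ e → contradiction (cong proj₂ e) λ ()) tf tt)

          reflect-c : ∀ {i s} → i ≢ c → T (c ⊕ c ⊝ i , s) → T (i , s)
          reflect-c {i} {s} n t = subst T (trans (μ-neq (reflect≢c n)) (cong (_, s) (reflect-invol c i))) (μ-closed kc t)

          -- The cross colour joining `(i , false)` to `(c , true)` takes `(c , false)` to index 2c
          -- - i in the second copy, and reflection in `c` brings this to `(i , true)`; likewise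
          -- with the copies exchanged.
          twin : ∀ {i s} → T (i , s) → T (i , not s)
          twin {i} {s} t = go (i ≟ c) s t
            where
              go : Dec (i ≡ c) → ∀ s → T (i , s) → T (i , not s)
              go (yes refl) false _ = tt
              go (yes refl) true  _ = tf
              go (no n) false t with cross n t tt
              ... | d , kd , e = reflect-c n (subst (λ z → T (z , true)) (trans (cong (c ⊕_) e)
                                   (solve (c ∷ i ∷ []) (v₀ :⊕ (v₀ :- v₁)) (v₀ :⊕ v₀ :- v₁) refl)) (μ-closed kd tf))
              go (no n) true t with cross (n ∘ sym) tf t
              ... | d , kd , e = reflect-c n (subst (λ z → T (z , false)) (trans (cong (c ⊝_) e)
                                   (solve (c ∷ i ∷ []) (v₀ :- (v₁ :- v₀)) (v₀ :⊕ v₀ :- v₁) refl)) (μ-closed kd tt))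

          -- Two twin pairs provide the cross colours c - i and i - c. Either one of them is `one`,
          -- or their product is.
          have-one : ∀ {i} → i ≢ c → T (i , false) → T (i , true) → K (inj₂ one)
          have-one {i} n uf ut with cross n uf tt | cross (n ∘ sym) tf ut
          ... | d , kd , e | d′ , kd′ , e′ with d ≟ one | d′ ≟ one
          ...   | yes refl | _        = kd
          ...   | no _     | yes refl = kd′
          ...   | no p     | no p′    = subst K (link d d′ (trans (cong₂ _⊕_ e e′)
                    (solve (c ∷ i ∷ []) (v₀ :- v₁ :⊕ (v₁ :- v₀)) :0 refl)) p p′) (K-closed kd kd′)

          -- The colour `one` followed by the passage to twins is a step by 1 around the circle.
          everything : K (inj₂ one) → ∀ i s → T (i , s)
          everything k1 i s = go s (all i)
            where
              all : ∀ i → T (i , false)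
              all = generate (λ i → T (i , false)) (λ x t → twin (subst (λ z → T (x ⊕ z , true)) one≡1 (μ-closed k1 t))) tf
              go : ∀ s → T (i , false) → T (i , s)
              go false t = t
              go true  t = twin t

          conclude : ∀ {y} → proj₁ y ≢ c → T y → ∀ d → K d
          conclude {i , s} n t d = colour (all c false) (all (proj₁ (μ d (c , false))) (proj₂ (μ d (c , false)))) refl
            where
              pair : ∀ s → T (i , s) → K (inj₂ one)
              pair false t = have-one n t (twin t)
              pair true  t = have-one n (twin t) t
              all = everything (pair s t)

        on-twins : ∀ {c} (y : Vertex) → proj₁ y ≡ c → y ≡ (c , false) ⊎ y ≡ (c , true)
        on-twins (c , false) refl = inj₁ refl
        on-twins (c , true)  refl = inj₂ refl

      three-suffice : ∀ {y y′ y″} → y ≢ y′ → y ≢ y″ → y′ ≢ y″ → T y → T y′ → T y″ → ∀ d → K d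
      three-suffice {y} {y′} {y″} a b c t t′ t″ d with em {∃[ c ] (T (c , false) × T (c , true))}
      ... | no none = ⊥-elim (at-most-two (λ u v → none (_ , u , v)) a b c t t′ t″)
      ... | yes (x , tf , tt) with proj₁ y ≟ x | proj₁ y′ ≟ x | proj₁ y″ ≟ x
      ...   | no n | _ | _ = conclude tf tt n t d
      ...   | _ | no n | _ = conclude tf tt n t′ d
      ...   | _ | _ | no n = conclude tf tt n t″ d
      ...   | yes p | yes p′ | yes p″ with on-twins y p | on-twins y′ p′ | on-twins y″ p″
      ...     | inj₁ q | inj₁ q′ | _ = contradiction (trans q (sym q′)) a
      ...     | inj₂ q | inj₂ q′ | _ = contradiction (trans q (sym q′)) a
      ...     | inj₁ q | inj₂ q′ | inj₁ q″ = contradiction (trans q (sym q″)) b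
      ...     | inj₁ q | inj₂ q′ | inj₂ q″ = contradiction (trans q′ (sym q″)) c
      ...     | inj₂ q | inj₁ q′ | inj₁ q″ = contradiction (trans q′ (sym q″)) c
      ...     | inj₂ q | inj₁ q′ | inj₂ q″ = contradiction (trans q (sym q″)) b

    rigid : Rigid G oneFact
    rigid K T K-closed sub {y} {c} {c′} ty kc kc′ n = three-suffice K T K-closed sub
        (μ-fpf c y ∘ sym) (μ-fpf c′ y ∘ sym) (n ∘ OneFact.μ-inj oneFact y) ty (μ-closed kc ty) (μ-closed kc′ ty)
      where open Sub sub

-- Labelling the colours by the points of `G`

bijection : ∀ {V W : Set} (φ : V → W) → (∀ {x y} → φ x ≡ φ y → x ≡ y) → (∀ w → ∃[ v ] φ v ≡ w) → V ↔ W
bijection φ φ-inj φ-sur = mk↔ₛ′ φ (λ w → proj₁ (φ-sur w)) (λ w → proj₂ (φ-sur w)) (λ v → φ-inj (proj₂ (φ-sur (φ v))))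

Maybe-↔ : ∀ {V : Set} {n} → V ↔ Fin n → Maybe V ↔ Fin (suc n)
Maybe-↔ {V} {n} i = bijection φ φ-inj φ-sur
  where
    φ : Maybe V → Fin (suc n)
    φ nothing  = zero
    φ (just v) = suc (Inverse.to i v)
    φ-inj : ∀ {x y} → φ x ≡ φ y → x ≡ y
    φ-inj {nothing} {nothing} _ = refl
    φ-inj {just _}  {just _}  e = cong just (↔-injective i (suc-injective e))
    φ-sur : ∀ w → ∃[ v ] φ v ≡ w
    φ-sur zero    = nothing , refl
    φ-sur (suc w) = just (Inverse.from i w) , cong suc (Inverse.strictlyInverseˡ i w)

×-Bool-↔ : ∀ {V : Set} {n} → V ↔ Fin n → (V × Bool) ↔ Fin (n * 2)
×-Bool-↔ {n = n} i = ↔-trans (i ×-↔ ↔-sym 2↔Bool) (↔-sym (*↔× {n} {2}))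

flip : ∀ {q} → Maybe (Fin q × Bool) → Maybe (Fin q × Bool)
flip nothing        = nothing
flip (just (k , b)) = just (k , not b)

-- The orbits of an involution with one fixed point. For multiplication by `o` in a Steiner
-- quasigroup of order g they are the blocks through `o` with `o` removed, so `pairs` is (g - 1)/2.
record Pairing {V : Set} (τ : V → V) (o : V) : Set where
  field
    pairs   : ℕ
    iso     : Maybe (Fin pairs × Bool) ↔ V
    iso-fix : Inverse.to iso nothing ≡ o
    iso-τ   : ∀ u → Inverse.to iso (flip u) ≡ τ (Inverse.to iso u)

  size : ∀ {n} → V ↔ Fin n → n ≡ suc (pairs * 2)
  size i = Fin-↔-≡ (↔-trans (↔-sym i) (↔-trans (↔-sym iso) (Maybe-↔ (×-Bool-↔ ↔-refl))))

pairing : ∀ {V : Set} {n} → V ↔ Fin n → (τ : V → V) → (∀ v → τ (τ v) ≡ v) → (o : V) → τ o ≡ o →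
          (∀ v → τ v ≡ v → v ≡ o) → Pairing τ o
pairing {V} {n} i τ τ-invol o fix only = record
  { pairs = size ; iso = bijection φ φ-inj φ-sur ; iso-fix = refl
  ; iso-τ = λ { nothing → sym fix ; (just (k , false)) → refl ; (just (k , true)) → sym (τ-invol _) } }
  where
    open Inverse i using (to; from; strictlyInverseˡ; strictlyInverseʳ)
    rank : V → ℕ
    rank v = toℕ (to v)
    -- The member of smaller rank represents its pair.
    E : Enum (λ x → rank (from x) < rank (τ (from x)))
    E = enum (λ x → rank (from x) ℕₚ.<? rank (τ (from x)))
    open Enum E
    rep : Fin size → V
    rep k = from (elem k)
    rep< : ∀ k → rank (rep k) < rank (τ (rep k))
    rep< = sound
    φ : Maybe (Fin size × Bool) → V
    φ nothing            = o
    φ (just (k , false)) = rep k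
    φ (just (k , true))  = τ (rep k)
    rep≢o : ∀ k → rep k ≢ o
    rep≢o k e = ℕₚ.<-irrefl refl (subst (rank o <_) (cong rank fix) (subst (λ v → rank v < rank (τ v)) e (rep< k)))
    rep≢τ : ∀ k l → rep k ≢ τ (rep l)
    rep≢τ k l e = ℕₚ.<-asym (rep< l) (subst₂ _<_ (cong rank e) (cong rank (trans (cong τ e) (τ-invol _))) (rep< k))
    φ-inj : ∀ {x y} → φ x ≡ φ y → x ≡ y
    φ-inj {nothing} {nothing} _ = refl
    φ-inj {nothing} {just (k , false)} e = contradiction (sym e) (rep≢o k)
    φ-inj {nothing} {just (k , true)}  e = contradiction (trans (sym (τ-invol _)) (trans (cong τ (sym e)) fix)) (rep≢o k)
    φ-inj {just (k , false)} {nothing} e = contradiction e (rep≢o k)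
    φ-inj {just (k , true)}  {nothing} e = contradiction (trans (sym (τ-invol _)) (trans (cong τ e) fix)) (rep≢o k)
    φ-inj {just (k , false)} {just (l , false)} e = cong (λ z → just (z , false)) (elem-inj (↔-injective⁻ i e))
    φ-inj {just (k , true)}  {just (l , true)}  e = cong (λ z → just (z , true))
      (elem-inj (↔-injective⁻ i (trans (sym (τ-invol _)) (trans (cong τ e) (τ-invol _)))))
    φ-inj {just (k , false)} {just (l , true)}  e = contradiction e (rep≢τ k l)
    φ-inj {just (k , true)}  {just (l , false)} e = contradiction (sym e) (rep≢τ l k)
    find : ∀ v → rank v < rank (τ v) → ∃[ k ] rep k ≡ v
    find v p with index (to v) (subst (λ w → rank w < rank (τ w)) (sym (strictlyInverseʳ v)) p)
    ... | k , e = k , trans (cong from e) (strictlyInverseʳ v)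
    φ-sur : ∀ v → ∃[ u ] φ u ≡ v
    φ-sur v with ℕₚ.<-cmp (rank v) (rank (τ v))
    ... | tri< p _ _ = just (proj₁ (find v p) , false) , proj₂ (find v p)
    ... | tri≈ _ p _ = nothing , sym (only v (sym (↔-injective i (toℕ-injective p))))
    ... | tri> _ _ p = just (proj₁ k , true) , trans (cong τ (proj₂ k)) (τ-invol v)
      where
        k : ∃[ k ] rep k ≡ τ v
        k = find (τ v) (subst (rank (τ v) <_) (cong rank (sym (τ-invol v))) p)

parity : ∀ q → ∃[ r ] (q ≡ r + r ⊎ q ≡ suc (r + r))
parity zero = 0 , inj₁ refl
parity (suc q) with parity q
... | r , inj₁ e = r , inj₂ (cong suc e)
... | r , inj₂ e = suc r , inj₁ (trans (cong suc e) (cong suc (sym (ℕₚ.+-suc r r))))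

record Extension {g} (G : Squag (Fin g)) : Set₁ where
  field
    Colour Vertex : Set
    _≟ᵛ_          : DecidableEquality Vertex
    θ             : Fin g ↔ Colour
    oneFact       : OneFact Colour Vertex
    rigid         : Rigid (transport θ G) oneFact
    count         : Vertex ↔ Fin (suc g)

  open Doubling _≟ᵛ_ (transport θ G) oneFact public

module Extend (em : ExcludedMiddle 0ℓ) where

  private
    odd-pairs : ∀ {g} (G : Squag (Fin (suc g))) (P : Pairing (Squag._∙_ G zero) zero) r →
                Pairing.pairs P ≡ suc (r + r) → suc g ≡ suc (Pairing.pairs P * 2) → Extension G
    odd-pairs {g} G record { pairs = pairs ; iso = iso ; iso-fix = iso-fix ; iso-τ = iso-τ } r refl refl = record
      { Colour = TwistedPair.Colour r ; Vertex = TwistedPair.Vertex r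
      ; _≟ᵛ_ = Prodₚ.≡-dec (Maybeₚ.≡-dec _≟_) 𝔹._≟_
      ; θ = ↔-trans (↔-sym iso) ψ
      ; oneFact = TwistedPair.oneFact r
      ; rigid = TwistedPair.rigid r em (transport (↔-trans (↔-sym iso) ψ) G) link
      ; count = ×-Bool-↔ (Maybe-↔ ↔-refl) }
      where
        open OddCyclic r
        ψ-to ψ-from : Maybe (Fin pairs × Bool) → Maybe (Fin pairs × Bool)
        ψ-to nothing            = nothing
        ψ-to (just (k , false)) = just (k , false)
        -- This shift of one member of each pair produces the `link` required by `TwistedPair`.
        ψ-to (just (k , true))  = just (k ⊕ [ 1 ] , true)
        ψ-from nothing            = nothing
        ψ-from (just (k , false)) = just (k , false)
        ψ-from (just (k , true))  = just (k ⊝ [ 1 ] , true)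
        ψ : Maybe (Fin pairs × Bool) ↔ Maybe (Fin pairs × Bool)
        ψ = mk↔ₛ′ ψ-to ψ-from
          (λ { nothing → refl ; (just (k , false)) → refl
             ; (just (k , true)) → cong (λ z → just (z , true)) (solve (k ∷ [ 1 ] ∷ []) (v₀ :- v₁ :⊕ v₁) v₀ refl) })
          (λ { nothing → refl ; (just (k , false)) → refl
             ; (just (k , true)) → cong (λ z → just (z , true)) (solve (k ∷ [ 1 ] ∷ []) (v₀ :⊕ v₁ :- v₁) v₀ refl) })
        link : ∀ c → Squag._∙_ (transport (↔-trans (↔-sym iso) ψ) G) nothing (just (c , false)) ≡ just (c ⊕ [ 1 ] , true)
        link c = cong ψ-to (trans (cong (Inverse.from iso) (trans (cong (λ z → Squag._∙_ G z (Inverse.to iso (just (c , false)))) iso-fix)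
          (sym (iso-τ (just (c , false)))))) (Inverse.strictlyInverseʳ iso (just (c , true))))

    module Even {g} (G : Squag (Fin (suc g))) (P : Pairing (Squag._∙_ G zero) zero) (r₀ : ℕ) where
      -- A positive `r` makes `k` positive, so that the cross colour `one` exists.
      r = suc r₀
      k : ℕ
      k = r + r
      open OddCyclic r
      module Z = Ab ℤ/
      Col : Set
      Col = Fin (suc k) ⊎ Fin k

      -- The first argument is a default for the value zero, which `⊖ suc d` never takes.
      pick : Fin k → Fin (suc k) → Fin k
      pick d zero     = d
      pick d (suc d′) = d′

      neg : Fin k → Fin k
      neg d = pick d (⊖ suc d)

      suc-neg : ∀ d → suc (neg d) ≡ ⊖ suc d
      suc-neg d with ⊖ suc d in eq
      ... | suc d′ = refl
      ... | zero   = contradiction (trans (sym (Z.identʳ (suc d))) (trans (cong (suc d ⊕_) (sym eq)) (Z.inverseʳ (suc d)))) λ ()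

      ⊖⊖ : ∀ x → ⊖ ⊖ x ≡ x
      ⊖⊖ x = trans (solve ((⊖ ⊖ x) ∷ (⊖ x) ∷ x ∷ []) v₀ (v₂ :⊕ (v₀ :⊕ v₁) :- (v₂ :⊕ v₁)) refl)
        (trans (cong₂ (λ a b → x ⊕ a ⊝ b) (trans (Z.comm _ _) (Z.inverseʳ (⊖ x))) (Z.inverseʳ x)) (solve (x ∷ []) (v₀ :⊕ :0 :- :0) v₀ refl))

      τ : Col → Col
      τ (inj₁ c) = inj₁ (⊖ c)
      τ (inj₂ d) = inj₂ (neg d)

      self-neg : ∀ x → ⊖ x ≡ x → x ≡ zero
      self-neg x e = double-inj (trans (cong (x ⊕_) (sym e)) (trans (Z.inverseʳ x) (sym (Z.identʳ zero))))

      τ-invol : ∀ c → τ (τ c) ≡ c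
      τ-invol (inj₁ c) = cong inj₁ (⊖⊖ c)
      τ-invol (inj₂ d) = cong inj₂ (suc-injective (trans (suc-neg (neg d)) (trans (cong ⊖_ (suc-neg d)) (⊖⊖ (suc d)))))

      τ-only : ∀ c → τ c ≡ c → c ≡ inj₁ zero
      τ-only (inj₁ c) e = cong inj₁ (self-neg c (inj₁-injective e))
      τ-only (inj₂ d) e = contradiction (self-neg (suc d) (trans (sym (suc-neg d)) (cong suc (inj₂-injective e)))) λ ()

      Q : Pairing τ (inj₁ zero)
      Q = pairing (↔-sym (+↔⊎ {suc k} {k})) τ τ-invol (inj₁ zero) (cong inj₁ (trans (solve {1} (⊖ zero ∷ []) v₀ (:0 :⊕ v₀) refl) (Z.inverseʳ zero))) τ-only

      one : Fin k
      one = zero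

      one≡1 : suc one ≡ [ 1 ]
      one≡1 = toℕ-injective (sym (toℕ-[] 1))

      -- Negation fixes the pure colour 0, so at first the blocks through that colour consist of it
      -- and two opposite colours. The transposition hands this role to the cross colour 1, as
      -- `link` demands.
      π : Col → Col
      π (inj₁ zero)    = inj₂ one
      π (inj₁ (suc c)) = inj₁ (suc c)
      π (inj₂ zero)    = inj₁ zero
      π (inj₂ (suc d)) = inj₂ (suc d)

      π-invol : ∀ c → π (π c) ≡ c
      π-invol (inj₁ zero)    = refl
      π-invol (inj₁ (suc c)) = refl
      π-invol (inj₂ zero)    = refl
      π-invol (inj₂ (suc d)) = refl

      -- `Q` pairs the colours under negation, `P` the points of `G` under multiplication by `zero`.
      -- Having equally many pairs they can be matched, and the multiplication becomes `τ`.
      module _ (e : Pairing.pairs Q ≡ Pairing.pairs P) where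
        private
          module P = Pairing P
          module Q = Pairing Q
          cast : Maybe (Fin P.pairs × Bool) ↔ Col
          cast = subst (λ q → Maybe (Fin q × Bool) ↔ Col) e Q.iso
          cast-fix : Inverse.to cast nothing ≡ inj₁ zero
          cast-fix = lemma e Q.iso Q.iso-fix
            where
              lemma : ∀ {q q′} (e : q ≡ q′) (i : Maybe (Fin q × Bool) ↔ Col) → Inverse.to i nothing ≡ inj₁ zero →
                      Inverse.to (subst (λ q → Maybe (Fin q × Bool) ↔ Col) e i) nothing ≡ inj₁ zero
              lemma refl i p = p
          cast-τ : ∀ u → Inverse.to cast (flip u) ≡ τ (Inverse.to cast u)
          cast-τ = lemma e Q.iso Q.iso-τ
            where
              lemma : ∀ {q q′} (e : q ≡ q′) (i : Maybe (Fin q × Bool) ↔ Col) → (∀ u → Inverse.to i (flip u) ≡ τ (Inverse.to i u)) →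
                      ∀ u → Inverse.to (subst (λ q → Maybe (Fin q × Bool) ↔ Col) e i) (flip u)
                          ≡ τ (Inverse.to (subst (λ q → Maybe (Fin q × Bool) ↔ Col) e i) u)
              lemma refl i p = p

        label : Fin (suc g) ↔ Col
        label = ↔-trans (↔-sym P.iso) cast

        G₁ : Squag Col
        G₁ = transport label G
        module G₁ = Squag G₁

        G₁-link : ∀ c → inj₁ zero G₁.∙ c ≡ τ c
        G₁-link c = trans (cong (λ z → Inverse.to label (Squag._∙_ G z (Inverse.from label c))) zero′)
            (trans (cong (Inverse.to cast) (trans (cong (Inverse.from P.iso) (sym (P.iso-τ u))) (Inverse.strictlyInverseʳ P.iso (flip u))))
            (trans (cast-τ u) (cong τ (Inverse.strictlyInverseˡ cast c))))
          where
            u = Inverse.from cast c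
            zero′ : Inverse.from label (inj₁ zero) ≡ zero
            zero′ = trans (cong (Inverse.to P.iso) (trans (cong (Inverse.from cast) (sym cast-fix)) (Inverse.strictlyInverseʳ cast nothing))) P.iso-fix

        swap : Col ↔ Col
        swap = mk↔ₛ′ π π π-invol π-invol

        link : ∀ d d′ → suc d ⊕ suc d′ ≡ zero → d ≢ one → d′ ≢ one → Squag._∙_ (transport (↔-trans label swap) G) (inj₂ d) (inj₂ d′) ≡ inj₂ one
        link zero    d′       s n n′ = contradiction refl n
        link (suc d) zero     s n n′ = contradiction refl n′
        link (suc d) (suc d′) s n n′ = cong π (trans (cong (inj₂ (suc d) G₁.∙_) d′≡) (trans (cong (inj₂ (suc d) G₁.∙_) (G₁.comm _ _)) (G₁.invol _ _)))
          where
            d′≡ : inj₂ (suc d′) ≡ inj₁ zero G₁.∙ inj₂ (suc d)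
            d′≡ = trans (cong inj₂ (suc-injective (trans (trans (solve (suc (suc d) ∷ suc (suc d′) ∷ []) v₁ (v₀ :⊕ v₁ :- v₀) refl)
              (trans (cong (_⊝ suc (suc d)) s) (trans (Z.comm _ _) (Z.identʳ _)))) (sym (suc-neg (suc d)))))) (sym (G₁-link (inj₂ (suc d))))

    even-pairs : ∀ {g} (G : Squag (Fin (suc g))) (P : Pairing (Squag._∙_ G zero) zero) r₀ →
                 Pairing.pairs P ≡ suc r₀ + suc r₀ → suc g ≡ suc (Pairing.pairs P * 2) → Extension G
    even-pairs {g} G P r₀ e e′ = record
      { Colour = Col ; Vertex = PureCross.Vertex r
      ; _≟ᵛ_ = Prodₚ.≡-dec _≟_ 𝔹._≟_
      ; θ = ↔-trans (label pairs≡) (swap pairs≡)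
      ; oneFact = PureCross.oneFact r
      ; rigid = PureCross.rigid r em (transport (↔-trans (label pairs≡) (swap pairs≡)) G) one one≡1 (link pairs≡)
      ; count = subst (λ n → (Fin (suc k) × Bool) ↔ Fin (suc n)) (sym (trans e′ (cong (λ q → suc (q * 2)) e))) (×-Bool-↔ ↔-refl) }
      where
        open Even G P r₀
        double-k : k + k ≡ k * 2
        double-k = trans (cong (k +_) (sym (ℕₚ.+-identityʳ k))) (ℕₚ.*-comm 2 k)
        pairs≡ : Pairing.pairs Q ≡ Pairing.pairs P
        pairs≡ = trans (ℕₚ.*-cancelʳ-≡ (Pairing.pairs Q) k 2
          (ℕₚ.suc-injective (trans (sym (Pairing.size Q (↔-sym (+↔⊎ {suc k} {k})))) (cong suc double-k)))) (sym e)

  extend : ∀ {g} (G : Squag (Fin g)) → 3 < g → Extension G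
  extend {suc g} G 3<g = go (parity pairs)
    where
      module G = Squag G
      P : Pairing (G._∙_ zero) zero
      P = pairing ↔-refl (G._∙_ zero) (G.invol zero) zero (G.idem zero) only
        where
          only : ∀ v → zero G.∙ v ≡ v → v ≡ zero
          only v e with zero ≟ v
          ... | yes p = sym p
          ... | no n  = contradiction e (G.∙≢ʳ n)
      open Pairing P
      go : ∃[ r ] (pairs ≡ r + r ⊎ pairs ≡ suc (r + r)) → Extension G
      go (r , inj₂ e)      = odd-pairs G P r e (size ↔-refl)
      go (suc r , inj₁ e)  = even-pairs G P r e (size ↔-refl)
      go (zero , inj₁ e)   = contradiction (subst (3 <_) (trans (size ↔-refl) (cong (λ q → suc (q * 2)) e)) 3<g) λ { (s≤s ()) }

  module _ {g} {G : Squag (Fin g)} (X : Extension G) where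
    open Extension X

    -- Once a vertex `p` occurs, each block through `p` contains a colour. An order above 3 gives
    -- two such blocks, hence two colours, and rigidity gives all of `G`.
    extension-subsystems : ∀ {c} (P : Squag (Fin c)) → 3 < c → Emb P double → Emb P G ⊎ Emb G P
    extension-subsystems {c} P 3<c f with em {∃[ a ] ∃[ y ] fun f a ≡ inj₂ y}
    ... | no none = inj₁ (transport-from θ G ⊙ emb-factor f base pre)
      where
        pre : ∀ a → ∃[ w ] inj₁ w ≡ fun f a
        pre a with fun f a in eq
        ... | inj₁ w = w , refl
        ... | inj₂ y = contradiction (a , y , eq) none
    ... | yes (p , y , fp) with em {∃[ d ] ∃[ d′ ] ((∃[ a ] fun f a ≡ inj₁ d) × (∃[ a ] fun f a ≡ inj₁ d′) × d ≢ d′)}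
    ...   | yes (d , d′ , sd , sd′ , n) = inj₂ (emb-factor (base) f (full ∘ inj₁) ⊙ transport-to θ G)
      where
        full : ∀ v → ∃[ a ] fun f a ≡ v
        full = double-full rigid (λ v → ∃[ a ] fun f a ≡ v) (λ { (a , refl) (b , refl) → Squag._∙_ P a b , hom f a b }) (p , fp) sd sd′ n
    ...   | no unique = ⊥-elim (q∉ (same (colour-of (q′ ∘ sym)) (colour-of (λ e → q∉ (inj₁ e)))))
      where
        module P = Squag P
        a = proj₁ (off-line P 3<c p p)
        q′ : p ≢ a
        q′ e = proj₂ (off-line P 3<c p p) (inj₁ (sym e))
        q = proj₁ (off-line P 3<c p a)
        q∉ : ¬ P.Line p a q
        q∉ = proj₂ (off-line P 3<c p a)
        colour-of : ∀ {z} → z ≢ p → ∃[ w ] ((w ≡ z ⊎ w ≡ p P.∙ z) × ∃[ d ] fun f w ≡ inj₁ d)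
        colour-of {z} n with fun f z in eq
        ... | inj₁ d  = z , inj₁ refl , d , eq
        ... | inj₂ y′ = p P.∙ z , inj₂ refl , _ , trans (hom f p z) (trans (cong₂ (Squag._∙_ double) fp eq)
                (double-diff λ { refl → n (inj f (trans eq (sym fp))) }))
        same : ∃[ w ] ((w ≡ a ⊎ w ≡ p P.∙ a) × ∃[ d ] fun f w ≡ inj₁ d) → ∃[ w ] ((w ≡ q ⊎ w ≡ p P.∙ q) × ∃[ d ] fun f w ≡ inj₁ d) → P.Line p a q
        same (w , wa , d , fw) (w′ , wq , d′ , fw′) = line wa wq (inj f (trans fw (trans (cong inj₁ d≡d′) (sym fw′))))
          where
            d≡d′ : d ≡ d′
            d≡d′ with em {d ≡ d′}
            ... | yes e = e
            ... | no n  = contradiction (d , d′ , (w , fw) , (w′ , fw′) , n) unique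
            line : ∀ {w w′} → (w ≡ a ⊎ w ≡ p P.∙ a) → (w′ ≡ q ⊎ w′ ≡ p P.∙ q) → w ≡ w′ → P.Line p a q
            line (inj₁ refl) (inj₁ refl) e = inj₂ (inj₁ (sym e))
            line (inj₁ refl) (inj₂ refl) e = inj₂ (inj₂ (trans (sym (P.invol p q)) (cong (p P.∙_) (sym e))))
            line (inj₂ refl) (inj₁ refl) e = inj₂ (inj₂ (sym e))
            line (inj₂ refl) (inj₂ refl) e = inj₂ (inj₁ (P.cancelˡ p (sym e)))

-- Fibres: arranging the extension on a circle

module Translations (k : ℕ) where
  open Cyclic k
  private module Z = Ab ℤ/
  open AbSolver ℤ/ using (solve)

  private
    N : ℕ
    N = suc k

  ⊕≢ : ∀ {e} → e ≢ 𝟘 → ∀ l → l ⊕ e ≢ l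
  ⊕≢ {e} n l p = n (trans (solve (l ∷ e ∷ []) v₁ (v₀ :⊕ v₁ :- v₀) refl) (trans (cong (_⊝ l) p) (Z.inverseʳ l)))

  module _ (P : Fin N → Set) {e : Fin N} (e≢0 : e ≢ 𝟘) (step : ∀ l → P l → P (l ⊕ e)) where
    pair-period : ∀ {l₁ l₂} → P l₁ → P l₂ → (∀ l → P l → l ≡ l₁ ⊎ l ≡ l₂) → l₁ ⊕ e ≡ l₂ × e ⊕ e ≡ 𝟘
    pair-period {l₁} {l₂} p₁ p₂ all with all _ (step l₁ p₁) | all _ (step l₂ p₂)
    ... | inj₁ q | _      = contradiction q (⊕≢ e≢0 l₁)
    ... | inj₂ _ | inj₂ q = contradiction q (⊕≢ e≢0 l₂)
    ... | inj₂ q | inj₁ q′ = q , trans (solve (l₁ ∷ e ∷ []) (v₁ :⊕ v₁) (v₀ :⊕ v₁ :⊕ v₁ :- v₀) refl)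
            (trans (cong (_⊝ l₁) (trans (cong (_⊕ e) q) q′)) (Z.inverseʳ l₁))

    private
      three-cycle : ∀ {l₁ l₂ l₃} → l₁ ≢ l₃ → l₂ ≢ l₃ → l₁ ⊕ e ≡ l₂ →
                    l₂ ⊕ e ≡ l₁ ⊎ l₂ ⊕ e ≡ l₂ ⊎ l₂ ⊕ e ≡ l₃ → l₃ ⊕ e ≡ l₁ ⊎ l₃ ⊕ e ≡ l₂ ⊎ l₃ ⊕ e ≡ l₃ → 3 · e ≡ 𝟘
      three-cycle {l₂ = l₂} b c q (inj₂ (inj₁ q′)) _ = contradiction q′ (⊕≢ e≢0 l₂)
      three-cycle {l₃ = l₃} b c q _ (inj₂ (inj₂ q″)) = contradiction q″ (⊕≢ e≢0 l₃)
      three-cycle b c q _ (inj₂ (inj₁ q″)) = contradiction (Z.cancelʳ e (trans q (sym q″))) b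
      three-cycle b c q (inj₁ q′) (inj₁ q″) = contradiction (Z.cancelʳ e (trans q′ (sym q″))) c
      three-cycle {l₁} b c q (inj₂ (inj₂ q′)) (inj₁ q″) =
        trans (solve (l₁ ∷ e ∷ []) (v₁ :⊕ (v₁ :⊕ (v₁ :⊕ :0))) (v₀ :⊕ v₁ :⊕ v₁ :⊕ v₁ :- v₀) refl)
          (trans (cong (_⊝ l₁) (trans (cong (_⊕ e) (trans (cong (_⊕ e) q) q′)) q″)) (Z.inverseʳ l₁))

    -- A nonzero translation permutes the three points without fixed points, hence cyclically.
    triple-period : ∀ {l₁ l₂ l₃} → l₁ ≢ l₂ → l₁ ≢ l₃ → l₂ ≢ l₃ → P l₁ → P l₂ → P l₃ →
                    (∀ l → P l → l ≡ l₁ ⊎ l ≡ l₂ ⊎ l ≡ l₃) → 3 · e ≡ 𝟘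
    triple-period {l₁} {l₂} {l₃} a b c p₁ p₂ p₃ all with all _ (step l₁ p₁)
    ... | inj₁ q        = contradiction q (⊕≢ e≢0 l₁)
    ... | inj₂ (inj₁ q) = three-cycle b c q (all _ (step l₂ p₂)) (all _ (step l₃ p₃))
    ... | inj₂ (inj₂ q) = three-cycle a (c ∘ sym) q (perm (all _ (step l₃ p₃))) (perm (all _ (step l₂ p₂)))
      where
        perm : ∀ {A B C : Set} → A ⊎ B ⊎ C → A ⊎ C ⊎ B
        perm (inj₁ x)        = inj₁ x
        perm (inj₂ (inj₁ x)) = inj₂ (inj₂ x)
        perm (inj₂ (inj₂ x)) = inj₂ (inj₁ x)

    -- A step of at most g never wraps from the lower half, so it climbs out of it. A larger step
    -- has to wrap in order to stay in the lower half, and then it descends forever.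
    half-circle : ∀ {g} → N ≡ g + g → (∀ l → P l → toℕ l < g) → ∀ {i} → P i → ⊥
    half-circle {g} N≡ small {i} pi with toℕ e ℕₚ.≤? g
    ... | yes e≤g = ℕₚ.<-irrefl refl (ℕₚ.≤-<-trans (proj₂ (proj₂ (climb g))) (small _ (proj₁ (proj₂ (climb g)))))
      where
        e>0 : 0 < toℕ e
        e>0 = ℕₚ.n≢0⇒n>0 λ z → e≢0 (toℕ-injective z)
        climb : ∀ t → ∃[ l ] (P l × t ≤ toℕ l)
        climb zero = i , pi , z≤n
        climb (suc t) with climb t
        ... | l , pl , t≤l = l ⊕ e , step l pl , bound (toℕ-⊕ l e)
          where
            bound : toℕ (l ⊕ e) ≡ toℕ l + toℕ e ⊎ toℕ (l ⊕ e) + N ≡ toℕ l + toℕ e → suc t ≤ toℕ (l ⊕ e)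
            bound (inj₁ p) = subst (suc t ≤_) (sym p) (ℕₚ.≤-trans (ℕₚ.≤-reflexive (ℕₚ.+-comm 1 t)) (ℕₚ.+-mono-≤ t≤l e>0))
            bound (inj₂ p) = contradiction (ℕₚ.≤-trans (ℕₚ.m≤n+m N (toℕ (l ⊕ e))) (ℕₚ.≤-reflexive p))
              (ℕₚ.<⇒≱ (subst (toℕ l + toℕ e <_) (sym N≡) (ℕₚ.+-mono-<-≤ (small l pl) e≤g)))
    ... | no e≰g = sink (toℕ i) i ℕₚ.≤-refl pi
      where
        drop : ∀ l → P l → toℕ (l ⊕ e) < toℕ l
        drop l pl with toℕ-⊕ l e
        ... | inj₁ p = contradiction (ℕₚ.≤-<-trans (ℕₚ.≤-trans (ℕₚ.m≤n+m (toℕ e) (toℕ l)) (ℕₚ.≤-reflexive (sym p))) (small _ (step l pl)))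
                         (ℕₚ.≤⇒≯ (ℕₚ.<⇒≤ (ℕₚ.≰⇒> e≰g)))
        ... | inj₂ p = ℕₚ.+-cancelʳ-< N (toℕ (l ⊕ e)) (toℕ l) (subst (_< toℕ l + N) (sym p) (ℕₚ.+-monoʳ-< (toℕ l) (toℕ<n e)))
        sink : ∀ n l → toℕ l ≤ n → P l → ⊥
        sink zero    l l≤ pl = ℕₚ.n≮0 (ℕₚ.<-≤-trans (drop l pl) l≤)
        sink (suc n) l l≤ pl = sink n (l ⊕ e) (ℕₚ.≤-pred (ℕₚ.<-≤-trans (drop l pl) l≤)) (step l pl)

  -- Three times the representative of `e` would be q · 2g with q < 3. Here q = 0 gives e = 0, while
  -- q = 1 and q = 2 make 3 divide g.
  no-period-3 : ∀ {g} → N ≡ g + g → ¬ 3 ∣ g → ∀ {e} → e ≢ 𝟘 → 3 · e ≢ 𝟘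
  no-period-3 {g} N≡ 3∤g {e} e≢0 p with m%n≡0⇒n∣m (3 * toℕ e) N (trans (sym (toℕ-[] (3 * toℕ e))) (cong toℕ (trans (sym (·-[] 3 e)) p)))
  ... | divides q eq = go q (trans (ℕₚ.*-comm (toℕ e) 3) (trans eq (cong (q *_) N≡)))
    where
      open Data.Nat.Solver.+-*-Solver using (_:*_; con) renaming (solve to ℕ-solve; _:+_ to _:✛_; _:=_ to _:≡_)
      go : ∀ q → toℕ e * 3 ≡ q * (g + g) → ⊥
      go 0 eq = e≢0 (toℕ-injective (ℕₚ.*-cancelʳ-≡ (toℕ e) 0 3 eq))
      go 1 eq = 3∤g (∣m+n∣m⇒∣n {3} {g + g} {g} (divides g (ℕ-solve 1 (λ g → g :✛ g :✛ g :≡ g :* con 3) refl g))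
                  (divides (toℕ e) (sym (trans eq (ℕₚ.+-identityʳ (g + g))))))
      go 2 eq = 3∤g (∣m+n∣m⇒∣n {3} {g + g + g} {g} (divides (toℕ e) (sym (trans eq (ℕ-solve 1 (λ g → con 2 :* (g :✛ g) :≡ g :✛ g :✛ g :✛ g) refl g))))
                  (divides g (ℕ-solve 1 (λ g → g :✛ g :✛ g :≡ g :* con 3) refl g)))
      go (suc (suc (suc q))) eq = ℕₚ.<⇒≱ (ℕₚ.*-monoˡ-< 3 (subst (toℕ e <_) N≡ (toℕ<n e)))
        (subst (_≤ toℕ e * 3) (ℕₚ.*-comm 3 (g + g)) (subst (3 * (g + g) ≤_) (sym eq) (ℕₚ.*-monoˡ-≤ (g + g) (s≤s (s≤s (s≤s (z≤n {q})))))))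

-- What the covers have to know about a fibre. The equation `k≡` makes the number of finite points
-- even, for the parity argument.
record FibreSystem {g} (G : Squag (Fin g)) : Set₁ where
  field
    k h        : ℕ
    k≡         : k ≡ suc (h + h)
    H          : Squag (Fibre.Fib k)
    spread     : Fibre.Spread k H
    subsystems : ∀ {c} (P : Squag (Fin c)) → 3 < c → Emb P H → Emb P G ⊎ Emb G P
    inside     : Emb G H

module MakeFibre (em : ExcludedMiddle 0ℓ) {g′} (G : Squag (Fin (suc g′))) (3<g : 3 < suc g′) (3∤g : ¬ 3 ∣ suc g′)
                 (X : Extension G) where
  open Extension X
  open OneFact oneFact
  private
    g k : ℕ
    g = suc g′
    -- Chosen so that `suc k` is `g + g` by computation.
    k = g′ + suc g′
    module C = Cyclic g′
    module 𝕔 = Ab C.ℤ/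
    module D = Squag double
    open Inverse θ using (to; from; strictlyInverseˡ; strictlyInverseʳ)
    open AbSolver C.ℤ/ using (solve)

    ∞ : Vertex
    ∞ = Inverse.from count zero

    up down : Fin g → Fin g
    up a = a C.⊕ C.[ 1 ]
    down a = a C.⊝ C.[ 1 ]

    down-up : ∀ a → down (up a) ≡ a
    down-up a = solve (a ∷ C.[ 1 ] ∷ []) (v₀ :⊕ v₁ :- v₁) v₀ refl

    up-down : ∀ a → up (down a) ≡ a
    up-down a = solve (a ∷ C.[ 1 ] ∷ []) (v₀ :- v₁ :⊕ v₁) v₀ refl

    -- G occupies the first half of the circle; the partner μ c ∞ of the colour at position a is at position
    -- g + a + 1, which is not the antipode of a.
    place : Fin g ⊎ Fin g → Colour ⊎ Vertex
    place (inj₁ a) = inj₁ (to a)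
    place (inj₂ b) = inj₂ (μ (to (down b)) ∞)

    φ : Maybe (Fin (g + g)) → Colour ⊎ Vertex
    φ nothing  = inj₂ ∞
    φ (just i) = place (splitAt g i)

    φ-left : ∀ a → φ (just (a ↑ˡ g)) ≡ inj₁ (to a)
    φ-left a = cong place (splitAt-↑ˡ g a g)

    φ-right : ∀ b → φ (just (g ↑ʳ b)) ≡ inj₂ (μ (to (down b)) ∞)
    φ-right b = cong place (splitAt-↑ʳ g g b)

    place-inj : ∀ u v → place u ≡ place v → u ≡ v
    place-inj (inj₁ a) (inj₁ a′) e = cong inj₁ (↔-injective θ (inj₁-injective e))
    place-inj (inj₂ b) (inj₂ b′) e = cong inj₂ (trans (sym (up-down b)) (trans (cong up (↔-injective θ (μ-inj ∞ (inj₂-injective e)))) (up-down b′)))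

    φ-inj : ∀ {u v} → φ u ≡ φ v → u ≡ v
    φ-inj {nothing} {nothing} _ = refl
    φ-inj {just i} {just j} e = cong just (↔-injective (+↔⊎ {g} {g}) (place-inj _ _ e))
    φ-inj {nothing} {just j} e with splitAt g j
    ... | inj₂ b = contradiction (sym (inj₂-injective e)) (μ-fpf _ ∞)
    φ-inj {just i} {nothing} e with splitAt g i
    ... | inj₂ b = contradiction (inj₂-injective e) (μ-fpf _ ∞)

    pos : Colour → Fin (g + g)
    pos c = from c ↑ˡ g

    partner : Colour → Fin (g + g)
    partner c = g ↑ʳ up (from c)

    φ-pos : ∀ c → φ (just (pos c)) ≡ inj₁ c
    φ-pos c = trans (φ-left (from c)) (cong inj₁ (strictlyInverseˡ c))

    φ-partner : ∀ c → φ (just (partner c)) ≡ inj₂ (μ c ∞)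
    φ-partner c = trans (φ-right (up (from c))) (cong (λ d → inj₂ (μ d ∞)) (trans (cong to (down-up (from c))) (strictlyInverseˡ c)))

    φ-sur : ∀ w → ∃[ v ] φ v ≡ w
    φ-sur (inj₁ c) = just (pos c) , φ-pos c
    φ-sur (inj₂ y) with ∞ ≟ᵛ y
    ... | yes refl = nothing , refl
    ... | no n = just (partner (χ ∞ y)) , trans (φ-partner (χ ∞ y)) (cong inj₂ (χ-spec n))

    β : Maybe (Fin (g + g)) ↔ (Colour ⊎ Vertex)
    β = bijection φ φ-inj φ-sur

  H : Squag (Maybe (Fin (g + g)))
  H = transport (↔-sym β) double

  private
    one≢zero : C.[ 1 ] ≢ zero
    one≢zero e = contradiction (trans (sym (C.toℕ-[] 1)) (cong toℕ e)) (nz 3<g)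
      where
        nz : ∀ {n} → 3 < suc n → Data.Nat._%_ 1 (suc n) ≢ 0
        nz {zero} (s≤s ())
        nz {suc (suc (suc _))} _ ()

    left⇒small : ∀ {i c} → φ (just i) ≡ inj₁ c → toℕ i < g
    left⇒small {i} e with splitAt g i in eq
    ... | inj₁ a = subst (_< g) (trans (sym (toℕ-↑ˡ a g)) (cong toℕ (splitAt⁻¹-↑ˡ eq))) (toℕ<n a)

    open Fibre k
    module T = Translations k
    open Cyclic k using (_⊕_; 𝟘; ℤ/; toℕ-⊕; _·_)

    module _ (S : Fib → Set) (closed : Squag.Closed H S) {i e : Fin (g + g)} (e≢0 : e ≢ 𝟘) (si : S (just i))
             (step : ∀ l → S (just l) → S (just (l ⊕ e))) where
      S′ : Colour ⊎ Vertex → Set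
      S′ v = ∃[ u ] (φ u ≡ v × S u)

      S′-closed : D.Closed S′
      S′-closed (u , refl , su) (v , refl , sv) = _ , hom (transport-from (↔-sym β) double) u v , closed su sv

      back : ∀ {u} → S′ (φ u) → S u
      back (u , e , su) = subst S (φ-inj e) su

      μ-S : ∀ {c y} → S′ (inj₁ c) → S′ (inj₂ y) → S′ (inj₂ (μ c y))
      μ-S = S′-closed

      -- With a vertex and at most one colour the subsystem is a single block {c, y, μ c y}. It has
      -- two points on the circle if ∞ is one of its vertices, and three otherwise.
      module Small (uniq : ∀ {c c′} → S′ (inj₁ c) → S′ (inj₁ c′) → c ≡ c′) where
        χ-S : ∀ {y y′} → y ≢ y′ → S′ (inj₂ y) → S′ (inj₂ y′) → S′ (inj₁ (χ y y′))
        χ-S n s s′ = subst S′ (double-diff n) (S′-closed s s′)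

        a-colour : ∃[ c ] S′ (inj₁ c)
        a-colour = go (φ (just i)) (φ (just (i ⊕ e))) refl refl
          where
            go : ∀ u v → φ (just i) ≡ u → φ (just (i ⊕ e)) ≡ v → ∃[ c ] S′ (inj₁ c)
            go (inj₁ c) _        p q = c , just i , p , si
            go (inj₂ y) (inj₁ c) p q = c , just (i ⊕ e) , q , step i si
            go (inj₂ y) (inj₂ y′) p q = _ , χ-S (λ { refl → T.⊕≢ e≢0 i (just-injective (φ-inj (trans q (sym p)))) }) (_ , p , si) (_ , q , step i si)

        c = proj₁ a-colour
        sc = proj₂ a-colour

        vertices : ∀ {y z} → S′ (inj₂ y) → S′ (inj₂ z) → z ≡ y ⊎ z ≡ μ c y
        vertices {y} {z} sy sz with y ≟ᵛ z
        ... | yes p = inj₁ (sym p)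
        ... | no n  = inj₂ (trans (sym (χ-spec n)) (cong (λ d → μ d y) (uniq (χ-S n sy sz) sc)))

        -- Two points forming a translation-invariant set are antipodal. The antipode of position a
        -- is g + a, whereas the partner sits at g + `up` a, and `up` has no fixed point.
        with-∞ : S′ (inj₂ ∞) → ⊥
        with-∞ s∞ = one≢zero (C-cancel (from c) (toℕ-injective up≡))
          where
            C-cancel : ∀ a → up a ≡ a → C.[ 1 ] ≡ zero
            C-cancel a p = trans (solve (a ∷ C.[ 1 ] ∷ []) v₁ (v₀ :⊕ v₁ :- v₀) refl) (trans (cong (C._⊝ a) p) (𝕔.inverseʳ a))
            two : ∀ l → S (just l) → l ≡ pos c ⊎ l ≡ partner c
            two l sl = go (φ (just l)) refl
              where
                go : ∀ v → φ (just l) ≡ v → l ≡ pos c ⊎ l ≡ partner c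
                go (inj₁ d) p = inj₁ (just-injective (φ-inj (trans p (trans (cong inj₁ (uniq (_ , p , sl) sc)) (sym (φ-pos c))))))
                go (inj₂ z) p with vertices s∞ (_ , p , sl)
                ... | inj₁ refl = contradiction (φ-inj {just l} {nothing} p) λ ()
                ... | inj₂ refl = inj₂ (just-injective (φ-inj (trans p (sym (φ-partner c)))))
            period : pos c ⊕ e ≡ partner c × e ⊕ e ≡ 𝟘
            period = T.pair-period (S ∘ just) e≢0 step (back (subst S′ (sym (φ-pos c)) sc))
                       (back (subst S′ (sym (φ-partner c)) (μ-S sc s∞))) two
            e≡g : toℕ e ≡ g
            e≡g with toℕ-⊕ e e
            ... | inj₁ p = contradiction (toℕ-injective (ℕₚ.m+n≡0⇒m≡0 (toℕ e) (trans (sym p) (cong toℕ (proj₂ period))))) e≢0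
            ... | inj₂ p = half-inj _ _ (trans (sym p) (cong (λ z → toℕ z + (g + g)) (proj₂ period)))
              where
                half-inj : ∀ a b → a + a ≡ b + b → a ≡ b
                half-inj a b q = ℕₚ.*-cancelˡ-≡ a b 2 (trans (cong (a +_) (ℕₚ.+-identityʳ a)) (trans q (sym (cong (b +_) (ℕₚ.+-identityʳ b)))))
            up≡ : toℕ (up (from c)) ≡ toℕ (from c)
            up≡ with toℕ-⊕ (pos c) e
            ... | inj₁ p = ℕₚ.+-cancelˡ-≡ g _ _ (trans (sym (toℕ-↑ʳ g (up (from c)))) (trans (sym (cong toℕ (proj₁ period)))
                    (trans p (trans (cong₂ _+_ (toℕ-↑ˡ (from c) g) e≡g) (ℕₚ.+-comm (toℕ (from c)) g)))))
            ... | inj₂ p = contradiction (ℕₚ.≤-trans (ℕₚ.m≤n+m (g + g) (toℕ (pos c ⊕ e))) (ℕₚ.≤-reflexive p))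
                    (ℕₚ.<⇒≱ (ℕₚ.+-mono-<-≤ (subst (_< g) (sym (toℕ-↑ˡ (from c) g)) (toℕ<n (from c))) (ℕₚ.≤-reflexive e≡g)))

        without-∞ : ∀ {y} → ¬ S′ (inj₂ ∞) → S′ (inj₂ y) → ⊥
        without-∞ {y} ∉ sy = T.no-period-3 {g} refl 3∤g e≢0
            (T.triple-period (S ∘ just) e≢0 step n₁₂ n₁₃ n₂₃ (back (subst S′ (sym e₁) sc)) (back (subst S′ (sym e₂) sy)) (back (subst S′ (sym e₃) (μ-S sc sy))) three)
          where
            position : ∀ z → S′ (inj₂ z) → ∃[ l ] φ (just l) ≡ inj₂ z
            position z (nothing , p , s) = contradiction (nothing , refl , s) ∉
            position z (just l , p , s) = l , p
            l₁ = pos c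
            l₂ = proj₁ (position y sy)
            l₃ = proj₁ (position (μ c y) (μ-S sc sy))
            e₁ : φ (just l₁) ≡ inj₁ c
            e₁ = φ-pos c
            e₂ : φ (just l₂) ≡ inj₂ y
            e₂ = proj₂ (position y sy)
            e₃ : φ (just l₃) ≡ inj₂ (μ c y)
            e₃ = proj₂ (position (μ c y) (μ-S sc sy))
            n₁₂ : l₁ ≢ l₂
            n₁₂ p = contradiction (trans (sym e₁) (trans (cong (φ ∘ just) p) e₂)) λ ()
            n₁₃ : l₁ ≢ l₃
            n₁₃ p = contradiction (trans (sym e₁) (trans (cong (φ ∘ just) p) e₃)) λ ()
            n₂₃ : l₂ ≢ l₃
            n₂₃ p = μ-fpf c y (sym (inj₂-injective (trans (sym e₂) (trans (cong (φ ∘ just) p) e₃))))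
            three : ∀ l → S (just l) → l ≡ l₁ ⊎ l ≡ l₂ ⊎ l ≡ l₃
            three l sl = go (φ (just l)) refl
              where
                go : ∀ v → φ (just l) ≡ v → l ≡ l₁ ⊎ l ≡ l₂ ⊎ l ≡ l₃
                go (inj₁ d) p = inj₁ (just-injective (φ-inj (trans p (trans (cong inj₁ (uniq (_ , p , sl) sc)) (sym e₁)))))
                go (inj₂ z) p with vertices sy (_ , p , sl)
                ... | inj₁ refl = inj₂ (inj₁ (just-injective (φ-inj (trans p (sym e₂)))))
                ... | inj₂ refl = inj₂ (inj₂ (just-injective (φ-inj (trans p (sym e₃)))))

      at-most-one : ¬ (∃[ c ] ∃[ c′ ] (S′ (inj₁ c) × S′ (inj₁ c′) × c ≢ c′)) → ∀ {c c′} → S′ (inj₁ c) → S′ (inj₁ c′) → c ≡ c′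
      at-most-one none {c} {c′} s s′ with em {c ≡ c′}
      ... | yes p = p
      ... | no n  = contradiction (c , c′ , s , s′ , n) none

      conclude : ∀ v → S v
      conclude with em {∃[ y ] S′ (inj₂ y)}
      -- Without vertices all points of the subsystem on the circle lie in the half occupied by `G`.
      ... | no none = ⊥-elim (T.half-circle (S ∘ just) e≢0 step {g} refl small si)
        where
          small : ∀ l → S (just l) → toℕ l < g
          small l sl = go (φ (just l)) refl
            where
              go : ∀ v → φ (just l) ≡ v → toℕ l < g
              go (inj₁ _) p = left⇒small p
              go (inj₂ y) p = contradiction (y , just l , p , sl) none
      ... | yes (y , sy) with em {∃[ c ] ∃[ c′ ] (S′ (inj₁ c) × S′ (inj₁ c′) × c ≢ c′)}
      ...   | yes (c , c′ , sc , sc′ , n) = λ v → back (double-full rigid S′ S′-closed sy sc sc′ n (φ v))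
      ...   | no none with em {S′ (inj₂ ∞)}
      ...     | yes s∞ = ⊥-elim (Small.with-∞ (at-most-one none) s∞)
      ...     | no ∉ = ⊥-elim (Small.without-∞ (at-most-one none) ∉ sy)

  fibreSystem : FibreSystem G
  fibreSystem = record
    { k = k ; h = g′ ; k≡ = ℕₚ.+-suc g′ g′ ; H = H
    ; spread = λ S closed i e e≢0 si step → conclude S closed e≢0 si step
    ; subsystems = λ P 3<c f → Extend.extension-subsystems em X P 3<c (transport-from (↔-sym β) double ⊙ f)
    ; inside = transport-to (↔-sym β) double ⊙ (base ⊙ transport-to θ G) }

module _ (em : ExcludedMiddle 0ℓ) where
  open Extend em

  -- If 3 divides the order g of G, then G is first replaced by its extension of order 2g + 1.
  fibreSystem : ∀ {g} (G : Squag (Fin g)) → 3 < g → FibreSystem G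
  fibreSystem {suc g′} G 3<g with 3 ∣? suc g′
  ... | no 3∤g = MakeFibre.fibreSystem em G 3<g 3∤g (extend G 3<g)
  ... | yes 3∣g = record
      { k = k ; h = h ; k≡ = k≡ ; H = H ; spread = spread
      -- A subsystem inside the enlarged system is itself subject to the dichotomy for the extension
      -- of `G`; one containing it contains `G`.
      ; subsystems = λ P 3<c f → [ (λ e → extension-subsystems X P 3<c (transport-from i double ⊙ e))
                                 , (λ e → inj₂ (e ⊙ G⊂G₁)) ]′ (subsystems P 3<c f)
      ; inside = inside ⊙ G⊂G₁ }
    where
      g = suc g′
      X = extend G 3<g
      open Extension X
      i : (Colour ⊎ Vertex) ↔ Fin (g + suc g)
      i = ↔-trans (↔-sym θ ⊎-↔ count) (↔-sym (+↔⊎ {g} {suc g}))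
      G₁ : Squag (Fin (g + suc g))
      G₁ = transport i double
      G⊂G₁ : Emb G G₁
      G⊂G₁ = transport-to i double ⊙ (base ⊙ transport-to θ G)
      3<g₁ : 3 < g + suc g
      3<g₁ = ℕₚ.<-≤-trans 3<g (ℕₚ.m≤m+n g (suc g))
      3∤g₁ : ¬ 3 ∣ (g + suc g)
      3∤g₁ d = contradiction (∣⇒≤ (∣m+n∣m⇒∣n (subst (3 ∣_) (ℕₚ.+-comm 1 g) (∣m+n∣m⇒∣n d 3∣g)) 3∣g)) λ { (s≤s ()) }
      open FibreSystem (MakeFibre.fibreSystem em G₁ 3<g₁ 3∤g₁ (extend G₁ 3<g₁))

-- Iterated covers, one for each mark

module Completions (em : ExcludedMiddle 0ℓ) {g} (G : Squag (Fin g)) (FS : FibreSystem G) where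
  open FibreSystem FS
  open Cyclic k using (𝟘)

  -- A finite system over Q that destroys the sections with exactly one block in one of the given sets of marks
  record Completion {V : Set} (Q : Squag V) {n} (marks : Fin n → Mark Q) : Set where
    field
      points  : ℕ
      system  : Squag (Fin points)
      ι       : V → Fin points
      ι-inj   : ∀ {x y} → ι x ≡ ι y → x ≡ y
      ι-hom   : ∀ {x y} → x ≢ y → (∀ i → marked (marks i) x y ≡ false) →
                ι (Squag._∙_ Q x y) ≡ Squag._∙_ system (ι x) (ι y)
      control : ∀ {c} (P : Squag (Fin c)) → 3 < c → Emb P system →
                Emb P G ⊎ Emb G P ⊎ Σ (Emb P Q) λ e → ∀ i → ¬ ExactlyOne (marks i) e

  -- The cover for the first mark is completed with respect to the lifts of the others. A section
  -- and its projection see the same lifted marks, so the exclusions accumulate on one embedding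
  -- into `Q`.
  complete : ∀ {V : Set} {N n} → DecidableEquality V → V ↔ Fin N → (Q : Squag V) (marks : Fin n → Mark Q) → Completion Q marks
  complete {n = zero} _ i Q marks = record
    { points = _ ; system = transport i Q ; ι = Inverse.to i ; ι-inj = ↔-injective i
    ; ι-hom = λ {x} {y} _ _ → hom (transport-to i Q) x y
    ; control = λ P _ f → inj₂ (inj₂ (transport-from i Q ⊙ f , λ ())) }
  complete {V} {n = suc n} _≟ⱽ_ i Q marks = record
    { points = points ; system = system
    ; ι = λ x → ι (just (x , 𝟘))
    ; ι-inj = λ e → cong proj₁ (just-injective (ι-inj e))
    ; ι-hom = λ n u → trans (cong ι (section-hom n (u zero)))
        (ι-hom (n ∘ cong proj₁ ∘ just-injective) (λ j → trans (liftMark-diff (marks (suc j)) {i = 𝟘} {j = 𝟘} n) (u (suc j))))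
    ; control = λ P 3<c f → [ inj₁ , [ inj₂ ∘ inj₁ , (λ { (e₁ , ¬one) → descend P 3<c e₁ ¬one }) ]′ ]′ (control P 3<c f) }
    where
      open Cover k H _≟ⱽ_ Q (marks zero)
      open Completion (complete (Maybeₚ.≡-dec (Prodₚ.≡-dec _≟ⱽ_ _≟_)) (Maybe-↔ (↔-trans (i ×-↔ ↔-refl) (↔-sym *↔×)))
        cover (λ i → liftMark (marks (suc i))))
      descend : ∀ {c} (P : Squag (Fin c)) → 3 < c → (e₁ : Emb P cover) → (∀ i → ¬ ExactlyOne (liftMark (marks (suc i))) e₁) →
                Emb P G ⊎ Emb G P ⊎ Σ (Emb P Q) λ e → ∀ i → ¬ ExactlyOne (marks i) e
      descend {c} P 3<c e₁ ¬one with Classify.classify em spread P e₁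
      ... | inj₁ full = inj₂ (inj₁ (full ⊙ inside))
      ... | inj₂ (inj₁ flat) = [ inj₁ , inj₂ ∘ inj₁ ]′ (subsystems P 3<c flat)
      ... | inj₂ (inj₂ (e , over)) = inj₂ (inj₂ (e , λ
            { zero one → Classify.section-unmarked em spread P e₁ h k≡ 3<c (e , over) one
            ; (suc j) (a , b , n , mab , only) → ¬one j (a , b , n , trans (same j n) mab ,
                λ a′ b′ n′ m′ → only a′ b′ n′ (trans (sym (same j n′)) m′)) }))
        where
          same : ∀ j {a b} → a ≢ b → marked (liftMark (marks (suc j))) (fun e₁ a) (fun e₁ b) ≡ marked (marks (suc j)) (fun e a) (fun e b)
          same j {a} {b} n = trans (cong₂ (marked (liftMark (marks (suc j)))) (proj₂ (over a)) (proj₂ (over b)))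
            (liftMark-diff (marks (suc j)) {i = proj₁ (over a)} {j = proj₁ (over b)} (n ∘ inj e))

-- Projective space over 𝔽₂ and trades

vec-ext : ∀ {u} {x y : Vec Bool u} → (∀ i → lookup x i ≡ lookup y i) → x ≡ y
vec-ext {x = []}    {[]}    h = refl
vec-ext {x = a ∷ x} {b ∷ y} h = cong₂ _∷_ (h zero) (vec-ext (h ∘ suc))

vec-↔ : ∀ u → ∃[ n ] (Vec Bool u ↔ Fin n)
vec-↔ zero    = 1 , mk↔ₛ′ (λ _ → zero) (λ _ → []) (λ { zero → refl }) (λ { [] → refl })
vec-↔ (suc u) with vec-↔ u
... | n , i = n * 2 , ↔-trans (mk↔ₛ′ uncons (λ p → proj₂ p ∷ proj₁ p) (λ _ → refl) (λ { (a ∷ x) → refl })) (×-Bool-↔ i)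
  where
    uncons : Vec Bool (suc u) → Vec Bool u × Bool
    uncons (a ∷ x) = x , a

vec-differ : ∀ {u} {x y : Vec Bool u} → x ≢ y → ∃[ i ] lookup x i ≢ lookup y i
vec-differ {x = []}    {[]}    n = contradiction refl n
vec-differ {x = a ∷ x} {b ∷ y} n with a 𝔹.≟ b
... | no a≢b   = zero , a≢b
... | yes refl with vec-differ {x = x} {y} (n ∘ cong (a ∷_))
...   | i , e = suc i , e

infixl 6 _⊻_
_⊻_ : ∀ {u} → Vec Bool u → Vec Bool u → Vec Bool u
_⊻_ = zipWith _xor_

𝟎 : ∀ {u} → Vec Bool u
𝟎 = replicate _ false

lookup-⊻ : ∀ {u} (x y : Vec Bool u) i → lookup (x ⊻ y) i ≡ lookup x i xor lookup y i
lookup-⊻ x y i = Vecₚ.lookup-zipWith _xor_ i x y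

infix 4 _⊆_
_⊆_ : ∀ {u} → Vec Bool u → Vec Bool u → Set
x ⊆ y = ∀ i → lookup x i ≡ true → lookup y i ≡ true

⊻-⊆ : ∀ {u} (x y z : Vec Bool u) → x ⊆ z → y ⊆ z → x ⊻ y ⊆ z
⊻-⊆ x y z p q i e with lookup x i in eq
... | true  = p i eq
... | false = q i (trans (sym (trans (lookup-⊻ x y i) (cong (_xor lookup y i) eq))) e)

⊻-comm : ∀ {u} (x y : Vec Bool u) → x ⊻ y ≡ y ⊻ x
⊻-comm = Vecₚ.zipWith-comm 𝔹.xor-comm

⊻-assoc : ∀ {u} (x y z : Vec Bool u) → (x ⊻ y) ⊻ z ≡ x ⊻ (y ⊻ z)
⊻-assoc = Vecₚ.zipWith-assoc 𝔹.xor-assoc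

⊻-cancel : ∀ {u} (x y : Vec Bool u) → x ⊻ (x ⊻ y) ≡ y
⊻-cancel x y = vec-ext λ i → trans (lookup-⊻ x (x ⊻ y) i) (trans (cong (lookup x i xor_) (lookup-⊻ x y i))
  (xor-solve 2 (λ a b → a :+ (a :+ b) := b) refl (lookup x i) (lookup y i)))

⊻-self : ∀ {u} (x : Vec Bool u) → x ⊻ x ≡ 𝟎
⊻-self x = vec-ext λ i → trans (lookup-⊻ x x i) (trans (xor-same (lookup x i)) (sym (Vecₚ.lookup-replicate i false)))

⊻-identʳ : ∀ {u} (x : Vec Bool u) → x ⊻ 𝟎 ≡ x
⊻-identʳ x = vec-ext λ i → trans (lookup-⊻ x 𝟎 i) (trans (cong (lookup x i xor_) (Vecₚ.lookup-replicate i false)) (𝔹.xor-identityʳ _))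

⊻≡𝟎⇒≡ : ∀ {u} {x y : Vec Bool u} → x ⊻ y ≡ 𝟎 → x ≡ y
⊻≡𝟎⇒≡ {x = x} {y} e = trans (sym (⊻-identʳ x)) (trans (cong (x ⊻_) (sym e)) (⊻-cancel x y))

nonzero : ∀ {u} → Vec Bool u → Bool
nonzero []          = false
nonzero (true  ∷ x) = true
nonzero (false ∷ x) = nonzero x

nonzero-support : ∀ {u} (x : Vec Bool u) → nonzero x ≡ true → ∃[ i ] lookup x i ≡ true
nonzero-support (true  ∷ x) _ = zero , refl
nonzero-support (false ∷ x) e with nonzero-support x e
... | i , p = suc i , p

≢𝟎⇒nonzero : ∀ {u} {x : Vec Bool u} → x ≢ 𝟎 → nonzero x ≡ true
≢𝟎⇒nonzero {x = []}        n = contradiction refl n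
≢𝟎⇒nonzero {x = true  ∷ x} n = refl
≢𝟎⇒nonzero {x = false ∷ x} n = ≢𝟎⇒nonzero (n ∘ cong (false ∷_))

nonzero-𝟎 : ∀ u → nonzero (𝟎 {u}) ≡ false
nonzero-𝟎 zero    = refl
nonzero-𝟎 (suc u) = nonzero-𝟎 u

Proj : ℕ → Set
Proj u = Σ (Vec Bool u) λ x → nonzero x ≡ true

proj-≡ : ∀ {u} {p q : Proj u} → proj₁ p ≡ proj₁ q → p ≡ q
proj-≡ {p = x , e} {_ , e′} refl = cong (x ,_) (≡-irrelevant e e′)

proj-≟ : ∀ {u} → DecidableEquality (Proj u)
proj-≟ p q with Vecₚ.≡-dec 𝔹._≟_ (proj₁ p) (proj₁ q)
... | yes e = yes (proj-≡ e)
... | no n  = no (n ∘ cong proj₁)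

proj≢𝟎 : ∀ {u} (p : Proj u) → proj₁ p ≢ 𝟎
proj≢𝟎 {u} (_ , e) refl = contradiction (trans (sym e) (nonzero-𝟎 u)) λ ()

proj-↔ : ∀ u → ∃[ n ] (Proj u ↔ Fin n)
proj-↔ u with vec-↔ u
... | n , i = size , ↔-sym (bijection φ (λ e → elem-inj (↔-injective⁻ i (cong proj₁ e))) sur)
  where
    open Inverse i using (to; from; strictlyInverseʳ)
    E : Enum (λ k → nonzero (from k) ≡ true)
    E = enum (λ k → nonzero (from k) 𝔹.≟ true)
    open Enum E
    φ : Fin size → Proj u
    φ k = from (elem k) , sound k
    sur : ∀ p → ∃[ k ] φ k ≡ p
    sur (x , e) with index (to x) (trans (cong nonzero (strictlyInverseʳ x)) e)
    ... | k , q = k , proj-≡ (trans (cong from q) (strictlyInverseʳ x))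

-- The projective space on the subsets of a set with a family Bl of subsets β, any two of which share at most
-- one point, after a trade for each β: for x , y ⊂ β with x + y ≠ β the third point is x + y + β.
module Trade (em : ExcludedMiddle 0ℓ) {u} (Bl : Vec Bool u → Set)
             (linear : ∀ {β β′ p q} → Bl β → Bl β′ → p ≢ q → lookup β p ≡ true → lookup β q ≡ true →
                       lookup β′ p ≡ true → lookup β′ q ≡ true → β ≡ β′) where

  -- For a three-element β and distinct nonzero x, y these are the pairs spanning a line of the Fano
  -- plane on the subsets of β that avoids β itself. The four such lines form a Pasch configuration,
  -- and the trade switches it to the opposite one.
  Affected : Vec Bool u → Vec Bool u → Vec Bool u → Set
  Affected β x y = Bl β × x ⊆ β × y ⊆ β × x ≢ β × y ≢ β × x ⊻ y ≢ β

  private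
    affected-sym : ∀ {β x y} → Affected β x y → Affected β y x
    affected-sym {β} {x} {y} (b , p , q , n , n′ , n″) = b , q , p , n′ , n , n″ ∘ trans (⊻-comm x y)

    -- Two points in the union of x and y suffice to determine, by `linear`, a β that contains both
    -- sets.
    two-points : ∀ {x y : Vec Bool u} → x ≢ y → x ≢ 𝟎 → y ≢ 𝟎 →
                 ∃[ p ] ∃[ q ] (p ≢ q × (∀ β → x ⊆ β → y ⊆ β → lookup β p ≡ true × lookup β q ≡ true))
    two-points {x} {y} n nx ny with vec-differ n
    ... | p , d with lookup x p in ex | lookup y p in ey
    ...   | true  | true  = contradiction refl d
    ...   | false | false = contradiction refl d
    ...   | true  | false with nonzero-support y (≢𝟎⇒nonzero ny)
    ...     | q , eq = p , q , (λ { refl → contradiction (trans (sym eq) ey) λ () }) , λ _ s t → s p ex , t q eq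
    two-points {x} {y} n nx ny | p , d | false | true with nonzero-support x (≢𝟎⇒nonzero nx)
    ...     | q , eq = p , q , (λ { refl → contradiction (trans (sym eq) ex) λ () }) , λ _ s t → t p ey , s q eq

    affected-unique : ∀ {β β′ x y} → x ≢ y → x ≢ 𝟎 → y ≢ 𝟎 → Affected β x y → Affected β′ x y → β ≡ β′
    affected-unique {β} {β′} n nx ny (b , p , q , _) (b′ , p′ , q′ , _) with two-points n nx ny
    ... | i , j , i≢j , h = linear b b′ i≢j (proj₁ (h β p q)) (proj₂ (h β p q)) (proj₁ (h β′ p′ q′)) (proj₂ (h β′ p′ q′))

    sum : ∀ x y → Dec (∃[ β ] Affected β x y) → Vec Bool u
    sum x y (yes (β , _)) = x ⊻ y ⊻ β
    sum x y (no _)        = x ⊻ y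

    sum≢𝟎 : ∀ {x y} d → x ≢ y → sum x y d ≢ 𝟎
    sum≢𝟎 (yes (β , a)) n e = proj₂ (proj₂ (proj₂ (proj₂ (proj₂ a)))) (⊻≡𝟎⇒≡ e)
    sum≢𝟎 (no _)        n e = n (⊻≡𝟎⇒≡ e)

    op′ : ∀ (p q : Proj u) → Dec (p ≡ q) → Proj u
    op′ p q (yes _) = p
    op′ p q (no n)  = sum (proj₁ p) (proj₁ q) em , ≢𝟎⇒nonzero (sum≢𝟎 em (n ∘ proj-≡))

    op : Proj u → Proj u → Proj u
    op p q = op′ p q (proj-≟ p q)

    op-idem : ∀ p → op p p ≡ p
    op-idem p with proj-≟ p p
    ... | yes _ = refl
    ... | no n  = contradiction refl n

    op-vec : ∀ {p q} → p ≢ q → proj₁ (op p q) ≡ sum (proj₁ p) (proj₁ q) em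
    op-vec {p} {q} n with proj-≟ p q
    ... | yes e = contradiction e n
    ... | no _  = refl

    sum-affected : ∀ {β x y} d → x ≢ y → x ≢ 𝟎 → y ≢ 𝟎 → Affected β x y → sum x y d ≡ x ⊻ y ⊻ β
    sum-affected {x = x} {y} (yes (β′ , a′)) n nx ny a = cong (x ⊻ y ⊻_) (affected-unique n nx ny a′ a)
    sum-affected (no none) n nx ny a = contradiction (_ , a) none

    sum-plain : ∀ {x y} d → ¬ (∃[ β ] Affected β x y) → sum x y d ≡ x ⊻ y
    sum-plain (yes a) none = contradiction a none
    sum-plain (no _)  _    = refl

    vec≢ : ∀ {p q : Proj u} → p ≢ q → proj₁ p ≢ proj₁ q
    vec≢ n = n ∘ proj-≡

  op-affected : ∀ {p q β} → p ≢ q → Affected β (proj₁ p) (proj₁ q) → proj₁ (op p q) ≡ proj₁ p ⊻ proj₁ q ⊻ β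
  op-affected {p} {q} n a = trans (op-vec n) (sum-affected em (vec≢ n) (proj≢𝟎 p) (proj≢𝟎 q) a)

  private
    op-plain : ∀ {p q} → p ≢ q → ¬ (∃[ β ] Affected β (proj₁ p) (proj₁ q)) → proj₁ (op p q) ≡ proj₁ p ⊻ proj₁ q
    op-plain n none = trans (op-vec n) (sum-plain em none)

    op-comm : ∀ p q → op p q ≡ op q p
    op-comm p q with proj-≟ p q
    op-comm p q | yes refl = sym (op-idem p)
    op-comm p@(x , _) q@(y , _) | no n with em {∃[ β ] Affected β x y} in eq
    ... | yes (β , a) = proj-≡ (trans (cong (_⊻ β) (⊻-comm x y)) (sym (op-affected (n ∘ sym) (affected-sym a))))
    ... | no none = proj-≡ (trans (⊻-comm x y) (sym (op-plain (n ∘ sym) (λ { (β , a) → none (β , affected-sym a) }))))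

    x⊻z : ∀ (x y β : Vec Bool u) → x ⊻ (x ⊻ y ⊻ β) ≡ y ⊻ β
    x⊻z x y β = trans (cong (x ⊻_) (⊻-assoc x y β)) (⊻-cancel x (y ⊻ β))

    op-invol : ∀ p q → op p (op p q) ≡ q
    op-invol p@(x , ex) q@(y , ey) with proj-≟ p q
    ... | yes refl = op-idem p
    ... | no n with em {∃[ β ] Affected β x y} in eq
    ...   | yes (β , b , x⊆ , y⊆ , x≢ , y≢ , s≢) = proj-≡ (trans (op-affected p≢z z-affected)
            (trans (cong (_⊻ β) (x⊻z x y β)) (trans (⊻-comm (y ⊻ β) β) (trans (cong (β ⊻_) (⊻-comm y β)) (⊻-cancel β y)))))
      where
        z = x ⊻ y ⊻ β
        p≢z : p ≢ (z , _)
        p≢z e = y≢ (⊻≡𝟎⇒≡ (trans (sym (x⊻z x y β)) (trans (cong (x ⊻_) (sym (cong proj₁ e))) (⊻-self x))))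
        -- The conditions pass to the new line: z = β would give x = y, and x + z = β would give y =
        -- 0.
        z-affected : Affected β x z
        z-affected = b , x⊆ , ⊻-⊆ (x ⊻ y) β β (⊻-⊆ x y β x⊆ y⊆) (λ _ e → e) , x≢
          , (λ e → n (proj-≡ (⊻≡𝟎⇒≡ (trans (sym (⊻-cancel β (x ⊻ y))) (trans (cong (β ⊻_) (trans (⊻-comm β (x ⊻ y)) e)) (⊻-self β))))))
          , (λ e → proj≢𝟎 q (trans (sym (⊻-cancel β y)) (trans (cong (β ⊻_) (trans (⊻-comm β y) (trans (sym (x⊻z x y β)) e))) (⊻-self β))))
    ...   | no none = proj-≡ (trans (op-plain p≢s none′) (⊻-cancel x y))
      where
        p≢s : p ≢ (x ⊻ y , _)
        p≢s e = proj≢𝟎 q (trans (sym (⊻-cancel x y)) (trans (cong (x ⊻_) (sym (cong proj₁ e))) (⊻-self x)))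
        none′ : ¬ (∃[ β ] Affected β x (x ⊻ y))
        none′ (β , b , x⊆ , s⊆ , x≢ , s≢ , y≢) = none (β , b , x⊆ , subst (_⊆ β) (⊻-cancel x y) (⊻-⊆ x (x ⊻ y) β x⊆ s⊆) , x≢ ,
          (λ e → y≢ (trans (⊻-cancel x y) e)) , s≢)

  trade : Squag (Proj u)
  trade = record { _∙_ = op ; idem = op-idem ; comm = op-comm ; invol = op-invol }

-- Embedding a partial triple system

record Partial (U : Set) : Set₁ where
  field
    Bl       : U → U → U → Set
    distinct : ∀ {p q r} → Bl p q r → p ≢ q
    swap₁₂   : ∀ {p q r} → Bl p q r → Bl q p r
    swap₂₃   : ∀ {p q r} → Bl p q r → Bl p r q
    unique   : ∀ {p q r s} → Bl p q r → Bl p q s → r ≡ s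

module Embedding (em : ExcludedMiddle 0ℓ) {u} (𝓟 : Partial (Fin u)) where
  open Partial 𝓟

  unit : Fin u → Vec Bool u
  unit p = Vec.tabulate (λ i → does (i ≟ p))

  private
    lookup-unit : ∀ p i → lookup (unit p) i ≡ does (i ≟ p)
    lookup-unit p i = Vecₚ.lookup∘tabulate (λ i → does (i ≟ p)) i

    unit-self : ∀ p → lookup (unit p) p ≡ true
    unit-self p = trans (lookup-unit p p) (lemma (p ≟ p))
      where
        lemma : (d : Dec (p ≡ p)) → does d ≡ true
        lemma (yes _) = refl
        lemma (no n)  = contradiction refl n

    unit-other : ∀ {p i} → i ≢ p → lookup (unit p) i ≡ false
    unit-other {p} {i} n = trans (lookup-unit p i) (lemma (i ≟ p))
      where
        lemma : (d : Dec (i ≡ p)) → does d ≡ false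
        lemma (yes e) = contradiction e n
        lemma (no _)  = refl

    block : Fin u → Fin u → Fin u → Vec Bool u
    block p q r = unit p ⊻ unit q ⊻ unit r

    lookup-block : ∀ p q r i → lookup (block p q r) i ≡ (lookup (unit p) i xor lookup (unit q) i) xor lookup (unit r) i
    lookup-block p q r i = trans (lookup-⊻ (unit p ⊻ unit q) (unit r) i) (cong (_xor lookup (unit r) i) (lookup-⊻ (unit p) (unit q) i))

    block-swap₁₂ : ∀ p q r → block q p r ≡ block p q r
    block-swap₁₂ p q r = cong (_⊻ unit r) (⊻-comm (unit q) (unit p))

    block-swap₂₃ : ∀ p q r → block p r q ≡ block p q r
    block-swap₂₃ p q r = trans (⊻-assoc (unit p) (unit r) (unit q)) (trans (cong (unit p ⊻_) (⊻-comm (unit r) (unit q))) (sym (⊻-assoc (unit p) (unit q) (unit r))))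

    in₁ : ∀ {p q r} → Bl p q r → lookup (block p q r) p ≡ true
    in₁ {p} {q} {r} b = trans (lookup-block p q r p) (cong₂ _xor_ (cong₂ _xor_ (unit-self p) (unit-other (distinct b))) (unit-other (distinct (swap₂₃ b))))

    in₂ : ∀ {p q r} → Bl p q r → lookup (block p q r) q ≡ true
    in₂ {p} {q} {r} b = trans (cong (λ v → lookup v q) (sym (block-swap₁₂ p q r))) (in₁ (swap₁₂ b))

    in₃ : ∀ {p q r} → Bl p q r → lookup (block p q r) r ≡ true
    in₃ {p} {q} {r} b = trans (cong (λ v → lookup v r) (sym (block-swap₂₃ p q r))) (in₂ (swap₂₃ b))

    members : ∀ p q r i → lookup (block p q r) i ≡ true → i ≡ p ⊎ i ≡ q ⊎ i ≡ r
    members p q r i e with i ≟ p | i ≟ q | i ≟ r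
    ... | yes a | _     | _     = inj₁ a
    ... | no _  | yes b | _     = inj₂ (inj₁ b)
    ... | no _  | no _  | yes c = inj₂ (inj₂ c)
    ... | no a  | no b  | no c  = contradiction (trans (sym e) (trans (lookup-block p q r i)
            (cong₂ _xor_ (cong₂ _xor_ (unit-other a) (unit-other b)) (unit-other c)))) λ ()

    IsBlock : Vec Bool u → Set
    IsBlock β = ∃[ p ] ∃[ q ] ∃[ r ] (Bl p q r × β ≡ block p q r)

    through : ∀ {β i j} → IsBlock β → i ≢ j → lookup β i ≡ true → lookup β j ≡ true → ∃[ k ] (Bl i j k × β ≡ block i j k)
    through {i = i} {j} (p , q , r , b , refl) n ei ej = go (members p q r i ei) (members p q r j ej)
      where
        Goal = ∃[ k ] (Bl i j k × block p q r ≡ block i j k)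
        go : i ≡ p ⊎ i ≡ q ⊎ i ≡ r → j ≡ p ⊎ j ≡ q ⊎ j ≡ r → Goal
        go (inj₁ refl)        (inj₁ refl)        = contradiction refl n
        go (inj₁ refl)        (inj₂ (inj₁ refl)) = r , b , refl
        go (inj₁ refl)        (inj₂ (inj₂ refl)) = q , swap₂₃ b , sym (block-swap₂₃ p q r)
        go (inj₂ (inj₁ refl)) (inj₁ refl)        = r , swap₁₂ b , sym (block-swap₁₂ p q r)
        go (inj₂ (inj₁ refl)) (inj₂ (inj₁ refl)) = contradiction refl n
        go (inj₂ (inj₁ refl)) (inj₂ (inj₂ refl)) = p , swap₂₃ (swap₁₂ b) , sym (trans (block-swap₂₃ q p r) (block-swap₁₂ p q r))
        go (inj₂ (inj₂ refl)) (inj₁ refl)        = q , swap₁₂ (swap₂₃ b) , sym (trans (block-swap₁₂ p r q) (block-swap₂₃ p q r))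
        go (inj₂ (inj₂ refl)) (inj₂ (inj₁ refl)) = p , swap₂₃ (swap₁₂ (swap₂₃ b)) ,
          sym (trans (block-swap₂₃ r p q) (trans (block-swap₁₂ p r q) (block-swap₂₃ p q r)))
        go (inj₂ (inj₂ refl)) (inj₂ (inj₂ refl)) = contradiction refl n

    linear : ∀ {β β′ p q} → IsBlock β → IsBlock β′ → p ≢ q → lookup β p ≡ true → lookup β q ≡ true →
             lookup β′ p ≡ true → lookup β′ q ≡ true → β ≡ β′
    linear b b′ n e₁ e₂ e₃ e₄ with through b n e₁ e₂ | through b′ n e₃ e₄
    ... | k , bl , refl | k′ , bl′ , refl with unique bl bl′
    ...   | refl = refl

  open Trade em IsBlock linear using (op-affected) renaming (trade to host) public
  open Squag host

  point : Fin u → Proj u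
  point p = unit p , ≢𝟎⇒nonzero {x = unit p} λ e → contradiction (trans (sym (unit-self p)) (trans (cong (λ v → lookup v p) e) (Vecₚ.lookup-replicate p false))) λ ()

  point-inj : ∀ {p q} → point p ≡ point q → p ≡ q
  point-inj {p} {q} e with p ≟ q
  ... | yes r = r
  ... | no n  = contradiction (trans (sym (unit-self p)) (trans (cong (λ v → lookup (proj₁ v) p) e) (unit-other n))) λ ()

  -- For β = p + q + r the traded sum p + q + β is r.
  point-block : ∀ {p q r} → Bl p q r → point p ∙ point q ≡ point r
  point-block {p} {q} {r} b = proj-≡ (trans (op-affected (distinct b ∘ point-inj) (
      (p , q , r , b , refl)
      , (λ i e → subst (λ i → lookup (block p q r) i ≡ true) (sym (is e)) (in₁ b))
      , (λ i e → subst (λ i → lookup (block p q r) i ≡ true) (sym (is e)) (in₂ b))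
      , (λ e → distinct b (sym (is (trans (cong (λ v → lookup v q) e) (in₂ b)))))
      , (λ e → distinct b (is (trans (cong (λ v → lookup v p) e) (in₁ b))))
      , (λ e → contradiction (trans (sym (in₃ b)) (trans (cong (λ v → lookup v r) (sym e)) (trans (lookup-⊻ (unit p) (unit q) r)
          (cong₂ _xor_ (unit-other (distinct (swap₂₃ b) ∘ sym)) (unit-other (distinct (swap₂₃ (swap₁₂ b)) ∘ sym)))))) λ ())))
      (⊻-cancel (unit p ⊻ unit q) (unit r)))
    where
      is : ∀ {p i} → lookup (unit p) i ≡ true → i ≡ p
      is {p} {i} e with i ≟ p
      ... | yes q = q
      ... | no n  = contradiction (trans (sym e) (unit-other n)) λ ()

  Given : Proj u → Proj u → Set
  Given x y = ∃[ p ] ∃[ q ] ∃[ r ] (Bl p q r × x ≡ point p × y ≡ point q)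

  private
    given-sym : ∀ {x y} → Given x y → Given y x
    given-sym (p , q , r , b , e , e′) = q , p , r , swap₁₂ b , e′ , e

    given-line : ∀ {x y} → Given x y → Given x (x ∙ y)
    given-line (p , q , r , b , refl , refl) = p , r , q , swap₂₃ b , refl , point-block b

    -- Requiring `P` and `Q` to lie on the line through `x` and `y`, rather than the reverse, makes
    -- the relation depend on that line alone, with no assumption that `P` and `Q` differ. For
    -- distinct `P`, `Q` it singles out their line, if it is not given.
    Extra : Proj u → Proj u → Proj u → Proj u → Set
    Extra P Q x y = ¬ Given x y × Line x y P × Line x y Q

    line-sym : ∀ {x y z} → Line x y z → Line y x z
    line-sym (inj₁ e)               = inj₂ (inj₁ e)
    line-sym (inj₂ (inj₁ e))        = inj₁ e
    line-sym {x} {y} (inj₂ (inj₂ e)) = inj₂ (inj₂ (trans e (comm x y)))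

    line-third : ∀ {x y z} → Line x y z → Line x (x ∙ y) z
    line-third (inj₁ e)                = inj₁ e
    line-third {x} {y} (inj₂ (inj₁ e)) = inj₂ (inj₂ (trans e (sym (invol x y))))
    line-third (inj₂ (inj₂ e))         = inj₂ (inj₁ e)

    line-third⁻ : ∀ {x y z} → Line x (x ∙ y) z → Line x y z
    line-third⁻ {x} {y} {z} l = subst (λ t → Line x t z) (invol x y) (line-third l)

    does-⇔ : ∀ {A B : Set} (a : Dec A) (b : Dec B) → (A → B) → (B → A) → does a ≡ does b
    does-⇔ (yes _) (yes _) _ _ = refl
    does-⇔ (no _)  (no _)  _ _ = refl
    does-⇔ (yes a) (no n)  f _ = contradiction (f a) n
    does-⇔ (no n)  (yes b) _ g = contradiction (g b) n

    does-yes : ∀ {A : Set} (a : Dec A) → A → does a ≡ true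
    does-yes (yes _) _ = refl
    does-yes (no n)  a = contradiction a n

    does-no : ∀ {A : Set} (a : Dec A) → ¬ A → does a ≡ false
    does-no (yes a) n = contradiction a n
    does-no (no _)  _ = refl

    does-true : ∀ {A : Set} (a : Dec A) → does a ≡ true → A
    does-true (yes a) _ = a

  extra : Proj u → Proj u → Mark host
  extra P Q = record
    { marked = λ x y → does (em {Extra P Q x y})
    ; marked-sym = λ x y → does-⇔ em em mirror mirror
    ; marked-line = λ {x} {y} n → does-⇔ (em {Extra P Q x (x ∙ y)}) em
        (λ { (g , l , l′) → (g ∘ given-line) , line-third⁻ l , line-third⁻ l′ })
        (λ { (g , l , l′) → (λ h → g (subst (Given x) (invol x y) (given-line h))) , line-third l , line-third l′ }) }
    where
      mirror : ∀ {x y} → Extra P Q x y → Extra P Q y x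
      mirror (g , l , l′) = (g ∘ given-sym) , line-sym l , line-sym l′

  private
    N : ℕ
    N = proj₁ (proj-↔ u)

  marks : Fin (N * N) → Mark host
  marks i = extra (Inverse.from (proj₂ (proj-↔ u)) (proj₁ (Inverse.to *↔× i))) (Inverse.from (proj₂ (proj-↔ u)) (proj₂ (Inverse.to (*↔× {N} {N}) i)))

  given-unmarked : ∀ {p q r} → Bl p q r → ∀ i → marked (marks i) (point p) (point q) ≡ false
  given-unmarked b i = does-no em λ { (n , _) → n (_ , _ , _ , b , refl , refl) }

  -- If the pair were not given, the mark attached to it would single out the block through `a` and
  -- `b`, and no other block of the subsystem, since two points determine their line.
  all-given : ∀ {c} (P : Squag (Fin c)) (e : Emb P host) → (∀ i → ¬ ExactlyOne (marks i) e) →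
              ∀ {a b} → a ≢ b → Given (fun e a) (fun e b)
  all-given {c} P e ¬one {a} {b} n with em {Given (fun e a) (fun e b)}
  ... | yes g = g
  ... | no ¬g = contradiction (subst (λ m → ExactlyOne m e) index one) (¬one i)
    where
      module P = Squag P
      iso = proj₂ (proj-↔ u)
      i = Inverse.from (*↔× {N} {N}) (Inverse.to iso (fun e a) , Inverse.to iso (fun e b))
      index : extra (fun e a) (fun e b) ≡ marks i
      index = sym (cong₂ extra
        (trans (cong (Inverse.from iso ∘ proj₁) (Inverse.strictlyInverseˡ (*↔× {N} {N}) _)) (Inverse.strictlyInverseʳ iso _))
        (trans (cong (Inverse.from iso ∘ proj₂) (Inverse.strictlyInverseˡ (*↔× {N} {N}) _)) (Inverse.strictlyInverseʳ iso _)))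
      pull : ∀ {x y z} → Line (fun e x) (fun e y) (fun e z) → P.Line x y z
      pull (inj₁ q)        = inj₁ (inj e q)
      pull (inj₂ (inj₁ q)) = inj₂ (inj₁ (inj e q))
      pull {x} {y} (inj₂ (inj₂ q)) = inj₂ (inj₂ (inj e (trans q (sym (hom e x y)))))
      exchange : ∀ {x y a b} → a ≢ b → P.Line x y a → P.Line x y b → P.Line a b x × P.Line a b y
      exchange n (inj₁ refl) (inj₁ refl) = contradiction refl n
      exchange n (inj₁ refl) (inj₂ (inj₁ refl)) = inj₁ refl , inj₂ (inj₁ refl)
      exchange {x} {y} n (inj₁ refl) (inj₂ (inj₂ refl)) = inj₁ refl , inj₂ (inj₂ (sym (P.invol x y)))
      exchange n (inj₂ (inj₁ refl)) (inj₁ refl) = inj₂ (inj₁ refl) , inj₁ refl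
      exchange n (inj₂ (inj₁ refl)) (inj₂ (inj₁ refl)) = contradiction refl n
      exchange {x} {y} n (inj₂ (inj₁ refl)) (inj₂ (inj₂ refl)) = inj₂ (inj₂ (sym (trans (P.comm y _) (P.invol′ x y)))) , inj₁ refl
      exchange {x} {y} n (inj₂ (inj₂ refl)) (inj₁ refl) = inj₂ (inj₁ refl) , inj₂ (inj₂ (sym (P.invol″ x y)))
      exchange {x} {y} n (inj₂ (inj₂ refl)) (inj₂ (inj₁ refl)) = inj₂ (inj₂ (sym (P.invol′ x y))) , inj₂ (inj₁ refl)
      exchange n (inj₂ (inj₂ refl)) (inj₂ (inj₂ refl)) = contradiction refl n
      one : ExactlyOne (extra (fun e a) (fun e b)) e
      one = a , b , n , does-yes em (¬g , inj₁ refl , inj₂ (inj₁ refl)) , λ a′ b′ _ m →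
        let _ , l , l′ = does-true (em {Extra (fun e a) (fun e b) (fun e a′) (fun e b′)}) m in exchange n (pull l) (pull l′)

-- The amalgam of two systems

module Amalgam (em : ExcludedMiddle 0ℓ) {g} (G : Squag (Fin g)) (FS : FibreSystem G)
               {a b c} {A : Squag (Fin a)} {B : Squag (Fin b)} {C : Squag (Fin c)} (f : Emb A B) (f′ : Emb A C) where
  private
    module A = Squag A
    module B = Squag B
    module C = Squag C

    ιB : Fin b → Fin (b + c)
    ιB x = x ↑ˡ c

    ιC′ : ∀ z → Dec (∃[ w ] fun f′ w ≡ z) → Fin (b + c)
    ιC′ z (yes (w , _)) = ιB (fun f w)
    ιC′ z (no _)        = b ↑ʳ z

    ιC : Fin c → Fin (b + c)
    ιC z = ιC′ z (any? (λ w → fun f′ w ≟ z))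

    left≢right : ∀ {x : Fin b} {z : Fin c} → x ↑ˡ c ≢ b ↑ʳ z
    left≢right {x} {z} e = contradiction (trans (sym (splitAt-↑ˡ b x c)) (trans (cong (Data.Fin.splitAt b) e) (splitAt-↑ʳ b c z))) λ ()

    ιB-inj : ∀ {x y} → ιB x ≡ ιB y → x ≡ y
    ιB-inj {x} {y} = ↑ˡ-injective c x y

    ιC-inj : ∀ {x y} → ιC x ≡ ιC y → x ≡ y
    ιC-inj {x} {y} = go (any? (λ w → fun f′ w ≟ x)) (any? (λ w → fun f′ w ≟ y))
      where
        go : ∀ d d′ → ιC′ x d ≡ ιC′ y d′ → x ≡ y
        go (yes (w , p)) (yes (w′ , p′)) e = trans (sym p) (trans (cong (fun f′) (inj f (ιB-inj e))) p′)
        go (yes _)       (no _)          e = contradiction e left≢right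
        go (no _)        (yes _)         e = contradiction (sym e) left≢right
        go (no _)        (no _)          e = ↑ʳ-injective b x y e

    glue : ∀ w → ιB (fun f w) ≡ ιC (fun f′ w)
    glue w with any? (λ v → fun f′ v ≟ fun f′ w)
    ... | yes (v , p) = cong (ιB ∘ fun f) (sym (inj f′ p))
    ... | no n        = contradiction (w , refl) n

    shared : ∀ {x z} → ιB x ≡ ιC z → ∃[ w ] (fun f w ≡ x × fun f′ w ≡ z)
    shared {x} {z} e with any? (λ w → fun f′ w ≟ z)
    ... | yes (w , p) = w , sym (ιB-inj e) , p
    ... | no _        = contradiction e left≢right

    Block₁ Block₂ Bl : Fin (b + c) → Fin (b + c) → Fin (b + c) → Set
    Block₁ p q r = ∃[ x ] ∃[ y ] (x ≢ y × p ≡ ιB x × q ≡ ιB y × r ≡ ιB (x B.∙ y))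
    Block₂ p q r = ∃[ x ] ∃[ y ] (x ≢ y × p ≡ ιC x × q ≡ ιC y × r ≡ ιC (x C.∙ y))
    Bl p q r = Block₁ p q r ⊎ Block₂ p q r

    -- Points shared by `B` and `C` come from `A`, and both products are images of the product
    -- there. Thus the union of the two sets of blocks is a partial triple system.
    agree : ∀ {x y z z′} → ιB x ≡ ιC z → ιB y ≡ ιC z′ → ιB (x B.∙ y) ≡ ιC (z C.∙ z′)
    agree e e′ with shared e | shared e′
    ... | w , refl , refl | w′ , refl , refl = trans (cong ιB (sym (hom f w w′))) (trans (glue (w A.∙ w′)) (cong ιC (hom f′ w w′)))

    blockB : ∀ {x y r} → Bl (ιB x) (ιB y) r → r ≡ ιB (x B.∙ y)
    blockB (inj₁ (_ , _ , _ , p , q , refl)) = cong ιB (sym (cong₂ B._∙_ (ιB-inj p) (ιB-inj q)))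
    blockB (inj₂ (_ , _ , _ , p , q , refl)) = sym (agree p q)

    blockC : ∀ {x y r} → Bl (ιC x) (ιC y) r → r ≡ ιC (x C.∙ y)
    blockC (inj₁ (_ , _ , _ , p , q , refl)) = agree (sym p) (sym q)
    blockC (inj₂ (_ , _ , _ , p , q , refl)) = cong ιC (sym (cong₂ C._∙_ (ιC-inj p) (ιC-inj q)))

    partials : Partial (Fin (b + c))
    partials = record
      { Bl = Bl
      ; distinct = λ { (inj₁ (x , y , n , refl , refl , _)) e → n (ιB-inj e) ; (inj₂ (x , y , n , refl , refl , _)) e → n (ιC-inj e) }
      ; swap₁₂ = λ { (inj₁ (x , y , n , refl , refl , refl)) → inj₁ (y , x , n ∘ sym , refl , refl , cong ιB (B.comm x y))
                   ; (inj₂ (x , y , n , refl , refl , refl)) → inj₂ (y , x , n ∘ sym , refl , refl , cong ιC (C.comm x y)) }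
      ; swap₂₃ = λ { (inj₁ (x , y , n , refl , refl , refl)) → inj₁ (x , x B.∙ y , B.∙≢ˡ n ∘ sym , refl , refl , cong ιB (sym (B.invol x y)))
                   ; (inj₂ (x , y , n , refl , refl , refl)) → inj₂ (x , x C.∙ y , C.∙≢ˡ n ∘ sym , refl , refl , cong ιC (sym (C.invol x y))) }
      ; unique = λ { (inj₁ (x , y , n , refl , refl , refl)) b → sym (blockB b)
                   ; (inj₂ (x , y , n , refl , refl , refl)) b → sym (blockC b) } }

    open Embedding em partials
    module E = Squag host
    open Completions em G FS using (Completion; complete)
    open Completion (complete proj-≟ (proj₂ (proj-↔ (b + c))) host marks)

    pull : ∀ {m r} {P : Squag (Fin m)} {R : Squag (Fin r)} (ι′ : Fin r → Fin (b + c)) → (∀ {x y} → ι′ x ≡ ι′ y → x ≡ y) →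
           (∀ {x y t} → Bl (ι′ x) (ι′ y) t → t ≡ ι′ (Squag._∙_ R x y)) →
           (e : Emb P host) → (∀ {x y} → x ≢ y → Given (fun e x) (fun e y)) → (∀ x → ∃[ w ] fun e x ≡ point (ι′ w)) → Emb P R
    pull {P = P} {R} ι′ ι′-inj ι′-block e given pre = emb (proj₁ ∘ pre)
        (λ {x} {y} p → inj e (trans (proj₂ (pre x)) (trans (cong (point ∘ ι′) p) (sym (proj₂ (pre y)))))) h
      where
        module P = Squag P
        module R = Squag R
        h : ∀ x y → proj₁ (pre (x P.∙ y)) ≡ proj₁ (pre x) R.∙ proj₁ (pre y)
        h x y with x ≟ y
        ... | yes refl = trans (cong (proj₁ ∘ pre) (P.idem x)) (sym (R.idem _))
        ... | no n with given n
        ...   | p , q , t , bl , ep , eq = ι′-inj (trans (point-inj (trans (sym (proj₂ (pre (x P.∙ y)))) (trans (hom e x y)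
                  (trans (cong₂ E._∙_ ep eq) (point-block bl)))))
                  (ι′-block (subst₂ (λ p q → Bl p q t) (point-inj (trans (sym ep) (proj₂ (pre x)))) (point-inj (trans (sym eq) (proj₂ (pre y)))) bl)))

    embed : ∀ {r} {R : Squag (Fin r)} (ι′ : Fin r → Fin (b + c)) → (∀ {x y} → ι′ x ≡ ι′ y → x ≡ y) →
            (∀ {x y} → x ≢ y → Bl (ι′ x) (ι′ y) (ι′ (Squag._∙_ R x y))) → Emb R system
    embed {R = R} ι′ ι′-inj bl = emb (ι ∘ point ∘ ι′) (ι′-inj ∘ point-inj ∘ ι-inj) h
      where
        module R = Squag R
        h : ∀ x y → ι (point (ι′ (x R.∙ y))) ≡ Squag._∙_ system (ι (point (ι′ x))) (ι (point (ι′ y)))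
        h x y with x ≟ y
        ... | yes refl = trans (cong (ι ∘ point ∘ ι′) (R.idem x)) (sym (Squag.idem system _))
        ... | no n = trans (cong ι (sym (point-block (bl n)))) (ι-hom (n ∘ ι′-inj ∘ point-inj) (given-unmarked (bl n)))

  amalgam-order : ℕ
  amalgam-order = points

  amalgam : Squag (Fin amalgam-order)
  amalgam = system

  left : Emb B amalgam
  left = embed ιB ιB-inj λ {x} {y} n → inj₁ (x , y , n , refl , refl , refl)

  right : Emb C amalgam
  right = embed ιC ιC-inj λ {x} {y} n → inj₂ (x , y , n , refl , refl , refl)

  commutes : ∀ w → fun left (fun f w) ≡ fun right (fun f′ w)
  commutes w = cong (ι ∘ point) (glue w)

  meet : ∀ {x z} → fun left x ≡ fun right z → ∃[ w ] (fun f w ≡ x × fun f′ w ≡ z)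
  meet e = shared (point-inj (ι-inj e))

  -- In the last case all pairs are given. If some `x₀` lies outside `B`, every block through `x₀`
  -- comes from `C`, and these blocks cover all the points.
  amalgam-subsystems : ∀ {m} (P : Squag (Fin m)) → 3 < m → Emb P amalgam → Emb P B ⊎ Emb P C ⊎ Emb P G ⊎ Emb G P
  amalgam-subsystems {m} P 3<m e with control P 3<m e
  ... | inj₁ e′ = inj₂ (inj₂ (inj₁ e′))
  ... | inj₂ (inj₁ e′) = inj₂ (inj₂ (inj₂ e′))
  ... | inj₂ (inj₂ (e′ , ¬one)) with em {∀ x → ∃[ w ] fun e′ x ≡ point (ιB w)}
  ...   | yes pre = inj₁ (pull ιB ιB-inj blockB e′ (all-given P e′ ¬one) pre)
  ...   | no ¬pre = inj₂ (inj₁ (pull ιC ιC-inj blockC e′ given pre))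
    where
      given : ∀ {x y} → x ≢ y → Given (fun e′ x) (fun e′ y)
      given = all-given P e′ ¬one
      InC : Fin m → Set
      InC x = ∃[ w ] fun e′ x ≡ point (ιC w)
      outside : ∃[ x ] ¬ (∃[ w ] fun e′ x ≡ point (ιB w))
      outside with em {∃[ x ] ¬ (∃[ w ] fun e′ x ≡ point (ιB w))}
      ... | yes o = o
      ... | no none = contradiction (λ x → lemma x em) ¬pre
        where
          lemma : ∀ x → Dec (∃[ w ] fun e′ x ≡ point (ιB w)) → ∃[ w ] fun e′ x ≡ point (ιB w)
          lemma x (yes p) = p
          lemma x (no n)  = contradiction (x , n) none
      x₀ = proj₁ outside
      both : ∀ {y} → x₀ ≢ y → InC x₀ × InC y
      both n with given n
      ... | p , q , t , inj₁ (v , w , _ , refl , refl , _) , ep , eq = contradiction (v , ep) (proj₂ outside)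
      ... | p , q , t , inj₂ (v , w , _ , refl , refl , _) , ep , eq = (v , ep) , (w , eq)
      pre : ∀ x → InC x
      pre x with x₀ ≟ x
      ... | no n = proj₂ (both n)
      ... | yes refl = proj₁ (both {proj₁ (off-line P 3<m x₀ x₀)} (λ q → proj₂ (off-line P 3<m x₀ x₀) (inj₁ (sym q))))

-- Countability and unions of chains

-- Cantor's enumeration of ℕ × ℕ along the antidiagonals
unpair : ℕ → ℕ × ℕ
unpair zero    = 0 , 0
unpair (suc n) = next (unpair n)
  where
    next : ℕ × ℕ → ℕ × ℕ
    next (zero  , y) = suc y , zero
    next (suc x , y) = x , suc y

unpair-bound : ∀ n → proj₁ (unpair n) + proj₂ (unpair n) ≤ n
unpair-bound zero    = z≤n
unpair-bound (suc n) with unpair n | unpair-bound n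
... | zero  , y | b = s≤s (subst (_≤ n) (sym (ℕₚ.+-identityʳ y)) b)
... | suc x , y | b = ℕₚ.≤-trans (ℕₚ.≤-reflexive (ℕₚ.+-suc x y)) (ℕₚ.m≤n⇒m≤1+n b)

unpair-surjective : ∀ p → ∃[ n ] unpair n ≡ p
unpair-surjective (x , y) = let n , e = diagonal (x + y) ; m , e′ = down {n} y e in m , trans e′ (cong (x ,_) (ℕₚ.+-identityʳ y))
  where
    down : ∀ {n x} y {z} → unpair n ≡ (x + y , z) → ∃[ m ] unpair m ≡ (x , y + z)
    down {n} {x} zero    {z} e = n , trans e (cong (_, z) (ℕₚ.+-identityʳ x))
    down {n} {x} (suc y) {z} e with down {n} {suc x} y {z} (trans e (cong (_, z) (ℕₚ.+-suc x y)))
    ... | m , e′ = suc m , lemma e′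
      where
        lemma : unpair m ≡ (suc x , y + z) → unpair (suc m) ≡ (x , suc (y + z))
        lemma e rewrite e = refl
    diagonal : ∀ s → ∃[ n ] unpair n ≡ (s , 0)
    diagonal zero = 0 , refl
    diagonal (suc s) with down {proj₁ (diagonal s)} {0} s (proj₂ (diagonal s))
    ... | m , e = suc m , lemma e
      where
        lemma : unpair m ≡ (0 , s + 0) → unpair (suc m) ≡ (suc s , 0)
        lemma e rewrite e = cong (λ t → suc t , 0) (ℕₚ.+-identityʳ s)

record Countable (X : Set) : Set where
  field
    decode     : ℕ → X
    surjective : ∀ x → ∃[ n ] decode n ≡ x

open Countable public

ℕ-countable : Countable ℕ
ℕ-countable = record { decode = id ; surjective = λ n → n , refl }

×-countable : ∀ {X Y} → Countable X → Countable Y → Countable (X × Y)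
×-countable {X} {Y} cX cY = record { decode = d ; surjective = s }
  where
    d : ℕ → X × Y
    d n = decode cX (proj₁ (unpair n)) , decode cY (proj₂ (unpair n))
    s : ∀ p → ∃[ n ] d n ≡ p
    s (x , y) with surjective cX x | surjective cY y
    ... | i , refl | j , refl with unpair-surjective (i , j)
    ...   | n , e = n , cong (λ (i , j) → decode cX i , decode cY j) e

List-countable : ∀ {X} → Countable X → Countable (List X)
List-countable {X} cX = record { decode = d ; surjective = s }
  where
    word : ℕ → ℕ → List X
    word zero    _ = []
    word (suc l) n = decode cX (proj₁ (unpair n)) ∷ word l (proj₂ (unpair n))
    d : ℕ → List X
    d n = word (proj₁ (unpair n)) (proj₂ (unpair n))
    code : ∀ xs → ∃[ l ] ∃[ n ] word l n ≡ xs
    code [] = 0 , 0 , refl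
    code (x ∷ xs) with surjective cX x | code xs
    ... | i , refl | l , j , refl with unpair-surjective (i , j)
    ...   | n , e = suc l , n , cong₂ _∷_ (cong (decode cX ∘ proj₁) e) (cong (word l ∘ proj₂) e)
    s : ∀ xs → ∃[ n ] d n ≡ xs
    s xs with code xs
    ... | l , j , refl with unpair-surjective (l , j)
    ...   | n , e = n , cong (λ (l , j) → word l j) e

bounded : ∀ {n} (f : Fin n → ℕ) → ∃[ k ] ∀ i → f i < k
bounded {zero}  f = 0 , λ ()
bounded {suc n} f with bounded (f ∘ suc)
... | k , b = suc (f zero) ⊔ k , λ { zero → ℕₚ.m≤m⊔n (suc (f zero)) k ; (suc i) → ℕₚ.<-≤-trans (b i) (ℕₚ.m≤n⊔m (suc (f zero)) k) }

record Chain : Set where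
  field
    ord       : ℕ → ℕ
    sys       : ∀ i → Squag (Fin (ord i))
    next      : ∀ i → Emb (sys i) (sys (suc i))
    next-toℕ  : ∀ i a → toℕ (fun (next i) a) ≡ toℕ a
    grow      : ∀ i → ord i < ord (suc i)

module Union (𝓒 : Chain) where
  open Chain 𝓒

  i≤ord : ∀ i → i ≤ ord i
  i≤ord zero    = z≤n
  i≤ord (suc i) = ℕₚ.≤-trans (s≤s (i≤ord i)) (grow i)

  ascend′ : ∀ {i j} → i ≤′ j → Σ (Emb (sys i) (sys j)) λ e → ∀ a → toℕ (fun e a) ≡ toℕ a
  ascend′ ≤′-refl = emb-refl , λ _ → refl
  ascend′ (≤′-step {j} p) with ascend′ p
  ... | e , h = next j ⊙ e , λ a → trans (next-toℕ j _) (h a)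

  ascend : ∀ {i j} → i ≤ j → Emb (sys i) (sys j)
  ascend p = proj₁ (ascend′ (ℕₚ.≤⇒≤′ p))

  ascend-toℕ : ∀ {i j} (p : i ≤ j) a → toℕ (fun (ascend p) a) ≡ toℕ a
  ascend-toℕ p = proj₂ (ascend′ (ℕₚ.≤⇒≤′ p))

  private
    op : ∀ i {x y} → x < ord i → y < ord i → ℕ
    op i p q = toℕ (Squag._∙_ (sys i) (fromℕ< p) (fromℕ< q))

    op-ascend : ∀ {i j} (p : i ≤ j) a b {x y} (u : x < ord j) (v : y < ord j) → toℕ a ≡ x → toℕ b ≡ y →
                toℕ (Squag._∙_ (sys i) a b) ≡ op j u v
    op-ascend {i} {j} p a b u v refl refl = trans (sym (ascend-toℕ p _)) (cong toℕ (trans (hom (ascend p) a b)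
      (cong₂ (Squag._∙_ (sys j)) (toℕ-injective (trans (ascend-toℕ p a) (sym (toℕ-fromℕ< u))))
        (toℕ-injective (trans (ascend-toℕ p b) (sym (toℕ-fromℕ< v)))))))

    op-any : ∀ i j {x y} (u : x < ord i) (v : y < ord i) (u′ : x < ord j) (v′ : y < ord j) → op i u v ≡ op j u′ v′
    op-any i j u v u′ v′ with ℕₚ.≤-total i j
    ... | inj₁ p = op-ascend p (fromℕ< u) (fromℕ< v) u′ v′ (toℕ-fromℕ< u) (toℕ-fromℕ< v)
    ... | inj₂ p = sym (op-ascend p (fromℕ< u′) (fromℕ< v′) u v (toℕ-fromℕ< u′) (toℕ-fromℕ< v′))

    -- Stage i has at least i points by `i≤ord`, so both arguments are present at this stage.
    level : ℕ → ℕ → ℕ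
    level x y = suc (x ⊔ y)

    left< : ∀ x y → x < ord (level x y)
    left< x y = ℕₚ.≤-trans (s≤s (ℕₚ.m≤m⊔n x y)) (i≤ord (level x y))

    right< : ∀ x y → y < ord (level x y)
    right< x y = ℕₚ.≤-trans (s≤s (ℕₚ.m≤n⊔m x y)) (i≤ord (level x y))

    infixl 7 _∙_
    _∙_ : ℕ → ℕ → ℕ
    x ∙ y = op (level x y) (left< x y) (right< x y)

    ∙-toℕ : ∀ i a b → toℕ a ∙ toℕ b ≡ toℕ (Squag._∙_ (sys i) a b)
    ∙-toℕ i a b = trans (op-any (level (toℕ a) (toℕ b)) i (left< (toℕ a) (toℕ b)) (right< (toℕ a) (toℕ b)) (toℕ<n a) (toℕ<n b)) (sym (op-ascend ℕₚ.≤-refl a b (toℕ<n a) (toℕ<n b) refl refl))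

    at : ∀ {i x} → x < ord i → ∃[ a ] toℕ a ≡ x
    at p = fromℕ< p , toℕ-fromℕ< p

  union : Squag ℕ
  union = record
    { _∙_ = _∙_
    ; idem = λ x → go₁ x (at (left< x x))
    ; comm = λ x y → go₂ x y (at (left< x y)) (at (right< x y))
    ; invol = λ x y → go₃ x y (at (left< x y)) (at (right< x y)) }
    where
      go₁ : ∀ x → ∃[ a ] toℕ {ord (level x x)} a ≡ x → x ∙ x ≡ x
      go₁ x (a , p) = lemma (level x x) a p
        where
          lemma : ∀ i (a : Fin (ord i)) {x} → toℕ a ≡ x → x ∙ x ≡ x
          lemma i a refl = trans (∙-toℕ i a a) (cong toℕ (Squag.idem (sys i) a))
      go₂ : ∀ x y → ∃[ a ] toℕ {ord (level x y)} a ≡ x → ∃[ b ] toℕ {ord (level x y)} b ≡ y → x ∙ y ≡ y ∙ x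
      go₂ x y (a , p) (b , q) = lemma (level x y) a b p q
        where
          lemma : ∀ i (a b : Fin (ord i)) {x y} → toℕ a ≡ x → toℕ b ≡ y → x ∙ y ≡ y ∙ x
          lemma i a b refl refl = trans (∙-toℕ i a b) (trans (cong toℕ (Squag.comm (sys i) a b)) (sym (∙-toℕ i b a)))
      go₃ : ∀ x y → ∃[ a ] toℕ {ord (level x y)} a ≡ x → ∃[ b ] toℕ {ord (level x y)} b ≡ y → x ∙ (x ∙ y) ≡ y
      go₃ x y (a , p) (b , q) = lemma (level x y) a b p q
        where
          lemma : ∀ i (a b : Fin (ord i)) {x y} → toℕ a ≡ x → toℕ b ≡ y → x ∙ (x ∙ y) ≡ y
          lemma i a b refl refl = trans (cong (toℕ a ∙_) (∙-toℕ i a b)) (trans (∙-toℕ i a _) (cong toℕ (Squag.invol (sys i) a b)))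

  stage : ∀ i → Emb (sys i) union
  stage i = emb toℕ toℕ-injective (λ a b → sym (∙-toℕ i a b))

  restrict : ∀ {a} {A : Squag (Fin a)} (f : Emb A union) i → (∀ x → fun f x < ord i) →
             Σ (Emb A (sys i)) λ e → ∀ x → toℕ (fun e x) ≡ fun f x
  restrict f i p = emb-factor f (stage i) (λ x → at (p x)) , λ x → toℕ-fromℕ< (p x)

  stage-of : ∀ {a} (f : Fin a → ℕ) → ∃[ k ] ∀ i → k ≤ i → ∀ x → f x < ord i
  stage-of f with bounded f
  ... | k , b = k , λ i k≤i x → ℕₚ.<-≤-trans (b x) (ℕₚ.≤-trans k≤i (i≤ord i))

-- Finite systems as objects: subsystems, renaming, codes

fin : ∀ {n} → Squag (Fin n) → FinSTS
fin {n} Q = finSTS n (toSTS Q)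

sq : (A : FinSTS) → Squag (Fin (order A))
sq A = ofSTS _≟_ (sts A)

sq-represents : ∀ A → Represents (sts A) (sq A)
sq-represents A = ofSTS-represents _≟_ (sts A)

infixr 9 _⊚_
_⊚_ : ∀ {U V W} {R : STS U} {S : STS V} {T : STS W} → Embedding S T → Embedding R S → Embedding R T
(g , g-inj , g-bl) ⊚ (f , f-inj , f-bl) = g ∘ f , f-inj ∘ g-inj , λ x y z →
  mk⇔ (Equivalence.to (g-bl _ _ _) ∘ Equivalence.to (f-bl x y z)) (Equivalence.from (f-bl x y z) ∘ Equivalence.from (g-bl _ _ _))

module Subsystem {n} (Q : Squag (Fin n)) {P : Fin n → Set} (E : Enum P) (closed : Squag.Closed Q P) where
  open Enum E
  private
    module Q = Squag Q
    ix : ∀ i j → ∃[ k ] elem k ≡ elem i Q.∙ elem j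
    ix i j = index _ (closed (sound i) (sound j))

  subsystem : Squag (Fin size)
  subsystem = record
    { _∙_ = λ i j → proj₁ (ix i j)
    ; idem = λ i → elem-inj (trans (proj₂ (ix i i)) (Q.idem _))
    ; comm = λ i j → elem-inj (trans (proj₂ (ix i j)) (trans (Q.comm _ _) (sym (proj₂ (ix j i)))))
    ; invol = λ i j → elem-inj (trans (proj₂ (ix i _)) (trans (cong (elem i Q.∙_) (proj₂ (ix i j))) (Q.invol _ _))) }

  include : Emb subsystem Q
  include = emb elem elem-inj (λ i j → proj₂ (ix i j))

-- R renamed so that the embedded system becomes an initial segment
module Normalise {a d} {A : Squag (Fin a)} {R : Squag (Fin d)} (f : Emb A R) where
  private
    E : Enum (λ x → ¬ (∃[ w ] fun f w ≡ x))
    E = enum (λ x → ¬? (any? (λ w → fun f w ≟ x)))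
    open Enum E

    φ : Fin a ⊎ Fin size → Fin d
    φ = [ fun f , elem ]′

    φ-inj : ∀ {u v} → φ u ≡ φ v → u ≡ v
    φ-inj {inj₁ x} {inj₁ y} e = cong inj₁ (inj f e)
    φ-inj {inj₁ x} {inj₂ k} e = contradiction (x , e) (sound k)
    φ-inj {inj₂ k} {inj₁ x} e = contradiction (x , sym e) (sound k)
    φ-inj {inj₂ k} {inj₂ l} e = cong inj₂ (elem-inj e)

    φ-sur : ∀ x → ∃[ u ] φ u ≡ x
    φ-sur x with any? (λ w → fun f w ≟ x)
    ... | yes (w , e) = inj₁ w , e
    ... | no n = inj₂ (proj₁ (index x n)) , proj₂ (index x n)

    ψ : Fin (a + size) ↔ Fin d
    ψ = bijection (φ ∘ splitAt a) (λ e → ↔-injective (+↔⊎ {a} {size}) (φ-inj e))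
          (λ x → Inverse.from +↔⊎ (proj₁ (φ-sur x)) , trans (cong φ (Inverse.strictlyInverseˡ (+↔⊎ {a} {size}) (proj₁ (φ-sur x)))) (proj₂ (φ-sur x)))

  extra : ℕ
  extra = size

  normal : Squag (Fin (a + extra))
  normal = transport (↔-sym ψ) R

  to-normal : Emb R normal
  to-normal = transport-to (↔-sym ψ) R

  from-normal : Emb normal R
  from-normal = transport-from (↔-sym ψ) R

  to-normal-toℕ : ∀ x → toℕ (fun to-normal (fun f x)) ≡ toℕ x
  to-normal-toℕ x = trans (cong toℕ (inj from-normal (trans (Inverse.strictlyInverseˡ ψ _) (sym (cong φ (splitAt-↑ˡ a x size)))))) (toℕ-↑ˡ x size)

  extra>0 : ∀ x → ¬ (∃[ w ] fun f w ≡ x) → 0 < extra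
  extra>0 x n = ℕₚ.≤-<-trans z≤n (toℕ<n (proj₁ (index x n)))

tabulate-inj : ∀ {X : Set} {n} {f g : Fin n → X} → tabulate f ≡ tabulate g → ∀ i → f i ≡ g i
tabulate-inj e zero    = Listₚ.∷-injectiveˡ e
tabulate-inj e (suc i) = tabulate-inj (Listₚ.∷-injectiveʳ e) i

-- Order and table determine the system and live in a countable type; this yields countably many
-- isomorphism types.
table : ∀ {n} → Squag (Fin n) → List (List ℕ)
table Q = tabulate λ i → tabulate λ j → toℕ (Squag._∙_ Q i j)

same-table : ∀ {m n} (Q : Squag (Fin m)) (R : Squag (Fin n)) → (m , table Q) ≡ (n , table R) →
             Σ (Emb Q R) λ e → ∀ y → ∃[ x ] fun e x ≡ y
same-table Q R e = go Q R (cong proj₁ e) (cong proj₂ e)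
  where
    go : ∀ {m n} (Q : Squag (Fin m)) (R : Squag (Fin n)) → m ≡ n → table Q ≡ table R → Σ (Emb Q R) λ e → ∀ y → ∃[ x ] fun e x ≡ y
    go Q R refl t = emb id id (λ x y → toℕ-injective (tabulate-inj (tabulate-inj t x) y)) , λ y → y , refl

∅ : Squag (Fin 0)
∅ = record { _∙_ = λ () ; idem = λ () ; comm = λ () ; invol = λ () }

∅-emb : ∀ {V} {Q : Squag V} → Emb ∅ Q
∅-emb = emb (λ ()) (λ { {()} }) (λ ())

singleton : Squag (Fin 1)
singleton = record { _∙_ = λ _ _ → zero ; idem = λ { zero → refl } ; comm = λ _ _ → refl ; invol = λ { zero zero → refl } }

-- Because of `meet`, amalgamating with a singleton over the empty system adds a genuinely new
-- point.
record StrongAmalgam (K : FinSTS → Set₁) {a b c} {A : Squag (Fin a)} {B : Squag (Fin b)} {C : Squag (Fin c)}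
                     (f : Emb A B) (g : Emb A C) : Set₁ where
  field
    {size}   : ℕ
    system   : Squag (Fin size)
    member   : K (fin system)
    left     : Emb B system
    right    : Emb C system
    commutes : ∀ w → fun left (fun f w) ≡ fun right (fun g w)
    meet     : ∀ {x z} → fun left x ≡ fun right z → ∃[ w ] (fun f w ≡ x × fun g w ≡ z)

lower : ExcludedMiddle (lsuc 0ℓ) → ExcludedMiddle 0ℓ
lower em {P} with em {Level.Lift (lsuc 0ℓ) P}
... | yes (Level.lift p) = yes p
... | no n = no (n ∘ Level.lift)

module Hereditary (K : FinSTS → Set₁) (K-hereditary : ∀ {A C} → K A → C ↪ A → K C) where
  K-sub : ∀ {a b} {A : Squag (Fin a)} {B : Squag (Fin b)} → K (fin B) → Emb A B → K (fin A)
  K-sub {A = A} {B} k e = K-hereditary {fin B} {fin A} k (fromEmb {S = toSTS A} {T = toSTS B} (toSTS-represents A) (toSTS-represents B) e)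

  K-sq : ∀ {A} → K A → K (fin (sq A))
  K-sq {A} k = K-hereditary {A} {fin (sq A)} k (fromEmb {S = toSTS (sq A)} {T = sts A} (toSTS-represents (sq A)) (sq-represents A) (emb-refl {Q = sq A}))

-- The limit: homogeneity, local finiteness and age

module Limit (em : ExcludedMiddle 0ℓ) (K : FinSTS → Set₁)
             (K-hereditary : ∀ {A C} → K A → C ↪ A → K C) (𝓒 : Chain)
             (sys-member : ∀ i → K (fin (Chain.sys 𝓒 i)))
             (extension : ∀ {a b} {A : Squag (Fin a)} {B : Squag (Fin b)} → K (fin B) → (f : Emb A B) (g : Emb A (Union.union 𝓒)) →
                          Σ (Emb B (Union.union 𝓒)) λ h → ∀ x → fun h (fun f x) ≡ fun g x) where

  open Hereditary K K-hereditary
  open Union 𝓒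
  open Chain 𝓒 using (ord; sys; grow)

  limit : STS ℕ
  limit = toSTS union

  private
    module U = Squag union

  -- Back and forth: a finite partial isomorphism of the limit is a system with two embeddings.
  record Span : Set where
    constructor span
    field
      {size}  : ℕ
      shape   : Squag (Fin size)
      dom cod : Emb shape union

  record _⊑_ (s t : Span) : Set where
    private
      module s = Span s
      module t = Span t
    field
      up     : Fin s.size → Fin t.size
      up-dom : ∀ x → fun t.dom (up x) ≡ fun s.dom x
      up-cod : ∀ x → fun t.cod (up x) ≡ fun s.cod x

  open _⊑_

  private
    ⊑-refl : ∀ {s} → s ⊑ s
    ⊑-refl = record { up = id ; up-dom = λ _ → refl ; up-cod = λ _ → refl }

    ⊑-trans : ∀ {s t u} → s ⊑ t → t ⊑ u → s ⊑ u
    ⊑-trans p q = record { up = up q ∘ up p ; up-dom = λ x → trans (up-dom q _) (up-dom p x) ; up-cod = λ x → trans (up-cod q _) (up-cod p x) }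

    converse : Span → Span
    converse (span A p q) = span A q p

    ⊑-converse : ∀ {s t} → s ⊑ t → converse s ⊑ converse t
    ⊑-converse p = record { up = up p ; up-dom = up-cod p ; up-cod = up-dom p }

    record Forth (s : Span) (x : ℕ) : Set where
      field
        {result} : Span
        above    : s ⊑ result
        point    : Fin (Span.size result)
        hits     : fun (Span.dom result) point ≡ x

    record Both (s : Span) (x : ℕ) : Set where
      field
        {result} : Span
        above    : s ⊑ result
        source   : Fin (Span.size result)
        source≡  : fun (Span.dom result) source ≡ x
        target   : Fin (Span.size result)
        target≡  : fun (Span.cod result) target ≡ x

    abstract
      -- The domain is enlarged to an entire stage that contains `x` and the old domain; `extension`
      -- supplies the map on it.
      forth : ∀ s x → Forth s x
      forth (span {n} A p q) x = record
        { result = span (sys i) (stage i) (proj₁ ext)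
        ; above = record { up = fun (proj₁ r) ; up-dom = proj₂ r ; up-cod = proj₂ ext }
        ; point = fromℕ< x<i ; hits = toℕ-fromℕ< x<i }
        where
          k i : ℕ
          k = proj₁ (stage-of (fun p))
          i = k ⊔ suc x
          x<i : x < ord i
          x<i = ℕₚ.≤-trans (ℕₚ.m≤n⊔m k (suc x)) (i≤ord i)
          r : Σ (Emb A (sys i)) λ e → ∀ y → toℕ (fun e y) ≡ fun p y
          r = restrict p i (proj₂ (stage-of (fun p)) i (ℕₚ.m≤m⊔n k (suc x)))
          ext : Σ (Emb (sys i) union) λ h → ∀ y → fun h (fun (proj₁ r) y) ≡ fun q y
          ext = extension {A = A} {B = sys i} (sys-member i) (proj₁ r) q

      both : ∀ s x → Both s x
      both s x = record
        { result = converse B.result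
        ; above = ⊑-trans A.above (⊑-converse B.above)
        ; source = up B.above A.point ; source≡ = trans (up-cod B.above A.point) A.hits
        ; target = B.point ; target≡ = B.hits }
        where
          module A = Forth (forth s x)
          module B = Forth (forth (converse A.result) x)

    module BackForth (s₀ : Span) where
      state : ℕ → Span
      state zero    = s₀
      state (suc i) = Both.result (both (state i) i)

      mono′ : ∀ {i j} → i ≤′ j → state i ⊑ state j
      mono′ ≤′-refl = ⊑-refl
      mono′ (≤′-step {j} p) = ⊑-trans (mono′ p) (Both.above (both (state j) j))

      mono : ∀ {i j} → i ≤ j → state i ⊑ state j
      mono = mono′ ∘ ℕₚ.≤⇒≤′

      dom cod : ∀ i → Fin (Span.size (state i)) → ℕ
      dom i = fun (Span.dom (state i))
      cod i = fun (Span.cod (state i))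

      source : ∀ x → ∃[ a ] dom (suc x) a ≡ x
      source x = Both.source (both (state x) x) , Both.source≡ (both (state x) x)

      target : ∀ y → ∃[ a ] cod (suc y) a ≡ y
      target y = Both.target (both (state y) y) , Both.target≡ (both (state y) y)

      σ : ℕ → ℕ
      σ x = cod (suc x) (proj₁ (source x))

      -- Both points are moved to a common later span, whose `dom` is injective. This makes `σ`
      -- independent of the stage at which it is computed.
      compare : ∀ i j {a b} → dom i a ≡ dom j b → cod i a ≡ cod j b
      compare i j {a} {b} e = trans (sym (up-cod i≤ a)) (trans (cong (cod (i ⊔ j)) (inj (Span.dom (state (i ⊔ j)))
          (trans (up-dom i≤ a) (trans e (sym (up-dom j≤ b)))))) (up-cod j≤ b))
        where
          i≤ = mono (ℕₚ.m≤m⊔n i j)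
          j≤ = mono (ℕₚ.m≤n⊔m i j)

      σ-dom : ∀ i a → σ (dom i a) ≡ cod i a
      σ-dom i a = compare _ i (proj₂ (source (dom i a)))

      common : ∀ x y → ∃[ i ] ∃[ a ] ∃[ b ] (dom i a ≡ x × dom i b ≡ y)
      common x y = suc x ⊔ suc y , up x≤ (proj₁ (source x)) , up y≤ (proj₁ (source y)) ,
          trans (up-dom x≤ _) (proj₂ (source x)) , trans (up-dom y≤ _) (proj₂ (source y))
        where
          x≤ = mono (ℕₚ.m≤m⊔n (suc x) (suc y))
          y≤ = mono (ℕₚ.m≤n⊔m (suc x) (suc y))

      automorphism : Emb union union
      automorphism = emb σ σ-inj σ-hom
        where
          σ-inj : ∀ {x y} → σ x ≡ σ y → x ≡ y
          σ-inj {x} {y} e with common x y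
          ... | i , a , b , refl , refl = cong (dom i) (inj (Span.cod (state i)) (trans (sym (σ-dom i a)) (trans e (σ-dom i b))))
          σ-hom : ∀ x y → σ (x U.∙ y) ≡ σ x U.∙ σ y
          σ-hom x y with common x y
          ... | i , a , b , refl , refl = trans (cong σ (sym (hom (Span.dom (state i)) a b))) (trans (σ-dom i _)
                  (trans (hom (Span.cod (state i)) a b) (sym (cong₂ U._∙_ (σ-dom i a) (σ-dom i b)))))

      onto : ∀ y → ∃[ x ] σ x ≡ y
      onto y = dom (suc y) (proj₁ (target y)) , trans (σ-dom (suc y) _) (proj₂ (target y))

      extends : ∀ a → σ (fun (Span.dom s₀) a) ≡ fun (Span.cod s₀) a
      extends = σ-dom 0

    closed-∙ : ∀ {S : ℕ → Set} → IsSubsystem limit S → U.Closed S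
    closed-∙ {S} sub {x} {y} sx sy with x ℕₚ.≟ y
    ... | yes refl = subst S (sym (U.idem x)) sx
    ... | no n     = sub sx sy (n , refl)

    initial-subsystem : ∀ i → IsSubsystem limit (_< ord i)
    initial-subsystem i p q (_ , refl) = subst (_< ord i) e (toℕ<n _)
      where
        e = trans (hom (stage i) (fromℕ< p) (fromℕ< q)) (cong₂ U._∙_ (toℕ-fromℕ< p) (toℕ-fromℕ< q))

    list-bound : (xs : List ℕ) → ∃[ i ] ∀ x → x ∈ xs → x < ord i
    list-bound [] = 0 , λ _ ()
    list-bound (y ∷ xs) = let i , b = list-bound xs in suc y ⊔ i , λ
      { x (here refl) → ℕₚ.≤-trans (ℕₚ.m≤m⊔n (suc y) i) (i≤ord (suc y ⊔ i))
      ; x (there m) → ℕₚ.<-≤-trans (b x m) (ord-mono (ℕₚ.m≤n⊔m (suc y) i)) }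
      where
        ord-mono : ∀ {i j} → i ≤ j → ord i ≤ ord j
        ord-mono p = injective⇒≤ {f = fun (ascend p)} (inj (ascend p))

    -- Minimality of a generated subsystem, applied to an initial segment containing the generators,
    -- bounds it; it can then be enumerated by excluded middle.
    module Generated (S : ℕ → Set) (fg : FinitelyGenerated limit S) where
      xs = proj₁ fg
      sub = proj₁ (proj₂ fg)
      i = proj₁ (list-bound xs)
      bound : ∀ x → S x → x < ord i
      bound x sx = proj₂ (proj₂ (proj₂ fg)) (_< ord i) (initial-subsystem i) (proj₂ (list-bound xs)) x sx
      E : Enum (λ a → S (toℕ {ord i} a))
      E = enum (λ a → em)
      closed : Squag.Closed (sys i) (λ a → S (toℕ a))
      closed {a} {b} p q = subst S (sym (hom (stage i) a b)) (closed-∙ sub p q)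
      open Subsystem (sys i) E closed public
      place : Emb subsystem union
      place = stage i ⊙ include
      place∈ : ∀ a → S (fun place a)
      place∈ = Enum.sound E
      place-onto : ∀ x → S x → ∃[ a ] fun place a ≡ x
      place-onto x sx = let a , e = Enum.index E (fromℕ< (bound x sx)) (subst S (sym (toℕ-fromℕ< (bound x sx))) sx) in
        a , trans (cong toℕ e) (toℕ-fromℕ< (bound x sx))

  homogeneous : Homogeneous limit
  homogeneous S T φ fgS _ (_ , φ-inj , _ , φ-block) =
      σ , (proj₂ (fromEmb {S = limit} {T = limit} {Q = union} {R = union} (toSTS-represents union) (toSTS-represents union) automorphism) , onto) , ext
    where
      open Generated S fgS
      q-hom : ∀ a b → φ (fun place (Squag._∙_ subsystem a b)) ≡ φ (fun place a) U.∙ φ (fun place b)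
      q-hom a b with a ≟ b
      ... | yes refl = trans (cong (φ ∘ fun place) (Squag.idem subsystem a)) (sym (U.idem (φ (fun place a))))
      ... | no n = sym (proj₂ (Equivalence.to
                     (φ-block (fun place a) (fun place b) (fun place (Squag._∙_ subsystem a b)) (place∈ a) (place∈ b) (place∈ (Squag._∙_ subsystem a b)))
                     ((n ∘ inj place) , sym (hom place a b))))
      q : Emb subsystem union
      q = emb (φ ∘ fun place) (λ {a} {b} e → inj place (φ-inj (fun place a) (fun place b) (place∈ a) (place∈ b) e)) q-hom
      open BackForth (span subsystem place q)
      ext : ∀ x → S x → σ x ≡ φ x
      ext x sx = trans (cong σ (sym (proj₂ (place-onto x sx)))) (trans (extends (proj₁ (place-onto x sx))) (cong φ (proj₂ (place-onto x sx))))

  locallyFinite : LocallyFinite limit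
  locallyFinite xs = let i , b = list-bound xs in
    (_< ord i) , initial-subsystem i , b , upTo (ord i) , λ x p → ∈-upTo⁺ p

  hasAge : HasAge limit K
  hasAge = (λ S fg → let open Generated S fg in
             fin subsystem , K-sub {A = subsystem} {B = sys i} (sys-member i) include ,
             fromEmb {S = toSTS subsystem} {T = limit} {Q = subsystem} {R = union} (toSTS-represents subsystem) (toSTS-represents union) place , place∈ , place-onto)
         -- Embedding a member is the extension problem over the empty system.
         , λ A k → fromEmb {S = sts A} {T = limit} {Q = sq A} {R = union} (sq-represents A) (toSTS-represents union)
                     (proj₁ (extension {A = ∅} {B = sq A} (K-sq {A} k) ∅-emb ∅-emb))

  infinitelyMany : InfinitelyManyNonIso K
  infinitelyMany = (λ i → fin (sys i)) , sys-member , λ i j n iso → n (distinct i j (ℕₚ.≤-antisym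
      (injective⇒≤ {f = proj₁ iso} (proj₁ (proj₁ (proj₂ iso)))) (injective⇒≤ {f = back iso} (back-inj iso))))
    where
      module _ {i j} (iso : fin (sys i) ≅ fin (sys j)) where
        back : Fin (ord j) → Fin (ord i)
        back y = proj₁ (proj₂ (proj₂ iso) y)
        back-inj : ∀ {x y} → back x ≡ back y → x ≡ y
        back-inj {x} {y} e = trans (sym (proj₂ (proj₂ (proj₂ iso) x))) (trans (cong (proj₁ iso) e) (proj₂ (proj₂ (proj₂ iso) y)))
      strict : ∀ {i j} → i < j → ord i < ord j
      strict {i} {j} p = ℕₚ.<-≤-trans (grow i) (injective⇒≤ {f = fun (ascend p)} (inj (ascend p)))
      distinct : ∀ i j → ord i ≡ ord j → i ≡ j
      distinct i j e with ℕₚ.<-cmp i j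
      ... | tri≈ _ p _ = p
      ... | tri< p _ _ = contradiction e (ℕₚ.<⇒≢ (strict p))
      ... | tri> _ _ p = contradiction (sym e) (ℕₚ.<⇒≢ (strict p))

-- Construction of a chain that solves every extension problem

module Fraïssé (em₁ : ExcludedMiddle (lsuc 0ℓ)) (K : FinSTS → Set₁)
               (K-hereditary : ∀ {A C} → K A → C ↪ A → K C)
               (K-small : ∀ {n} (Q : Squag (Fin n)) → n ≤ 1 → K (fin Q))
               (amalgamate : ∀ {a b c} {A : Squag (Fin a)} {B : Squag (Fin b)} {C : Squag (Fin c)} →
                             K (fin B) → K (fin C) → (f : Emb A B) (g : Emb A C) → StrongAmalgam K f g) where

  em : ExcludedMiddle 0ℓ
  em = lower em₁

  open Hereditary K K-hereditary

  record KSys : Set₁ where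
    constructor ksys
    field
      {size} : ℕ
      system : Squag (Fin size)
      member : K (fin system)

  open KSys

  private
    Code : Set
    Code = ℕ × List (List ℕ)

    code : ∀ {n} → Squag (Fin n) → Code
    code {n} Q = n , table Q

    codes : Countable Code
    codes = ×-countable ℕ-countable (List-countable (List-countable ℕ-countable))

    Coded : Code → Set₁
    Coded c = Σ KSys λ S → code (system S) ≡ c

    -- Codes of no member are sent to the empty system, which keeps the enumeration total.
    pick : ∀ {c} → Dec (Coded c) → KSys
    pick (yes (S , _)) = S
    pick (no _)        = ksys ∅ (K-small ∅ z≤n)

    pick-code : ∀ {c} (d : Dec (Coded c)) → Coded c → code (system (pick d)) ≡ c
    pick-code (yes (_ , e)) _ = e
    pick-code (no n)        c = contradiction c n

  abstract
    enumeration : ℕ → KSys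
    enumeration i = pick (em₁ {Coded (decode codes i)})

    enumerated : ∀ {n} (Q : Squag (Fin n)) → K (fin Q) →
                 ∃[ i ] Σ (Emb Q (system (enumeration i))) λ e → ∀ y → ∃[ x ] fun e x ≡ y
    enumerated {n} Q k = let i , e = surjective codes (code Q) in
      i , same-table Q _ (sym (trans (pick-code (em₁ {Coded (decode codes i)}) (ksys Q k , sym e)) e))

  -- A task (b , l) asks for the b-th system to be mapped into the chain, extending the finite map with graph l.
  Task : Set
  Task = ℕ × List (ℕ × ℕ)

  tasks : Countable Task
  tasks = ×-countable ℕ-countable (List-countable (×-countable ℕ-countable ℕ-countable))

  graph : ∀ {a b c} → (Fin a → Fin b) → (Fin a → Fin c) → List (ℕ × ℕ)
  graph f g = tabulate λ i → toℕ (f i) , toℕ (g i)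

  -- Tasks are plain data and hence countable. Whether the list is the graph of two embeddings of a
  -- common system is decided only when the task comes up.
  Valid : KSys → Task → Set
  Valid M (b , l) = ∃[ a ] Σ (Squag (Fin a)) λ A → Σ (Emb A (system (enumeration b))) λ f →
                    Σ (Emb A (system M)) λ g → graph (fun f) (fun g) ≡ l

  record Step (M : KSys) (t : Task) : Set₁ where
    field
      result  : KSys
      next    : Emb (system M) (system result)
      next-ℕ  : ∀ x → toℕ (fun next x) ≡ toℕ x
      larger  : size M < size result
      realise : Valid M t → Σ (Emb (system (enumeration (proj₁ t))) (system result)) λ h →
                ∀ x (y : Fin (size M)) → (toℕ x , toℕ y) ∈ proj₂ t → toℕ (fun h x) ≡ toℕ y

  private
    record Half (M : KSys) (t : Task) : Set₁ where
      field
        result  : KSys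
        next    : Emb (system M) (system result)
        realise : Valid M t → Σ (Emb (system (enumeration (proj₁ t))) (system result)) λ h →
                  ∀ x y → (toℕ x , toℕ y) ∈ proj₂ t → fun h x ≡ fun next y

    half : ∀ M t → Half M t
    half M (b , l) with em {Valid M (b , l)}
    ... | no n = record { result = M ; next = emb-refl ; realise = λ v → contradiction v n }
    ... | yes (a , A , f , g , e) = record
          { result = ksys (StrongAmalgam.system S) (StrongAmalgam.member S)
          ; next = left
          ; realise = λ _ → right , λ x y m → let i , p = ∈-tabulate⁻ (subst ((toℕ x , toℕ y) ∈_) (sym e) m) in
              trans (cong (fun right) (toℕ-injective (cong proj₁ p))) (trans (sym (commutes i)) (cong (fun left) (sym (toℕ-injective (cong proj₂ p))))) }
      where
        S = amalgamate {B = system M} {C = system (enumeration b)} (member M) (member (enumeration b)) g f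
        open StrongAmalgam S using (left; right; commutes)

  abstract
    -- After the task is met by amalgamation a point is adjoined, so the chain grows strictly even
    -- at an invalid task. Normalising makes the old stage an initial segment again.
    step : ∀ M t → Step M t
    step M t = record
        { result = ksys normal (K-sub {A = normal} {B = StrongAmalgam.system S} (StrongAmalgam.member S) from-normal)
        ; next = to-normal ⊙ f
        ; next-ℕ = to-normal-toℕ
        ; larger = ℕₚ.<-≤-trans (ℕₚ.≤-reflexive (ℕₚ.+-comm 1 (size M))) (ℕₚ.+-monoʳ-≤ (size M) (extra>0 (fun right zero) new))
        ; realise = λ v → let h , p = Half.realise H v in to-normal ⊙ (left ⊙ h) , λ x y m →
            trans (cong (λ z → toℕ (fun to-normal (fun left z))) (p x y m)) (to-normal-toℕ y) }
      where
        H : Half M t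
        H = half M t
        S : StrongAmalgam K (∅-emb {Q = system (Half.result H)}) (∅-emb {Q = singleton})
        S = amalgamate {B = system (Half.result H)} {C = singleton} (member (Half.result H)) (K-small singleton (s≤s z≤n)) ∅-emb ∅-emb
        open StrongAmalgam S using (left; right; meet)
        f : Emb (system M) (StrongAmalgam.system S)
        f = left ⊙ Half.next H
        open Normalise f
        new : ¬ (∃[ w ] fun f w ≡ fun right zero)
        new (w , e) with meet {fun (Half.next H) w} {zero} e
        ... | () , _

  private
    -- Discarding the first coordinate of `unpair i` makes every task recur beyond every stage.
    task : ℕ → Task
    task i = decode tasks (proj₂ (unpair i))

    build : ℕ → KSys
    build zero    = ksys ∅ (K-small ∅ z≤n)
    build (suc i) = Step.result (step (build i) (task i))

  chain : Chain
  chain = record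
    { ord = λ i → size (build i) ; sys = λ i → system (build i)
    ; next = λ i → Step.next (step (build i) (task i)) ; next-toℕ = λ i → Step.next-ℕ (step (build i) (task i))
    ; grow = λ i → Step.larger (step (build i) (task i)) }

  open Union chain
  open Chain chain using (ord)

  sys-member : ∀ i → K (fin (Chain.sys chain i))
  sys-member i = member (build i)

  extension : ∀ {a b} {A : Squag (Fin a)} {B : Squag (Fin b)} → K (fin B) → (f : Emb A B) (g : Emb A union) →
              Σ (Emb B union) λ h → ∀ x → fun h (fun f x) ≡ fun g x
  extension {A = A} {B} kB f g = stage (suc i) ⊙ (h ⊙ κ) , λ x →
      trans (h-graph (fun κ (fun f x)) (fun gᵢ x) (subst ((toℕ (fun κ (fun f x)) , toℕ (fun gᵢ x)) ∈_) l≡ (∈-tabulate⁺ {f = λ x → toℕ (fun κ (fun f x)) , toℕ (fun gᵢ x)} x))) (gᵢ-ℕ x)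
    where
      b₀ = proj₁ (enumerated B kB)
      κ = proj₁ (proj₂ (enumerated B kB))
      j₀ = proj₁ (stage-of (fun g))
      l : List (ℕ × ℕ)
      l = tabulate λ x → toℕ (fun κ (fun f x)) , fun g x
      t = surjective tasks (b₀ , l)
      ui = unpair-surjective (j₀ , proj₁ t)
      -- A stage at which the desired task comes up and which, by `unpair-bound`, already contains
      -- the image of `g`.
      i = proj₁ ui
      j₀≤i : j₀ ≤ i
      j₀≤i = ℕₚ.≤-trans (ℕₚ.m≤m+n j₀ (proj₁ t)) (subst (λ p → proj₁ p + proj₂ p ≤ i) (proj₂ ui) (unpair-bound i))
      gr = restrict g i (proj₂ (stage-of (fun g)) i j₀≤i)
      gᵢ = proj₁ gr
      gᵢ-ℕ = proj₂ gr
      l≡ : graph (fun κ ∘ fun f) (fun gᵢ) ≡ l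
      l≡ = Listₚ.tabulate-cong λ x → cong (toℕ (fun κ (fun f x)) ,_) (gᵢ-ℕ x)
      taskᵢ : task i ≡ (b₀ , l)
      taskᵢ = trans (cong (decode tasks ∘ proj₂) (proj₂ ui)) (proj₂ t)
      real : ∀ {t} → t ≡ (b₀ , l) → (R : Step (build i) t) → Σ (Emb (system (enumeration b₀)) (system (Step.result R))) λ h →
             ∀ x (y : Fin (ord i)) → (toℕ x , toℕ y) ∈ l → toℕ (fun h x) ≡ toℕ y
      real refl R = Step.realise R (_ , A , κ ⊙ f , gᵢ , l≡)
      h = proj₁ (real taskᵢ (step (build i) (task i)))
      h-graph = proj₂ (real taskᵢ (step (build i) (task i)))

  private
    to : ∀ {A B} → A ↪ B → Emb (sq A) (sq B)
    to {A} {B} = toEmb {S = sts A} {T = sts B} {Q = sq A} {R = sq B} (sq-represents A) (sq-represents B) _≟_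

    out : ∀ {A n} {Q : Squag (Fin n)} → Emb (sq A) Q → A ↪ fin Q
    out {A} {Q = Q} = fromEmb {S = sts A} {T = toSTS Q} (sq-represents A) (toSTS-represents Q)

  amalgamationClass : AmalgamationClass K
  amalgamationClass = record
    { nonempty = fin ∅ , K-small ∅ z≤n
    ; countable = (λ i → fin (system (enumeration i))) , (λ i → member (enumeration i)) , λ A k →
        let i , e , s = enumerated (sq A) (K-sq {A} k) in i , fun e , (proj₂ (out {A} e) , s)
    ; hereditary = λ A C k f → C , K-hereditary {A} {C} k f , id ,
        ((id , λ _ _ _ → mk⇔ id id) , λ w → w , refl)
    -- Joint embedding is amalgamation over the empty system.
    ; jointEmbed = λ A B kA kB → let open StrongAmalgam (amalgamate {B = sq A} {C = sq B} (K-sq {A} kA) (K-sq {B} kB) (∅-emb {Q = sq A}) (∅-emb {Q = sq B})) renaming (system to D; member to kD) in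
        fin D , kD , out {A} left , out {B} right
    ; amalgamation = λ A B C kA kB kC f g → let open StrongAmalgam (amalgamate {B = sq B} {C = sq C} (K-sq {B} kB) (K-sq {C} kC) (to {A} {B} f) (to {A} {C} g)) renaming (system to D; member to kD) in
        fin D , kD , out {B} left , out {C} right , commutes }

-- Good classes and the conclusion

-- Order 2 is impossible, and the orders 0, 1 and 3 give the empty system, a point and a block,
-- which every system of order above 3 contains.
trivial-embeds : ∀ {g c} (G : Squag (Fin g)) (C : Squag (Fin c)) → g ≤ 3 → 3 < c → Emb G C
trivial-embeds {0} G C _ _ = emb (λ ()) (λ { {()} }) (λ ())
trivial-embeds {1} {suc c} G C _ _ = emb (λ _ → zero) (λ { {zero} {zero} _ → refl }) (λ _ _ → sym (Squag.idem C zero))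
trivial-embeds {2} G C _ _ = ⊥-elim (go (zero G.∙ suc zero) refl)
  where
    module G = Squag G
    go : ∀ z → zero G.∙ suc zero ≡ z → ⊥
    go zero       e = G.∙≢ˡ {zero} {suc zero} (λ ()) e
    go (suc zero) e = G.∙≢ʳ {zero} {suc zero} (λ ()) e
trivial-embeds {3} {suc c} G C _ 3<c = emb f f-inj f-hom
  where
    module G = Squag G
    module C = Squag C
    a b : Fin (suc c)
    a = zero
    b = proj₁ (off-line C 3<c a a)
    a≢b : a ≢ b
    a≢b e = proj₂ (off-line C 3<c a a) (inj₁ (sym e))
    f : Fin 3 → Fin (suc c)
    f zero             = a
    f (suc zero)       = b
    f (suc (suc zero)) = a C.∙ b
    f-inj : ∀ {x y} → f x ≡ f y → x ≡ y
    f-inj {zero}           {zero}           _ = refl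
    f-inj {suc zero}       {suc zero}       _ = refl
    f-inj {suc (suc zero)} {suc (suc zero)} _ = refl
    f-inj {zero}           {suc zero}       e = contradiction e a≢b
    f-inj {suc zero}       {zero}           e = contradiction (sym e) a≢b
    f-inj {zero}           {suc (suc zero)} e = contradiction (sym e) (C.∙≢ˡ a≢b)
    f-inj {suc (suc zero)} {zero}           e = contradiction e (C.∙≢ˡ a≢b)
    f-inj {suc zero}       {suc (suc zero)} e = contradiction (sym e) (C.∙≢ʳ a≢b)
    f-inj {suc (suc zero)} {suc zero}       e = contradiction e (C.∙≢ʳ a≢b)
    third : zero G.∙ suc zero ≡ suc (suc zero)
    third = go (zero G.∙ suc zero) refl
      where
        go : ∀ z → zero G.∙ suc zero ≡ z → zero G.∙ suc zero ≡ suc (suc zero)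
        go zero             e = contradiction e (G.∙≢ˡ {zero} {suc zero} (λ ()))
        go (suc zero)       e = contradiction e (G.∙≢ʳ {zero} {suc zero} (λ ()))
        go (suc (suc zero)) e = e
    02≡1 : zero G.∙ suc (suc zero) ≡ suc zero
    02≡1 = trans (cong (zero G.∙_) (sym third)) (G.invol _ _)
    12≡0 : suc zero G.∙ suc (suc zero) ≡ zero
    12≡0 = trans (cong (suc zero G.∙_) (trans (sym third) (G.comm _ _))) (G.invol _ _)
    a∙c : a C.∙ (a C.∙ b) ≡ b
    a∙c = C.invol a b
    b∙c : b C.∙ (a C.∙ b) ≡ a
    b∙c = trans (cong (b C.∙_) (C.comm a b)) (C.invol b a)
    f-hom : ∀ x y → f (x G.∙ y) ≡ f x C.∙ f y
    f-hom zero             zero             = trans (cong f (G.idem _)) (sym (C.idem _))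
    f-hom (suc zero)       (suc zero)       = trans (cong f (G.idem _)) (sym (C.idem _))
    f-hom (suc (suc zero)) (suc (suc zero)) = trans (cong f (G.idem _)) (sym (C.idem _))
    f-hom zero             (suc zero)       = cong f third
    f-hom (suc zero)       zero             = trans (cong f (trans (G.comm _ _) third)) (C.comm a b)
    f-hom zero             (suc (suc zero)) = trans (cong f 02≡1) (sym a∙c)
    f-hom (suc (suc zero)) zero             = trans (cong f (trans (G.comm _ _) 02≡1)) (trans (sym a∙c) (C.comm _ _))
    f-hom (suc zero)       (suc (suc zero)) = trans (cong f 12≡0) (sym b∙c)
    f-hom (suc (suc zero)) (suc zero)       = trans (cong f (trans (G.comm _ _) 12≡0)) (trans (sym b∙c) (C.comm _ _))
trivial-embeds {suc (suc (suc (suc g)))} G C (s≤s (s≤s (s≤s ()))) _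

-- A witness of order at most 3 forces F to be empty; then the Fano plane is one.
nontrivial-witness : ExcludedMiddle 0ℓ → (F : FinSTS → Set) → (∀ C → F C → Nontrivial C) → Good F →
                     ∃[ g ] Σ (Squag (Fin g)) λ G → 3 < g × Free F (fin G) × (∀ C → F C → ¬ Emb G (sq C))
nontrivial-witness em F nt (G , free , avoid) with 3 <? order G
... | yes 3<g = order G , sq G , 3<g
    , (λ C fC e → free C fC (_⊚_ {R = sts C} {S = toSTS (sq G)} {T = sts G} to-G e))
    , (λ C fC e → avoid C fC (fromEmb {S = sts G} {T = sts C} {Q = sq G} {R = sq C} (sq-represents G) (sq-represents C) e))
  where
    to-G : Embedding (toSTS (sq G)) (sts G)
    to-G = fromEmb {S = toSTS (sq G)} {T = sts G} {Q = sq G} {R = sq G} (toSTS-represents (sq G)) (sq-represents G) emb-refl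
... | no 3≮g = proj₁ (proj-↔ 3) , transport (proj₂ (proj-↔ 3)) host , from-yes (3 <? proj₁ (proj-↔ 3))
    , (λ C fC _ → empty C fC) , (λ C fC _ → empty C fC)
  where
    -- With no blocks nothing is traded, so the host on three points is the plain projective plane
    -- over 𝔽₂.
    no-blocks : Partial (Fin 3)
    no-blocks = record { Bl = λ _ _ _ → ⊥ ; distinct = λ () ; swap₁₂ = λ () ; swap₂₃ = λ () ; unique = λ () }
    open Embedding em no-blocks
    empty : ∀ C → ¬ F C
    empty C fC = avoid C fC (fromEmb {S = sts G} {T = sts C} {Q = sq G} {R = sq C} (sq-represents G) (sq-represents C)
                   (trivial-embeds (sq G) (sq C) (ℕₚ.≮⇒≥ 3≮g) (nt C fC)))

module FreeSystems (em₁ : ExcludedMiddle (lsuc 0ℓ)) (F : FinSTS → Set) (nt : ∀ C → F C → Nontrivial C)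
                   {g} (G : Squag (Fin g)) (3<g : 3 < g) (free : Free F (fin G)) (avoid : ∀ C → F C → ¬ Emb G (sq C)) where

  hereditary : ∀ {A C} → Free F A → C ↪ A → Free F C
  hereditary {A} {C} fA f E fE e = fA E fE (_⊚_ {R = sts E} {S = sts C} {T = sts A} f e)

  small : ∀ {n} (Q : Squag (Fin n)) → n ≤ 1 → Free F (fin Q)
  small Q n≤1 C fC e = ℕₚ.<⇒≱ (nt C fC) (ℕₚ.≤-trans (injective⇒≤ {f = proj₁ e} (proj₁ (proj₂ e))) (ℕₚ.≤-trans n≤1 (s≤s z≤n)))

  amalgamate : ∀ {a b c} {A : Squag (Fin a)} {B : Squag (Fin b)} {C : Squag (Fin c)} →
               Free F (fin B) → Free F (fin C) → (f : Emb A B) (f′ : Emb A C) → StrongAmalgam (Free F) f f′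
  amalgamate {B = B} {C} freeB freeC f f′ = record
      { system = amalgam ; member = member ; left = left ; right = right ; commutes = commutes ; meet = meet }
    where
      open Amalgam (lower em₁) G (fibreSystem (lower em₁) G 3<g) f f′
      out : ∀ {E n} {R : Squag (Fin n)} → Emb (sq E) R → E ↪ fin R
      out {E} {R = R} = fromEmb {S = sts E} {T = toSTS R} {Q = sq E} {R = R} (sq-represents E) (toSTS-represents R)
      member : Free F (fin amalgam)
      member E fE e with amalgam-subsystems (sq E) (nt E fE)
                           (toEmb {S = sts E} {T = toSTS amalgam} {Q = sq E} {R = amalgam} (sq-represents E) (toSTS-represents amalgam) _≟_ e)
      ... | inj₁ e′                = freeB E fE (out {E} e′)
      ... | inj₂ (inj₁ e′)         = freeC E fE (out {E} e′)
      ... | inj₂ (inj₂ (inj₁ e′))  = free E fE (out {E} e′)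
      ... | inj₂ (inj₂ (inj₂ e′))  = avoid E fE e′

theorem1 : ExcludedMiddle (lsuc 0ℓ) →
    (F : FinSTS → Set) → (∀ C → F C → Nontrivial C) → Good F →
    AmalgamationClass (Free F) × InfinitelyManyNonIso (Free F) ×
    ∃[ M ] (Homogeneous {ℕ} M × LocallyFinite M × HasAge M (Free F))
theorem1 em₁ F nt good with nontrivial-witness (lower em₁) F nt good
... | g , G , 3<g , free , avoid = amalgamationClass , infinitelyMany , limit , homogeneous , locallyFinite , hasAge
  where
    open FreeSystems em₁ F nt G 3<g free avoid
    open Fraïssé em₁ (Free F) (λ {A} {C} → hereditary {A} {C}) small amalgamate
    open Limit em (Free F) (λ {A} {C} → hereditary {A} {C}) chain sys-member extension
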